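{- Let $n$, $k$, $r$ be positive integers with $n \geq k \geq r > t$ and $r \geq 3$, where $t=\lfloor (n-1)/2\rfloor$. If $H$ is an $n$-vertex $r$-uniform hypergraph with at least $k$ edges such that $\delta(H) \geq \lceil \frac{k}{2} \rceil$, then $c(H)\geq k$.
   Context: A hypergraph is a family of (distinct) subsets, called edges, of a vertex set; it is $r$-uniform if every edge has exactly $r$ vertices. $\delta(H)$ denotes the minimum number of edges containing a vertex. A Berge cycle of length $\ell$ is a list $v_1, e_1, v_2, \ldots, v_\ell, e_\ell, v_1$ of $\ell$ distinct vertices and $\ell$ distinct edges with $\{v_i, v_{i+1}\} \subseteq e_i$ for all $i$ (indices modulo $\ell$). The circumference $c(H)$ is the length of a longest Berge cycle in $H$. -}

module Defs where

open import Data.Nat using (ℕ; zero; suc; _+_; _≤_; _≥_; _>_; _/_; _∸_)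
open import Data.Fin using (Fin; zero; suc)
open import Data.Fin.Subset using (Subset; _∈_; ∣_∣)
open import Data.Fin.Subset.Properties using (_∈?_)
open import Data.Fin.Properties using (any?)
open import Data.List using (List; length; filter; allFin)
open import Data.Product using (Σ; _×_; _,_)
open import Relation.Binary.PropositionalEquality using (_≡_)
open import Function.Definitions using (Injective)

record Hypergraph (n : ℕ) : Set where
  field
    m     : ℕ
    edge  : Fin m → Subset n
    edges-distinct : Injective _≡_ _≡_ edge
open Hypergraph public

Uniform : ∀ {n} → ℕ → Hypergraph n → Set
Uniform r H = ∀ i → ∣ edge H i ∣ ≡ r

degree : ∀ {n} → Hypergraph n → Fin n → ℕ
degree H v = length (filter (λ i → v ∈? edge H i) (allFin (m H)))

MinDegreeAtLeast : ∀ {n} → Hypergraph n → ℕ → Set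
MinDegreeAtLeast H d = ∀ v → d ≤ degree H v

-- successor index modulo ℓ: i ↦ i+1, and the last index ↦ 0
next : ∀ {ℓ} → Fin ℓ → Fin ℓ
next {suc zero} zero = zero
next {suc (suc ℓ)} zero = suc zero
next {suc (suc ℓ)} (suc i) with next {suc ℓ} i
... | zero = zero
... | suc j = suc (suc j)

record BergeCycle {n : ℕ} (H : Hypergraph n) (ℓ : ℕ) : Set where
  field
    vert : Fin ℓ → Fin n
    edg  : Fin ℓ → Fin (m H)
    vert-distinct : Injective _≡_ _≡_ vert
    edg-distinct  : Injective _≡_ _≡_ edg
    vert-in  : ∀ i → vert i ∈ edge H (edg i)
    next-in  : ∀ i → vert (next i) ∈ edge H (edg i)

CircumferenceAtLeast : ∀ {n} → Hypergraph n → ℕ → Set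
CircumferenceAtLeast H k = Σ ℕ λ ℓ → k ≤ ℓ × BergeCycle H ℓ

⌈_/2⌉ : ℕ → ℕ
⌈ k /2⌉ = (k + 1) / 2

{-# OPTIONS --safe #-}

-- Work in the bipartite incidence graph, where vertices have degree ≥ h = ⌈k/2⌉, edges have degree r,
-- there are n ≤ 2r vertices, and distinct edges have distinct neighbourhoods.  A Berge cycle of length ℓ
-- is a graph cycle with 2ℓ nodes.  Let D be a longest one and suppose ℓ < k.
--   * An edge f outside D meets D: edges have at least n/2 vertices, so f meets all edges of D but at most
--     one, and detours through f would lengthen D.
--   * There is no cycle outside D with more than ℓ nodes: such a cycle is attached to D at a single vertex,
--     and counting vertices forces all edges of D to coincide.
--   * Let Q be a longest path outside D.  All further neighbours of its ends lie on D, and a neighbour of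
--     one end and a neighbour of the other are more than |Q| apart on D, since otherwise D could be
--     rerouted through Q.  Charging the nodes of D to these neighbours contradicts the degree conditions
--     unless Q is a vertex u on a single edge f, with n = ℓ + 1; exchanging f for an edge of D then makes
--     u isolated outside D.
--   * If a vertex u and an edge f have all their neighbours on D, then at most one edge of D contains u and
--     is followed by a vertex of f (crossing chords).  Counting shows that every edge of D contains u or is
--     followed by a vertex of f, and exchanging f for an edge e ∌ u of D yields e = f, a contradiction.
module Submission where

open import Defs
open import Data.Bool using (Bool; true; false; not; if_then_else_)
import Data.Bool.Properties as BoolP
open import Data.Empty using (⊥; ⊥-elim)
open import Data.Fin using (Fin; zero; suc)
import Data.Fin.Properties as FinP
open import Data.Fin.Subset as Subset using (Subset; ∣_∣; inside; outside)
open import Data.Fin.Subset.Properties using (⊆-antisym; p⊂q⇒∣p∣<∣q∣) renaming (_∈?_ to _∈ˢ?_)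
open import Data.List using (List; []; _∷_; _++_; length; filter; reverse; map; allFin; lookup; tabulate)
import Data.List.Membership.DecPropositional as DecMembership
open import Data.List.Membership.Propositional using (_∈_; _∉_; find; lose)
open import Data.List.Membership.Propositional.Properties using (∈-++⁺ˡ; ∈-++⁺ʳ; ∈-++⁻; ∈-∃++; ∈-filter⁺; ∈-filter⁻; ∈-insert; ∈-map⁺; ∈-map⁻; ∈-allFin; ∈-lookup)
open import Data.List.Properties using (length-++; ++-assoc; ++-identityʳ; unfold-reverse; length-reverse; reverse-++; ∷-injectiveʳ; map-tabulate; length-map; length-tabulate)
open import Data.List.Relation.Binary.Permutation.Propositional using (_↭_; ↭-refl; ↭-sym; ↭-trans; ↭-reflexive; ↭⇒↭ₛ; prep; swap)
open import Data.List.Relation.Binary.Permutation.Propositional.Properties using (∈-resp-↭; ↭-length; ↭-reverse; shift; ++⁺ˡ; ++⁺ʳ; filter-↭) renaming (++-comm to ↭-++-comm)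
import Data.List.Relation.Binary.Permutation.Setoid.Properties as PermS
open import Data.List.Relation.Unary.All as All using (All; []; _∷_)
open import Data.List.Relation.Unary.AllPairs using (AllPairs; []; _∷_; allPairs?)
open import Data.List.Relation.Unary.Any using (here; there; any?)
open import Data.List.Relation.Unary.Unique.Propositional using (Unique)
import Data.List.Relation.Unary.Unique.Propositional.Properties as Uniq
open import Data.Maybe using (Maybe; just; nothing)
import Data.Maybe.Properties as MaybeP
open import Data.Nat using (ℕ; zero; suc; _+_; _*_; _∸_; _/_; _≤_; _<_; z≤n; s≤s; s≤s⁻¹)
open import Data.Nat.DivMod using (_%_; m≡m%n+[m/n]*n; m%n<n; /-monoˡ-≤)
open import Data.Nat.Properties hiding (_≟_)
open import Data.Nat.Tactic.RingSolver using (solve-∀)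
open import Data.Product using (∃; _×_; _,_; proj₁; proj₂)
open import Data.Sum using (_⊎_; inj₁; inj₂; [_,_]′)
open import Data.Sum.Properties using (inj₁-injective; inj₂-injective) renaming (≡-dec to ⊎-≡-dec)
open import Data.Vec using ([]; _∷_)
open import Function using (case_of_)
open import Function.Definitions using (Injective)
open import Relation.Binary.Definitions using (DecidableEquality)
open import Relation.Binary.PropositionalEquality using (_≡_; _≢_; refl; sym; trans; cong; cong₂; subst; subst₂; setoid)
open import Relation.Nullary using (¬_; ¬?; _×-dec_; Dec; yes; no; does; contradiction)
open import Relation.Nullary.Decidable using (map′)

-- The hypothesis `r > t` acts through `n ≤ 2r`, both in counts and as a covering property: two
-- disjoint edges exhaust the vertices, and two edges with one common vertex miss at most one.
-- Uniformity makes an edge that is contained in another equal to it. Vertices have no such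
-- property, since two of them may lie in exactly the same edges, and this asymmetry shapes the
-- treatment of Q. For two edge ends the charging is contradictory outright, distinctness supplying
-- the last missing unit. For two vertex ends it shows only that they have the same neighbours on D;
-- the contradiction then needs the edge before the last vertex and rotations of the path.
-- Neighbours of an end that lie on Q are lost to the count on D, up to half of the nodes of Q. The
-- long gaps on D between neighbours of different ends pay for this loss. The argument refutes the
-- absence of a long cycle, and an exhaustive search over node lists turns the refutation into a
-- cycle.

-- Farkas certificate: a ≤ b is absurd once a ≡ 1 + b + c is a ring identity.
≤-absurd : ∀ {a b} c → a ≤ b → a ≡ suc (b + c) → ⊥
≤-absurd {b = b} c p refl = <-irrefl refl (≤-trans (s≤s (m≤m+n b c)) p)

-- Lists without repetitions

module _ {A : Set} where

  Unique-resp-↭ : {xs ys : List A} → xs ↭ ys → Unique xs → Unique ys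
  Unique-resp-↭ p = PermS.Unique-resp-↭ (setoid A) (↭⇒↭ₛ p)

  Unique-++⁻ˡ : ∀ (xs : List A) {ys} → Unique (xs ++ ys) → Unique xs
  Unique-++⁻ˡ []       u       = []
  Unique-++⁻ˡ (x ∷ xs) (p ∷ u) = All.tabulate (λ y∈ → All.lookup p (∈-++⁺ˡ y∈)) ∷ Unique-++⁻ˡ xs u

  Unique-++⁻ʳ : ∀ (xs : List A) {ys} → Unique (xs ++ ys) → Unique ys
  Unique-++⁻ʳ []       u       = u
  Unique-++⁻ʳ (x ∷ xs) (p ∷ u) = Unique-++⁻ʳ xs u

  ∷-Unique : ∀ {x} {xs : List A} → x ∉ xs → Unique xs → Unique (x ∷ xs)
  ∷-Unique x∉ u = All.tabulate (λ y∈ → λ where refl → x∉ y∈) ∷ u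

  Unique-head∉ : ∀ {x} {xs : List A} → Unique (x ∷ xs) → x ∉ xs
  Unique-head∉ (p ∷ u) x∈ = All.lookup p x∈ refl

  ++-Unique : ∀ {xs ys : List A} → Unique xs → Unique ys → (∀ {x} → x ∈ xs → x ∉ ys) → Unique (xs ++ ys)
  ++-Unique u v d = Uniq.++⁺ u v (λ (p , q) → d p q)

  ∈-delete : ∀ xs {ys} {x y : A} → y ∈ xs ++ x ∷ ys → y ≢ x → y ∈ xs ++ ys
  ∈-delete xs y∈ y≢x with ∈-++⁻ xs y∈
  ... | inj₁ p          = ∈-++⁺ˡ p
  ... | inj₂ (here eq)  = contradiction eq y≢x
  ... | inj₂ (there p)  = ∈-++⁺ʳ xs p

  Unique-⊆⇒length≤ : ∀ {xs ys : List A} → Unique xs → (∀ {x} → x ∈ xs → x ∈ ys) → length xs ≤ length ys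
  Unique-⊆⇒length≤ {[]}     u       sub = z≤n
  Unique-⊆⇒length≤ {x ∷ xs} (p ∷ u) sub with ∈-∃++ (sub (here refl))
  ... | as , bs , refl = begin
    suc (length xs)              ≤⟨ s≤s (Unique-⊆⇒length≤ u λ y∈ → ∈-delete as (sub (there y∈)) (λ y≡x → All.lookup p y∈ (sym y≡x))) ⟩
    suc (length (as ++ bs))      ≡⟨ cong suc (length-++ as) ⟩
    suc (length as + length bs)  ≡⟨ sym (+-suc (length as) (length bs)) ⟩
    length as + suc (length bs)  ≡⟨ sym (length-++ as) ⟩
    length (as ++ x ∷ bs)        ∎
    where open ≤-Reasoning

  split-last : {P : A → Set} (P? : ∀ x → Dec (P x)) {xs : List A} {x : A} → x ∈ xs → P x →
    ∃ λ as → ∃ λ y → ∃ λ bs → xs ≡ as ++ y ∷ bs × P y × (∀ {z} → z ∈ bs → ¬ P z)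
  split-last P? {y ∷ ys} x∈ px with any? P? ys | x∈
  ... | no none | here refl  = [] , y , ys , refl , px , λ z∈ pz → none (lose z∈ pz)
  ... | no none | there x∈ys = contradiction (lose x∈ys px) none
  ... | yes some | _ with find some
  ... | z , z∈ , pz with split-last P? z∈ pz
  ... | as , w , bs , refl , pw , none = y ∷ as , w , bs , refl , pw , none

-- Bipartite graphs: walks, cycles and their rerouting

record BipartiteGraph : Set₁ where
  field
    Node     : Set
    _≟_      : DecidableEquality Node
    isV      : Node → Bool
    Adj      : Node → Node → Set
    adj?     : ∀ a b → Dec (Adj a b)
    adj-sym  : ∀ {a b} → Adj a b → Adj b a
    adj-flip : ∀ {a b} → Adj a b → isV a ≡ not (isV b)

module Walks (G : BipartiteGraph) where
  open BipartiteGraph G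

  data Walk : Node → Node → List Node → Set where
    [_] : ∀ a → Walk a a (a ∷ [])
    _∷_ : ∀ {a b c l} → Adj a b → Walk b c l → Walk a c (a ∷ l)

  walk-++ : ∀ {a b c d k l} → Walk a b k → Adj b c → Walk c d l → Walk a d (k ++ l)
  walk-++ [ a ]   e v = e ∷ v
  walk-++ (f ∷ w) e v = f ∷ walk-++ w e v

  walk-reverse : ∀ {a b l} → Walk a b l → Walk b a (reverse l)
  walk-reverse [ a ] = [ a ]
  walk-reverse (_∷_ {a} {l = l} e w) rewrite unfold-reverse a l = walk-++ (walk-reverse w) (adj-sym e) [ a ]

  walk-head : ∀ {a b x l} → Walk a b (x ∷ l) → a ≡ x
  walk-head [ a ]   = refl
  walk-head (e ∷ w) = refl

  walk-first∈ : ∀ {a b l} → Walk a b l → a ∈ l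
  walk-first∈ [ a ]   = here refl
  walk-first∈ (e ∷ w) = here refl

  walk-last∈ : ∀ {a b l} → Walk a b l → b ∈ l
  walk-last∈ [ a ]   = here refl
  walk-last∈ (e ∷ w) = there (walk-last∈ w)

  walk-drop : ∀ {a b} k {x l} → Walk a b (k ++ x ∷ l) → Walk x b (x ∷ l)
  walk-drop []          w       with walk-head w
  ... | refl = w
  walk-drop (y ∷ [])    (e ∷ w) = walk-drop [] w
  walk-drop (y ∷ z ∷ k) (e ∷ w) = walk-drop (z ∷ k) w

  walk-step : ∀ {a b x y l} → Walk a b (x ∷ y ∷ l) → Adj x y
  walk-step (e ∷ w) with walk-head w
  ... | refl = e

  walk-cut : ∀ {a b} c k {x l} → Walk a b (c ∷ k ++ x ∷ l) →
    ∃ λ y → Walk a y (c ∷ k) × Adj y x × Walk x b (x ∷ l)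
  walk-cut c []      (e ∷ w) with walk-head w
  ... | refl = c , [ c ] , e , w
  walk-cut c (d ∷ k) (e ∷ w) with walk-cut d k w
  ... | y , w₁ , e₁ , w₂ = y , e ∷ w₁ , e₁ , w₂

  walk-take : ∀ {a b} k {x l} → Walk a b (k ++ x ∷ l) → Walk a x (k ++ x ∷ [])
  walk-take []      w with walk-head w
  ... | refl = [ _ ]
  walk-take (c ∷ k) w with walk-cut c k w
  ... | y , w₁ , e , _ = walk-++ w₁ e [ _ ]

  walk-unsnoc : ∀ {a b c} k {x} → Walk a b (c ∷ k ++ x ∷ []) → b ≡ x × ∃ λ y → Walk a y (c ∷ k) × Adj y x
  walk-unsnoc c w with walk-cut _ c w
  ... | y , w₁ , e , [ _ ] = refl , y , w₁ , e

  -- Two adjacent nodes already form a `Cycle`, because the closing step may run back along the only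
  -- step of the walk. This is why later statements ask for `4 ≤ length D`.
  record Cycle (l : List Node) : Set where
    field
      {first last} : Node
      walk  : Walk first last l
      close : Adj last first
      uniq  : Unique l
  open Cycle public

  rotate : ∀ k {x l} → Cycle (k ++ x ∷ l) → Cycle (x ∷ l ++ k)
  rotate []      {x} {l} c = subst Cycle (sym (++-identityʳ (x ∷ l))) c
  rotate (y ∷ k) {x} {l} c with walk-head (walk c) | walk-cut y k (walk c)
  ... | refl | z , w₁ , e , w₂ = record
    { walk  = walk-++ w₂ (close c) w₁
    ; close = e
    ; uniq  = Unique-resp-↭ (↭-++-comm (y ∷ k) (x ∷ l)) (uniq c) }

  rotate-to : ∀ {x D} → Cycle D → x ∈ D → ∃ λ w → Cycle (x ∷ w) × x ∷ w ↭ D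
  rotate-to {x} c x∈ with ∈-∃++ x∈
  ... | k , l , refl = l ++ k , rotate k c , ↭-++-comm (x ∷ l) k

  cycle-reverse : ∀ {D} → Cycle D → Cycle (reverse D)
  cycle-reverse {D} c = record
    { walk  = walk-reverse (walk c)
    ; close = adj-sym (close c)
    ; uniq  = Unique-resp-↭ (↭-sym (↭-reverse D)) (uniq c) }

  record PathOff (D : List Node) (a b : Node) (Q : List Node) : Set where
    constructor pathOff
    field
      pwalk : Walk a b Q
      puniq : Unique Q
      off   : ∀ {x} → x ∈ Q → x ∉ D
  open PathOff public

  pathOff-reverse : ∀ {D a b Q} → PathOff D a b Q → PathOff D b a (reverse Q)
  pathOff-reverse {Q = Q} (pathOff w u o) =
    pathOff (walk-reverse w) (Unique-resp-↭ (↭-sym (↭-reverse Q)) u) (λ x∈ → o (∈-resp-↭ (↭-reverse Q) x∈))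

  pathOff-↭ : ∀ {D D′ a b Q} → D ↭ D′ → PathOff D a b Q → PathOff D′ a b Q
  pathOff-↭ p (pathOff w u o) = pathOff w u (λ x∈ x∈D → o x∈ (∈-resp-↭ (↭-sym p) x∈D))

  -- The arc `M` strictly between `α` and `β` is replaced by `Q`; the result is listed from `β`.
  reroute : ∀ {α M β R a b Q} → Cycle (α ∷ M ++ β ∷ R) → PathOff (α ∷ M ++ β ∷ R) a b Q →
    Adj α a → Adj b β → Cycle (β ∷ R ++ α ∷ Q)
  reroute {α} {M} {β} {R} {Q = Q} c (pathOff w u o) αa bβ with walk-cut α M (walk c) | walk-head (walk c)
  ... | _ , _ , _ , w₂ | refl = record
    { walk  = walk-++ w₂ (close c) (αa ∷ w)
    ; close = bβ
    ; uniq  = ++-Unique (Unique-++⁻ʳ (α ∷ M) (uniq c)) (∷-Unique (λ α∈ → o α∈ (here refl)) u)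
        λ { x∈ (here refl) → Unique-head∉ (uniq c) (∈-++⁺ʳ M x∈)
          ; x∈ (there x∈Q) → o x∈Q (∈-++⁺ʳ (α ∷ M) x∈) } }

  attach : ∀ {α D a b Q} → α ∈ D → PathOff D a b Q → Adj α a → Adj b α → Cycle (α ∷ Q)
  attach α∈ (pathOff w u o) αa bα = record
    { walk = αa ∷ w ; close = bα ; uniq = ∷-Unique (λ α∈Q → o α∈Q α∈) u }

  -- D = e ∷ v ∷ M ++ e′ ∷ v′ ∷ R; the new cycle is u e ←R v′ f v M→ e′.
  cross : ∀ {e v M e′ v′ R u f} → Cycle (e ∷ v ∷ M ++ e′ ∷ v′ ∷ R) →
    u ∉ (e ∷ v ∷ M ++ e′ ∷ v′ ∷ R) → f ∉ (e ∷ v ∷ M ++ e′ ∷ v′ ∷ R) → u ≢ f →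
    Adj u e → Adj u e′ → Adj f v → Adj f v′ →
    ∃ λ D → Cycle D × length D ≡ 2 + length (e ∷ v ∷ M ++ e′ ∷ v′ ∷ R)
  cross {e} {v} {M} {e′} {v′} {R} {u} {f} c u∉ f∉ u≢f ue ue′ fv fv′
    with walk-head (walk c) | walk-cut e (v ∷ M) (walk c)
  ... | refl | y , (ev ∷ w₁) , ye′ , (e′v′ ∷ w₂) with walk-head w₁ | walk-head w₂
  ... | refl | refl = D , record { walk = W ; close = adj-sym ue′ ; uniq = Unique-resp-↭ (↭-sym perm) U } , len
    where
    D = u ∷ e ∷ reverse (v′ ∷ R) ++ f ∷ (v ∷ M) ++ e′ ∷ []
    W : Walk u e′ D
    W = ue ∷ walk-++ [ e ] (adj-sym (close c))
          (walk-++ (walk-reverse w₂) (adj-sym fv′) (fv ∷ walk-++ w₁ ye′ [ e′ ]))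
    old = e ∷ v ∷ M ++ e′ ∷ v′ ∷ R
    perm : D ↭ u ∷ f ∷ old
    perm = prep u (↭-trans (prep e (↭-trans (shift f (reverse (v′ ∷ R)) ((v ∷ M) ++ e′ ∷ []))
             (prep f (↭-trans (↭-++-comm (reverse (v′ ∷ R)) ((v ∷ M) ++ e′ ∷ []))
               (↭-trans (++⁺ˡ ((v ∷ M) ++ e′ ∷ []) (↭-reverse (v′ ∷ R)))
                 (↭-reflexive (++-assoc (v ∷ M) (e′ ∷ []) (v′ ∷ R))))))))
             (swap e f ↭-refl))
    U : Unique (u ∷ f ∷ old)
    U = ∷-Unique (λ { (here refl) → u≢f refl ; (there u∈) → u∉ u∈ }) (∷-Unique f∉ (uniq c))
    len : length D ≡ 2 + length old
    len = ↭-length perm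

-- Charging the nodes of a cycle to labelled nodes

data Class : Set where
  both left right : Class

_≟ᶜ_ : DecidableEquality Class
both  ≟ᶜ both  = yes refl
both  ≟ᶜ left  = no λ ()
both  ≟ᶜ right = no λ ()
left  ≟ᶜ both  = no λ ()
left  ≟ᶜ left  = yes refl
left  ≟ᶜ right = no λ ()
right ≟ᶜ both  = no λ ()
right ≟ᶜ left  = no λ ()
right ≟ᶜ right = yes refl

-- cost c c′ is a lower bound for the cyclic distance on D from a node of class c to one of class c′.
module Charging (G : BipartiteGraph)
  (cls : BipartiteGraph.Node G → Maybe Class) (cost : Class → Class → ℕ) (D : List (BipartiteGraph.Node G))
  (sep≠ : ∀ {z M z′ R c c′} → Walks.Cycle G (z ∷ M ++ z′ ∷ R) → z ∷ M ++ z′ ∷ R ↭ D →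
    cls z ≡ just c → cls z′ ≡ just c′ → cost c c′ ≤ suc (length M))
  (sep= : ∀ {z M c} → Walks.Cycle G (z ∷ M) → z ∷ M ↭ D → cls z ≡ just c → cost c c ≤ suc (length M))
  where
  open BipartiteGraph G
  open Walks G

  cls? : ∀ c x → Dec (cls x ≡ just c)
  cls? c x = MaybeP.≡-dec _≟ᶜ_ (cls x) (just c)

  num : Class → List Node → ℕ
  num c l = length (filter (cls? c) l)

  -- The empty list is charged for the passage that closes the cycle, back to its starting node of
  -- class `c₀`.
  need : Class → Class → List Node → ℕ
  need c c₀ []      = cost c c₀
  need c c₀ (y ∷ w) with cls y
  ... | nothing = need c c₀ w
  ... | just c′ = cost c c′ + need c′ c₀ w

  -- The labelled nodes cut `D` into arcs, and the classes at the two ends of an arc bound its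
  -- length from below.
  need-≤ : ∀ {z₀ w c₀} → Cycle (z₀ ∷ w) → z₀ ∷ w ↭ D → cls z₀ ≡ just c₀ → need c₀ c₀ w ≤ suc (length w)
  need-≤ {z₀} {w} {c₀} cy perm cz₀ = go [] z₀ [] w refl cz₀
    where
    turn : ∀ pre {l} → pre ++ l ≡ z₀ ∷ w → l ++ pre ↭ D
    turn pre {l} eq = ↭-trans (↭-++-comm l pre) (↭-trans (↭-reflexive eq) perm)

    -- Here `z` is the last labelled node met so far and `M` collects the unlabelled nodes after it.
    go : ∀ pre z M w₂ {c} → pre ++ z ∷ M ++ w₂ ≡ z₀ ∷ w → cls z ≡ just c →
      need c c₀ w₂ ≤ suc (length M + length w₂)
    go pre z M [] eq cz rewrite ++-identityʳ M | +-identityʳ (length M) with pre | eq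
    -- `pre` is still empty only if no labelled node follows `z₀`, so the single arc runs from `z₀`
    -- to itself.
    ... | []    | refl with trans (sym cz) cz₀
    ...   | refl = sep= cy perm cz
    go pre z M [] eq cz | _ ∷ p | refl = sep≠ (rotate (z₀ ∷ p) cy) (turn (z₀ ∷ p) refl) cz cz₀
    go pre z M (y ∷ w₂) {c} eq cz with cls y in cy′
    ... | nothing = subst (λ t → need c c₀ w₂ ≤ suc t)
          (trans (cong (_+ length w₂) (length-++ M)) (+-assoc (length M) 1 (length w₂)))
          (go pre z (M ++ y ∷ []) w₂ (trans (cong (λ t → pre ++ z ∷ t) (++-assoc M (y ∷ []) w₂)) eq) cz)
    ... | just c′ = +-mono-≤
          (sep≠ (subst Cycle assoc (rotate pre (subst Cycle (sym eq) cy)))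
                (subst (_↭ D) assoc (turn pre eq)) cz cy′)
          (go (pre ++ z ∷ M) y [] w₂ (trans (++-assoc pre (z ∷ M) (y ∷ w₂)) eq) cy′)
      where
      assoc : z ∷ (M ++ y ∷ w₂) ++ pre ≡ z ∷ M ++ y ∷ (w₂ ++ pre)
      assoc = ++-assoc (z ∷ M) (y ∷ w₂) pre

  -- ω is charged for every labelled node and ε for every passage to another class; κ telescopes around D.
  module Weights (ω ε κ : Class → ℕ)
    (stay  : ∀ c → ω c ≤ cost c c)
    (leave : ∀ {c c′} → c ≢ c′ → ω c + ε c + κ c′ ≤ cost c c′ + κ c) where

    exit : Class → Class → ℕ
    exit c c′ with c ≟ᶜ c′
    ... | yes _ = 0
    ... | no  _ = ε c

    exits : Class → Class → List Node → ℕ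
    exits c c₀ []      = exit c c₀
    exits c c₀ (y ∷ w) with cls y
    ... | nothing = exits c c₀ w
    ... | just c′ = exit c c′ + exits c′ c₀ w

    weight : List Node → ℕ
    weight []      = 0
    weight (y ∷ w) with cls y
    ... | nothing = weight w
    ... | just c  = ω c + weight w

    step : ∀ c c′ → ω c + exit c c′ + κ c′ ≤ cost c c′ + κ c
    step c c′ with c ≟ᶜ c′
    ... | yes refl rewrite +-identityʳ (ω c) = +-monoˡ-≤ (κ c) (stay c)
    ... | no  c≢c′ = leave c≢c′

    charged : ∀ c c₀ w → ω c + weight w + exits c c₀ w + κ c₀ ≤ need c c₀ w + κ c
    charged c c₀ [] rewrite +-identityʳ (ω c) = step c c₀
    charged c c₀ (y ∷ w) with cls y
    ... | nothing = charged c c₀ w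
    ... | just c′ = +-cancelʳ-≤ (κ c′) _ _ (begin
      ω c + (ω c′ + weight w) + (exit c c′ + exits c′ c₀ w) + κ c₀ + κ c′
        ≡⟨ solve₁ (ω c) (ω c′) (weight w) (exit c c′) (exits c′ c₀ w) (κ c₀) (κ c′) ⟩
      (ω c + exit c c′ + κ c′) + (ω c′ + weight w + exits c′ c₀ w + κ c₀)
        ≤⟨ +-mono-≤ (step c c′) (charged c′ c₀ w) ⟩
      (cost c c′ + κ c) + (need c′ c₀ w + κ c′)
        ≡⟨ solve₂ (cost c c′) (κ c) (need c′ c₀ w) (κ c′) ⟩
      cost c c′ + need c′ c₀ w + κ c + κ c′ ∎)
      where
      open ≤-Reasoning
      solve₁ : ∀ a b c d e f g → a + (b + c) + (d + e) + f + g ≡ (a + d + g) + (b + c + e + f)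
      solve₁ = solve-∀
      solve₂ : ∀ a b c d → (a + b) + (c + d) ≡ a + c + b + d
      solve₂ = solve-∀

    exit-≢ : ∀ {c c′} → c ≢ c′ → ε c ≤ exit c c′
    exit-≢ {c} {c′} c≢ with c ≟ᶜ c′
    ... | yes eq = contradiction eq c≢
    ... | no  _  = ≤-refl

    exits-from : ∀ {c c₀} w → c ≢ c₀ → ε c ≤ exits c c₀ w
    exits-from []      c≢ = exit-≢ c≢
    exits-from {c} {c₀} (y ∷ w) c≢ with cls y
    ... | nothing = exits-from w c≢
    ... | just c′ with c ≟ᶜ c′
    ...   | yes refl = exits-from w c≢
    ...   | no  _    = m≤m+n (ε c) _

    exits-later : ∀ {d c c₀} w {x} → d ≢ c₀ → x ∈ w → cls x ≡ just d → ε d ≤ exits c c₀ w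
    exits-later {d} (y ∷ w) d≢ (here refl) eq with cls y
    exits-later {d} {c} (y ∷ w) d≢ (here refl) refl | just .d =
      ≤-trans (exits-from w d≢) (m≤n+m _ (exit c d))
    exits-later {d} {c} (y ∷ w) d≢ (there x∈) eq with cls y
    ... | nothing = exits-later w d≢ x∈ eq
    ... | just c′ = ≤-trans (exits-later w d≢ x∈ eq) (m≤n+m _ (exit c c′))

    -- A closed tour that starts in class `c₀` and meets class `d` leaves `c₀` before it reaches
    -- `d`, and leaves `d` before it returns.
    exits-both : ∀ {d c₀} w {x} → d ≢ c₀ → x ∈ w → cls x ≡ just d → ε c₀ + ε d ≤ exits c₀ c₀ w
    exits-both {d} {c₀} (y ∷ w) d≢ (here refl) eq with cls y
    exits-both {d} {c₀} (y ∷ w) d≢ (here refl) refl | just .d =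
      +-mono-≤ (exit-≢ (λ eq → d≢ (sym eq))) (exits-from w d≢)
    exits-both {d} {c₀} (y ∷ w) d≢ (there x∈) eq with cls y
    ... | nothing = exits-both w d≢ x∈ eq
    ... | just c′ with c₀ ≟ᶜ c′
    ...   | yes refl = exits-both w d≢ x∈ eq
    ...   | no  c₀≢  = +-monoʳ-≤ (ε c₀) (exits-later w d≢ x∈ eq)

    total : List Node → ℕ
    total l = ω both * num both l + ω left * num left l + ω right * num right l

    weight-total : ∀ l → weight l ≡ total l
    weight-total [] = sym (solve₀ (ω both) (ω left) (ω right))
      where
      solve₀ : ∀ a b c → a * 0 + b * 0 + c * 0 ≡ 0
      solve₀ = solve-∀
    weight-total (y ∷ l) with cls y
    ... | nothing = weight-total l
    ... | just both  = trans (cong (ω both +_) (weight-total l))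
                         (eq (ω both) (ω left) (ω right) (num both l) (num left l) (num right l))
      where
      eq : ∀ a b c x y z → a + (a * x + b * y + c * z) ≡ a * suc x + b * y + c * z
      eq = solve-∀
    ... | just left  = trans (cong (ω left +_) (weight-total l))
                         (eq (ω both) (ω left) (ω right) (num both l) (num left l) (num right l))
      where
      eq : ∀ a b c x y z → b + (a * x + b * y + c * z) ≡ a * x + b * suc y + c * z
      eq = solve-∀
    ... | just right = trans (cong (ω right +_) (weight-total l))
                         (eq (ω both) (ω left) (ω right) (num both l) (num left l) (num right l))
      where
      eq : ∀ a b c x y z → c + (a * x + b * y + c * z) ≡ a * x + b * y + c * suc z
      eq = solve-∀

    num-↭ : ∀ c {l l′} → l ↭ l′ → num c l ≡ num c l′
    num-↭ c p = ↭-length (filter-↭ (cls? c) p)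

    total-↭ : ∀ {l l′} → l ↭ l′ → total l ≡ total l′
    total-↭ {l} {l′} p rewrite num-↭ both p | num-↭ left p | num-↭ right p = refl

    weight-cons : ∀ {z c} w → cls z ≡ just c → ω c + weight w ≡ weight (z ∷ w)
    weight-cons {z} w eq with cls z
    weight-cons {z} w refl | just c = refl

    module _ (cy : Cycle D) {z₀ c₀} (z₀∈ : z₀ ∈ D) (cz₀ : cls z₀ ≡ just c₀) where

      bound : ∀ {w x} → Cycle (z₀ ∷ w) → z₀ ∷ w ↭ D → x ≤ exits c₀ c₀ w → total D + x ≤ length D
      bound {w} {x} cy′ perm x≤ = begin
        total D + x                          ≡⟨ cong (_+ x) (sym (total-↭ perm)) ⟩
        total (z₀ ∷ w) + x                   ≡⟨ cong (_+ x) (sym (weight-total (z₀ ∷ w))) ⟩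
        weight (z₀ ∷ w) + x                  ≡⟨ cong (_+ x) (sym (weight-cons w cz₀)) ⟩
        ω c₀ + weight w + x                  ≤⟨ +-monoʳ-≤ (ω c₀ + weight w) x≤ ⟩
        ω c₀ + weight w + exits c₀ c₀ w      ≤⟨ +-cancelʳ-≤ (κ c₀) _ _ (charged c₀ c₀ w) ⟩
        need c₀ c₀ w                         ≤⟨ need-≤ cy′ perm cz₀ ⟩
        length (z₀ ∷ w)                      ≡⟨ ↭-length perm ⟩
        length D                             ∎
        where open ≤-Reasoning

      one-class : total D ≤ length D
      one-class with rotate-to cy z₀∈
      ... | w , cy′ , perm = subst (_≤ length D) (+-identityʳ (total D)) (bound cy′ perm z≤n)

      two-classes : ∀ {x d} → x ∈ D → cls x ≡ just d → d ≢ c₀ → total D + (ε c₀ + ε d) ≤ length D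
      two-classes {x} x∈ cx d≢ with rotate-to cy z₀∈
      ... | w , cy′ , perm = bound cy′ perm (exits-both w d≢ (tail∈ (∈-resp-↭ (↭-sym perm) x∈)) cx)
        where
        tail∈ : x ∈ z₀ ∷ w → x ∈ w
        tail∈ (here refl) with trans (sym cx) cz₀
        ... | refl = contradiction refl d≢
        tail∈ (there x∈w) = x∈w

-- Counting the two sides, and gaps on a longest cycle

module Counting (G : BipartiteGraph) where
  open BipartiteGraph G
  open Walks G

  V E : Node → Set
  V x = isV x ≡ true
  E x = isV x ≡ false

  V≢E : ∀ {x} → V x → E x → ⊥
  V≢E p q with trans (sym p) q
  ... | ()

  adj-V : ∀ {a b} → Adj a b → V a → E b
  adj-V {a} {b} e v with isV b | trans (sym v) (adj-flip e)
  ... | false | _ = refl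

  adj-E : ∀ {a b} → Adj a b → E a → V b
  adj-E {a} {b} e v with isV b | trans (sym v) (adj-flip e)
  ... | true | _ = refl

  adj-irrefl : ∀ {a} → ¬ Adj a a
  adj-irrefl {a} e = BoolP.not-¬ {isV a} refl (adj-flip e)

  adj-common : ∀ {a x y} → Adj a x → Adj a y → ¬ Adj x y
  adj-common {a} {x} {y} ax ay xy with isV a | isV x | isV y | adj-flip ax | adj-flip ay | adj-flip xy
  ... | true  | false | false | _ | _ | ()
  ... | false | true  | true  | _ | _ | ()

  vs es : List Node → ℕ
  vs []      = 0
  vs (x ∷ l) = if isV x then suc (vs l) else vs l
  es []      = 0
  es (x ∷ l) = if isV x then es l else suc (es l)

  length-vs-es : ∀ l → length l ≡ vs l + es l
  length-vs-es [] = refl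
  length-vs-es (x ∷ l) with isV x
  ... | true  = cong suc (length-vs-es l)
  ... | false = trans (cong suc (length-vs-es l)) (sym (+-suc (vs l) (es l)))

  ι : Node → ℕ
  ι x = if isV x then 1 else 0

  -- Sides alternate along a walk, so the surplus of one side depends only on the two ends; the
  -- equation is arranged to avoid subtraction.
  walk-balance : ∀ {a b l} → Walk a b l → es l + (ι a + ι b) ≡ suc (vs l)
  walk-balance [ a ] with isV a
  ... | true  = refl
  ... | false = refl
  walk-balance (_∷_ {a} {b} {c} {l} e w) with isV a | isV b | adj-flip e | walk-balance w
  ... | true  | false | _ | ih = trans (+-suc (es l) (ι c)) (cong suc ih)
  ... | false | true  | _ | ih = trans (sym (+-suc (es l) (ι c))) ih

  walk-VV : ∀ {a b l} → Walk a b l → V a → V b → vs l ≡ suc (es l)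
  walk-VV {a} {b} {l} w va vb with isV a | isV b | va | vb | walk-balance w
  ... | true | true | _ | _ | eq = suc-injective (trans (sym eq) (+-comm (es l) 2))

  walk-EE : ∀ {a b l} → Walk a b l → E a → E b → es l ≡ suc (vs l)
  walk-EE {a} {b} {l} w va vb with isV a | isV b | va | vb | walk-balance w
  ... | false | false | _ | _ | eq = trans (sym (+-identityʳ (es l))) eq

  walk-VE : ∀ {a b l} → Walk a b l → V a → E b → es l ≡ vs l
  walk-VE {a} {b} {l} w va vb with isV a | isV b | va | vb | walk-balance w
  ... | true | false | _ | _ | eq = suc-injective (trans (+-comm 1 (es l)) eq)

  cycle-balance : ∀ {l} → Cycle l → es l ≡ vs l
  cycle-balance {l} c with isV (first c) | isV (last c) | adj-flip (close c) | walk-balance (walk c)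
  ... | true  | false | _ | eq = suc-injective (trans (+-comm 1 (es l)) eq)
  ... | false | true  | _ | eq = suc-injective (trans (+-comm 1 (es l)) eq)

  cycle-length : ∀ {l} → Cycle l → length l ≡ vs l + vs l
  cycle-length {l} c = trans (length-vs-es l) (cong (vs l +_) (cycle-balance c))

  infix 8 _#_
  _#_ : Node → List Node → ℕ
  a # l = length (filter (adj? a) l)

  #-≤vs : ∀ {a} l → E a → a # l ≤ vs l
  #-≤vs [] ea = z≤n
  #-≤vs {a} (x ∷ l) ea with adj? a x
  ... | yes ax rewrite adj-E ax ea = s≤s (#-≤vs l ea)
  ... | no _ with isV x
  ...   | true  = m≤n⇒m≤1+n (#-≤vs l ea)
  ...   | false = #-≤vs l ea

  #-≤es : ∀ {a} l → V a → a # l ≤ es l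
  #-≤es [] ea = z≤n
  #-≤es {a} (x ∷ l) ea with adj? a x
  ... | yes ax rewrite adj-V ax ea = s≤s (#-≤es l ea)
  ... | no _ with isV x
  ...   | true  = #-≤es l ea
  ...   | false = m≤n⇒m≤1+n (#-≤es l ea)

  #-full-vs : ∀ {a} l → E a → vs l ≤ a # l → ∀ {x} → x ∈ l → V x → Adj a x
  #-full-vs {a} (y ∷ l) ea full x∈ vx with adj? a y
  #-full-vs {a} (y ∷ l) ea full (here refl) vx | yes ay = ay
  #-full-vs {a} (y ∷ l) ea full (there x∈) vx | yes ay rewrite adj-E ay ea = #-full-vs l ea (s≤s⁻¹ full) x∈ vx
  #-full-vs {a} (y ∷ l) ea full (here refl) vx | no _ rewrite vx = ⊥-elim (<-irrefl refl (≤-trans full (#-≤vs l ea)))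
  #-full-vs {a} (y ∷ l) ea full (there x∈) vx | no _ with isV y
  ... | true  = ⊥-elim (<-irrefl refl (≤-trans full (#-≤vs l ea)))
  ... | false = #-full-vs l ea full x∈ vx

  #-full-es : ∀ {a} l → V a → es l ≤ a # l → ∀ {x} → x ∈ l → E x → Adj a x
  #-full-es {a} (y ∷ l) va full x∈ ex with adj? a y
  #-full-es {a} (y ∷ l) va full (here refl) ex | yes ay = ay
  #-full-es {a} (y ∷ l) va full (there x∈) ex | yes ay rewrite adj-V ay va = #-full-es l va (s≤s⁻¹ full) x∈ ex
  #-full-es {a} (y ∷ l) va full (here refl) ex | no _ rewrite ex = ⊥-elim (<-irrefl refl (≤-trans full (#-≤es l va)))
  #-full-es {a} (y ∷ l) va full (there x∈) ex | no _ with isV y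
  ... | true  = #-full-es l va full x∈ ex
  ... | false = ⊥-elim (<-irrefl refl (≤-trans full (#-≤es l va)))

  #-pos : ∀ {a x l} → x ∈ l → Adj a x → 1 ≤ a # l
  #-pos {a} {x} {l} x∈ ax with filter (adj? a) l | ∈-filter⁺ (adj? a) x∈ ax
  ... | _ ∷ _ | _ = s≤s z≤n

  #-find : ∀ {a l} → 1 ≤ a # l → ∃ λ x → x ∈ l × Adj a x
  #-find {a} {l} p with filter (adj? a) l in eq
  ... | x ∷ _ = x , ∈-filter⁻ (adj? a) (subst (x ∈_) (sym eq) (here refl))

  #-none : ∀ {a l} → a # l ≡ 0 → ∀ {x} → x ∈ l → ¬ Adj a x
  #-none eq x∈ ax with subst (1 ≤_) eq (#-pos x∈ ax)
  ... | ()

  #-↭ : ∀ {a l l′} → l ↭ l′ → a # l ≡ a # l′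
  #-↭ {a} p = ↭-length (filter-↭ (adj? a) p)

  Longest : List Node → Set
  Longest D = Cycle D × (∀ {l} → Cycle l → length l ≤ length D)

  longest-↭ : ∀ {D D′} → Longest D → Cycle D′ → length D′ ≡ length D → Longest D′
  longest-↭ (c , max) c′ eq = c′ , λ x → subst (_ ≤_) (sym eq) (max x)

  module Gaps {D} (lg : Longest D) {a b Q} (P : PathOff D a b Q) where

    -- `reroute` trades `M` for `Q`, which cannot lengthen a longest cycle.
    gap≠ : ∀ {α M β R} → Cycle (α ∷ M ++ β ∷ R) → α ∷ M ++ β ∷ R ↭ D → Adj a α → Adj b β →
      length Q ≤ length M
    gap≠ {α} {M} {β} {R} c p aα bβ = +-cancelˡ-≤ (length R + 2) _ _ (begin
      length R + 2 + length Q          ≡⟨ +-assoc (length R) 2 (length Q) ⟩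
      length R + (2 + length Q)        ≡⟨ +-suc (length R) (suc (length Q)) ⟩
      suc (length R + suc (length Q))  ≡⟨ cong suc (length-++ R) ⟨
      length (β ∷ R ++ α ∷ Q)          ≤⟨ proj₂ lg (reroute c (pathOff-↭ (↭-sym p) P) (adj-sym aα) bβ) ⟩
      length D                         ≡⟨ ↭-length p ⟨
      length (α ∷ M ++ β ∷ R)          ≡⟨ cong suc (length-++ M) ⟩
      suc (length M + suc (length R))  ≡⟨ eq (length M) (length R) ⟩
      length R + 2 + length M          ∎)
      where
      open ≤-Reasoning
      eq : ∀ m r → suc (m + suc r) ≡ r + 2 + m
      eq = solve-∀

    gap= : ∀ {α M} → α ∷ M ↭ D → Adj a α → Adj b α → length Q ≤ length M
    gap= p aα bα = s≤s⁻¹ (≤-trans (proj₂ lg (attach (∈-resp-↭ p (here refl)) P (adj-sym aα) bα))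
                                   (≤-reflexive (sym (↭-length p))))

  module _ {D} (lg : Longest D) {a b Q} (P : PathOff D a b Q) where

    -- Neither arc of `D` between `α` and `β` may be shorter than `Q`: one is compared with `Q`, the
    -- other with `Q` reversed.
    gap-two : ∀ {α β} → α ∈ D → β ∈ D → α ≢ β → Adj a α → Adj b β → 2 * suc (length Q) ≤ length D
    gap-two {α} {β} α∈ β∈ α≢β aα bβ with rotate-to (proj₁ lg) α∈
    ... | w , c , p with ∈-resp-↭ (↭-sym p) β∈
    ...   | here refl = contradiction refl α≢β
    ...   | there β∈w with ∈-∃++ β∈w
    ...     | M , R , refl = begin
      2 * suc (length Q)                       ≡⟨ cong (suc (length Q) +_) (+-identityʳ _) ⟩
      suc (length Q) + suc (length Q)          ≤⟨ +-mono-≤ (s≤s one) (s≤s other) ⟩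
      suc (length M) + suc (length R)          ≡⟨ length-++ (α ∷ M) ⟨
      length (α ∷ M ++ β ∷ R)                  ≡⟨ ↭-length p ⟩
      length D                                 ∎
      where
      open ≤-Reasoning
      one : length Q ≤ length M
      one = Gaps.gap≠ lg P c p aα bβ
      other : length Q ≤ length R
      other = subst (_≤ length R) (length-reverse Q)
        (Gaps.gap≠ lg (pathOff-reverse P) (rotate (α ∷ M) c) (↭-trans (↭-++-comm (β ∷ R) (α ∷ M)) p) bβ aα)

  nonconsecutive : ∀ {a z M z′ R} → Cycle (z ∷ M ++ z′ ∷ R) → Adj a z → Adj a z′ → 2 ≤ suc (length M)
  nonconsecutive {M = []} c az az′ with walk c
  ... | e ∷ w with walk-head w
  ...   | refl = ⊥-elim (adj-common az az′ e)
  nonconsecutive {M = _ ∷ _} c az az′ = s≤s (s≤s z≤n)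

  cycle-2≤ : ∀ {z M} → Cycle (z ∷ M) → 2 ≤ suc (length M)
  cycle-2≤ {M = []} c with walk c | close c
  ... | [ _ ] | e = ⊥-elim (adj-irrefl e)
  cycle-2≤ {M = _ ∷ _} c = s≤s (s≤s z≤n)

  module Labels (a b : Node) where

    classify : Bool → Bool → Maybe Class
    classify true  true  = just both
    classify true  false = just left
    classify false true  = just right
    classify false false = nothing

    cls : Node → Maybe Class
    cls x = classify (does (adj? a x)) (does (adj? b x))

    InClass : Class → Node → Set
    InClass both  x = Adj a x × Adj b x
    InClass left  x = Adj a x × ¬ Adj b x
    InClass right x = ¬ Adj a x × Adj b x

    cls⁻ : ∀ {x c} → cls x ≡ just c → InClass c x
    cls⁻ {x} eq with adj? a x | adj? b x | eq
    ... | yes p | yes q | refl = p , q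
    ... | yes p | no  q | refl = p , q
    ... | no  p | yes q | refl = p , q

    cls⁺ : ∀ {x} c → InClass c x → cls x ≡ just c
    cls⁺ {x} c i with adj? a x | adj? b x
    cls⁺ both  i       | yes p | yes q = refl
    cls⁺ left  (_ , i) | yes p | yes q = contradiction q i
    cls⁺ right (i , _) | yes p | yes q = contradiction p i
    cls⁺ both  (_ , i) | yes p | no  q = contradiction i q
    cls⁺ left  i       | yes p | no  q = refl
    cls⁺ right (i , _) | yes p | no  q = contradiction p i
    cls⁺ both  (i , _) | no  p | yes q = contradiction i p
    cls⁺ left  (i , _) | no  p | yes q = contradiction i p
    cls⁺ right i       | no  p | yes q = refl
    cls⁺ both  (i , _) | no  p | no  q = contradiction i p
    cls⁺ left  (i , _) | no  p | no  q = contradiction i p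
    cls⁺ right (_ , i) | no  p | no  q = contradiction i q

    cls? : ∀ c x → Dec (cls x ≡ just c)
    cls? c x = MaybeP.≡-dec _≟ᶜ_ (cls x) (just c)

    clsNum : Class → List Node → ℕ
    clsNum c l = length (filter (cls? c) l)

    #-left : ∀ l → a # l ≡ clsNum both l + clsNum left l
    #-left [] = refl
    #-left (x ∷ l) with does (adj? a x) | does (adj? b x)
    ... | true  | true  = cong suc (#-left l)
    ... | true  | false = trans (cong suc (#-left l)) (sym (+-suc (clsNum both l) (clsNum left l)))
    ... | false | true  = #-left l
    ... | false | false = #-left l

    #-right : ∀ l → b # l ≡ clsNum both l + clsNum right l
    #-right [] = refl
    #-right (x ∷ l) with does (adj? a x) | does (adj? b x)
    ... | true  | true  = cong suc (#-right l)
    ... | true  | false = #-right l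
    ... | false | true  = trans (cong suc (#-right l)) (sym (+-suc (clsNum both l) (clsNum right l)))
    ... | false | false = #-right l

    clsNum-find : ∀ {c l} → 1 ≤ clsNum c l → ∃ λ x → x ∈ l × cls x ≡ just c
    clsNum-find {c} {l} p with filter (cls? c) l in eq
    ... | x ∷ _ = x , ∈-filter⁻ (cls? c) (subst (x ∈_) (sym eq) (here refl))

    clsNum-pos : ∀ {c x l} → x ∈ l → cls x ≡ just c → 1 ≤ clsNum c l
    clsNum-pos {c} {x} {l} x∈ cx with filter (cls? c) l | ∈-filter⁺ (cls? c) x∈ cx
    ... | _ ∷ _ | _ = s≤s z≤n

-- Charging schemes for the two ends of an outside path

module Separation (G : BipartiteGraph) where
  open BipartiteGraph G
  open Walks G
  open Counting G

  walk-1≤ : ∀ {a b l} → Walk a b l → 1 ≤ length l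
  walk-1≤ [ a ]   = s≤s z≤n
  walk-1≤ (e ∷ w) = s≤s z≤n

  module TwoEnds {D} (lg : Longest D) {a b Q} (P : PathOff D a b Q) where
    open Labels a b public

    private
      q : ℕ
      q = length Q

      P⁻ : PathOff D b a (reverse Q)
      P⁻ = pathOff-reverse P

    -- Nodes attached to opposite ends of `Q` have at least |Q| nodes of `D` between them. Two nodes
    -- attached to the same end only are merely known to be non-adjacent, hence the 2. A node of
    -- class `both` is opposite to every attached node, itself included.
    cost : Class → Class → ℕ
    cost left  left  = 2
    cost right right = 2
    cost both  _     = suc q
    cost left  both  = suc q
    cost left  right = suc q
    cost right both  = suc q
    cost right left  = suc q

    module _ {z M z′ R} (c : Cycle (z ∷ M ++ z′ ∷ R)) (p : z ∷ M ++ z′ ∷ R ↭ D) where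

      ab : Adj a z → Adj b z′ → suc q ≤ suc (length M)
      ab az bz′ = s≤s (Gaps.gap≠ lg P c p az bz′)

      ba : Adj b z → Adj a z′ → suc q ≤ suc (length M)
      ba bz az′ = s≤s (subst (_≤ length M) (length-reverse Q) (Gaps.gap≠ lg P⁻ c p bz az′))

      sep-classes : ∀ x y → InClass x z → InClass y z′ → cost x y ≤ suc (length M)
      sep-classes both  both  (az , bz) (az′ , bz′) = ab az bz′
      sep-classes both  left  (az , bz) (az′ , _)   = ba bz az′
      sep-classes both  right (az , bz) (_ , bz′)   = ab az bz′
      sep-classes left  both  (az , _)  (az′ , bz′) = ab az bz′
      sep-classes left  left  (az , _)  (az′ , _)   = nonconsecutive c az az′
      sep-classes left  right (az , _)  (_ , bz′)   = ab az bz′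
      sep-classes right both  (_ , bz)  (az′ , bz′) = ba bz az′
      sep-classes right left  (_ , bz)  (az′ , _)   = ba bz az′
      sep-classes right right (_ , bz)  (_ , bz′)   = nonconsecutive c bz bz′

    sep-self : ∀ {z M} → Cycle (z ∷ M) → z ∷ M ↭ D → ∀ x → InClass x z → cost x x ≤ suc (length M)
    sep-self c p both  (az , bz) = s≤s (Gaps.gap= lg P p az bz)
    sep-self c p left  _         = cycle-2≤ c
    sep-self c p right _         = cycle-2≤ c

    open Charging G cls cost D (λ c p i j → sep-classes c p _ _ (cls⁻ i) (cls⁻ j)) (λ c p i → sep-self c p _ (cls⁻ i))

    -- An arc that leaves `left` or `right` costs q + 1, of which its starting node uses 2; the
    -- remaining q - 1 become the exit charge. Arcs from `both` have nothing left over.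
    ω ε κ : Class → ℕ
    ω both  = suc q
    ω left  = 2
    ω right = 2
    ε both  = 0
    ε left  = q ∸ 1
    ε right = q ∸ 1
    κ _     = 0

    stay : ∀ c → ω c ≤ cost c c
    stay both  = ≤-refl
    stay left  = ≤-refl
    stay right = ≤-refl

    leave : ∀ {c c′} → c ≢ c′ → ω c + ε c + κ c′ ≤ cost c c′ + κ c
    leave {c} {c′} c≢c′ = +-monoˡ-≤ 0 (pay c c′ c≢c′)
      where
      pure : suc (suc (q ∸ 1)) ≤ suc q
      pure = s≤s (≤-reflexive (m+[n∸m]≡n (walk-1≤ (pwalk P))))
      pay : ∀ c c′ → c ≢ c′ → ω c + ε c ≤ cost c c′
      pay both  _     _  = ≤-reflexive (+-identityʳ (suc q))
      pay left  both  _  = pure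
      pay left  left  c≢ = contradiction refl c≢
      pay left  right _  = pure
      pay right both  _  = pure
      pay right left  _  = pure
      pay right right c≢ = contradiction refl c≢

    open Weights ω ε κ stay leave

    nB nL nR : ℕ
    nB = clsNum both D
    nL = clsNum left D
    nR = clsNum right D

    left-right : 1 ≤ nL → 1 ≤ nR → suc q * nB + 2 * nL + 2 * nR + ((q ∸ 1) + (q ∸ 1)) ≤ length D
    left-right l r with clsNum-find l | clsNum-find r
    ... | x , x∈ , cx | y , y∈ , cy = two-classes (proj₁ lg) x∈ cx y∈ cy λ ()

    left-both : 1 ≤ nL → 1 ≤ nB → suc q * nB + 2 * nL + 2 * nR + ((q ∸ 1) + 0) ≤ length D
    left-both l r with clsNum-find l | clsNum-find r
    ... | x , x∈ , cx | y , y∈ , cy = two-classes (proj₁ lg) x∈ cx y∈ cy λ ()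

    right-both : 1 ≤ nR → 1 ≤ nB → suc q * nB + 2 * nL + 2 * nR + ((q ∸ 1) + 0) ≤ length D
    right-both l r with clsNum-find l | clsNum-find r
    ... | x , x∈ , cx | y , y∈ , cy = two-classes (proj₁ lg) x∈ cx y∈ cy λ ()

    both-only : 1 ≤ nB → suc q * nB + 2 * nL + 2 * nR ≤ length D
    both-only l with clsNum-find l
    ... | x , x∈ , cx = one-class (proj₁ lg) x∈ cx

    no-left : nL ≡ 0 → ∀ {x} → x ∈ D → Adj a x → Adj b x
    no-left eq {x} x∈ ax with adj? b x
    ... | yes bx = bx
    ... | no ¬bx with subst (1 ≤_) eq (clsNum-pos x∈ (cls⁺ left (ax , ¬bx)))
    ...   | ()

  clsNum-both-VE : ∀ {a b} → V a → E b → ∀ l → Labels.clsNum a b both l ≡ 0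
  clsNum-both-VE {a} {b} va eb l with Labels.clsNum a b both l in eq
  ... | zero  = refl
  ... | suc _ with Labels.clsNum-find a b {both} {l} (subst (1 ≤_) (sym eq) (s≤s z≤n))
  ...   | x , _ , cx with Labels.cls⁻ a b cx
  ...     | ax , bx = ⊥-elim (V≢E (adj-E bx eb) (adj-V ax va))

  -- For a vertex a and an edge b the class `both` is empty, so its costs are immaterial.
  module Mixed {D} (lg : Longest D) {a b} (va : V a) (eb : E b) (cL cLR cR ωR εL εR κL : ℕ)
    (LL : ∀ {z M z′ R} → Cycle (z ∷ M ++ z′ ∷ R) → z ∷ M ++ z′ ∷ R ↭ D → Adj a z → Adj a z′ → cL ≤ suc (length M))
    (LR : ∀ {z M z′ R} → Cycle (z ∷ M ++ z′ ∷ R) → z ∷ M ++ z′ ∷ R ↭ D → Adj a z → Adj b z′ → cLR ≤ suc (length M))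
    (RL : ∀ {z M z′ R} → Cycle (z ∷ M ++ z′ ∷ R) → z ∷ M ++ z′ ∷ R ↭ D → Adj b z → Adj a z′ → cLR ≤ suc (length M))
    (RR : ∀ {z M z′ R} → Cycle (z ∷ M ++ z′ ∷ R) → z ∷ M ++ z′ ∷ R ↭ D → Adj b z → Adj b z′ → cR ≤ suc (length M))
    (L= : ∀ {z M} → Cycle (z ∷ M) → z ∷ M ↭ D → Adj a z → cL ≤ suc (length M))
    (R= : ∀ {z M} → Cycle (z ∷ M) → z ∷ M ↭ D → Adj b z → cR ≤ suc (length M))
    (stayR : ωR ≤ cR) (leaveL : cL + εL ≤ cLR + κL) (leaveR : ωR + εR + κL ≤ cLR) where
    open Labels a b

    -- Large enough for every `leave` inequality that involves the empty class `both`.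
    big : ℕ
    big = (cL + εL) + (ωR + εR) + κL

    cost : Class → Class → ℕ
    cost left  left  = cL
    cost left  right = cLR
    cost right left  = cLR
    cost right right = cR
    cost both  both  = 0
    cost _     _     = big

    ω ε κ : Class → ℕ
    ω both  = 0
    ω left  = cL
    ω right = ωR
    ε both  = 0
    ε left  = εL
    ε right = εR
    κ both  = 0
    κ left  = κL
    κ right = 0

    absurd : ∀ {x} {B : Set} → InClass both x → B
    absurd (ax , bx) = ⊥-elim (V≢E (adj-E bx eb) (adj-V ax va))

    sep-classes : ∀ {z M z′ R} → Cycle (z ∷ M ++ z′ ∷ R) → z ∷ M ++ z′ ∷ R ↭ D →
      ∀ x y → InClass x z → InClass y z′ → cost x y ≤ suc (length M)
    sep-classes c p both  _     i j = absurd i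
    sep-classes c p left  both  i j = absurd j
    sep-classes c p right both  i j = absurd j
    sep-classes c p left  left  (i , _) (j , _) = LL c p i j
    sep-classes c p left  right (i , _) (_ , j) = LR c p i j
    sep-classes c p right left  (_ , i) (j , _) = RL c p i j
    sep-classes c p right right (_ , i) (_ , j) = RR c p i j

    sep-self : ∀ {z M} → Cycle (z ∷ M) → z ∷ M ↭ D → ∀ x → InClass x z → cost x x ≤ suc (length M)
    sep-self c p both  i = absurd i
    sep-self c p left  (i , _) = L= c p i
    sep-self c p right (_ , i) = R= c p i

    stay : ∀ c → ω c ≤ cost c c
    stay both  = z≤n
    stay left  = ≤-refl
    stay right = stayR

    leave : ∀ {c c′} → c ≢ c′ → ω c + ε c + κ c′ ≤ cost c c′ + κ c
    leave {c} {c′} = pay c c′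
      where
      pay : ∀ c c′ → c ≢ c′ → ω c + ε c + κ c′ ≤ cost c c′ + κ c
      pay both  both  c≢ = contradiction refl c≢
      pay both  left  _  = ≤-trans (m≤n+m κL _) (m≤m+n big 0)
      pay both  right _  = z≤n
      pay left  left  c≢ = contradiction refl c≢
      pay left  both  _  rewrite +-identityʳ (cL + εL) = ≤-trans (m≤m+n (cL + εL) _) (≤-trans (m≤m+n _ κL) (m≤m+n big κL))
      pay left  right _  rewrite +-identityʳ (cL + εL) = leaveL
      pay right right c≢ = contradiction refl c≢
      pay right both  _  rewrite +-identityʳ (ωR + εR) | +-identityʳ big = ≤-trans (m≤n+m (ωR + εR) (cL + εL)) (m≤m+n _ κL)
      pay right left  _  rewrite +-identityʳ cLR = leaveR

    open Charging G cls cost D (λ c p i j → sep-classes c p _ _ (cls⁻ i) (cls⁻ j)) (λ c p i → sep-self c p _ (cls⁻ i))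
    open Weights ω ε κ stay leave

    mixed : 1 ≤ a # D → 1 ≤ b # D → cL * (a # D) + ωR * (b # D) + (εL + εR) ≤ length D
    mixed l r with #-find {a} {D} l | #-find {b} {D} r
    ... | x , x∈ , ax | y , y∈ , by = subst (λ t → t + (εL + εR) ≤ length D) counts
      (two-classes (proj₁ lg) x∈ (cls⁺ left (ax , λ bx → absurd (ax , bx))) y∈ (cls⁺ right ((λ ay → absurd (ay , by)) , by)) λ ())
      where
      counts : 0 * clsNum both D + cL * clsNum left D + ωR * clsNum right D ≡ cL * (a # D) + ωR * (b # D)
      counts = sym (cong₂ (λ s t → cL * s + ωR * t)
        (trans (#-left D) (cong (_+ clsNum left D) (clsNum-both-VE va eb D)))
        (trans (#-right D) (cong (_+ clsNum right D) (clsNum-both-VE va eb D))))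

-- The incidence graph, and covering the vertices by two edges

record Incidence : Set₁ where
  field
    graph : BipartiteGraph
  open BipartiteGraph graph public
  field
    r h k              : ℕ
    nb                 : Node → List Node
    nb-unique          : ∀ a → Unique (nb a)
    ∈-nb⁺              : ∀ {a b} → Adj a b → b ∈ nb a
    ∈-nb⁻              : ∀ {a b} → b ∈ nb a → Adj a b
    vertices edges     : List Node
    ∈-vertices         : ∀ {v} → isV v ≡ true → v ∈ vertices
    ∈-edges            : ∀ {e} → isV e ≡ false → e ∈ edges
    vertices-V         : ∀ {v} → v ∈ vertices → isV v ≡ true
    edges-E            : ∀ {e} → e ∈ edges → isV e ≡ false
    vertices-unique    : Unique vertices
    edges-unique       : Unique edges
    edge-size          : ∀ {e} → isV e ≡ false → length (nb e) ≡ r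
    vertex-degree      : ∀ {v} → isV v ≡ true → h ≤ length (nb v)
    extensional        : ∀ {e f} → isV e ≡ false → isV f ≡ false → (∀ {v} → Adj e v → Adj f v) → e ≡ f
    3≤r                : 3 ≤ r
    2≤h                : 2 ≤ h
    k≤2h               : k ≤ h + h
    vertices≤2r        : length vertices ≤ r + r
    k≤vertices         : k ≤ length vertices
    k≤edges            : k ≤ length edges

module Basics (I : Incidence) where
  open Incidence I
  open Walks graph public
  open Counting graph public
  open Separation graph public
  open DecMembership _≟_ public using (_∈?_)

  V-length : ∀ {l} → Unique l → (∀ {x} → x ∈ l → V x) → length l ≤ length vertices
  V-length u allV = Unique-⊆⇒length≤ u (λ x∈ → ∈-vertices (allV x∈))

  nb-V : ∀ {e x} → E e → x ∈ nb e → V x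
  nb-V ee x∈ = adj-E (∈-nb⁻ x∈) ee

  differ : ∀ {e f} → E e → E f → e ≢ f → ∃ λ v → Adj e v × ¬ Adj f v
  differ {e} {f} ee ef e≢f with any? (λ v → ¬? (adj? f v)) (nb e)
  ... | yes p with find p
  ...   | v , v∈ , ¬fv = v , ∈-nb⁻ v∈ , ¬fv
  differ {e} {f} ee ef e≢f | no none = contradiction (extensional ee ef sub) e≢f
    where
    sub : ∀ {v} → Adj e v → Adj f v
    sub {v} ev with adj? f v
    ... | yes fv = fv
    ... | no ¬fv = contradiction (lose (∈-nb⁺ ev) ¬fv) none

  another : ∀ {v} f → V v → ∃ λ g → Adj v g × g ≢ f
  another {v} f vv with any? (λ g → ¬? (g ≟ f)) (nb v)
  ... | yes p with find p
  ...   | g , g∈ , g≢ = g , ∈-nb⁻ g∈ , g≢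
  another {v} f vv | no none = ⊥-elim (<-irrefl refl (≤-trans 2≤h (≤-trans (vertex-degree vv)
    (Unique-⊆⇒length≤ {ys = f ∷ []} (nb-unique v) only))))
    where
    only : ∀ {x} → x ∈ nb v → x ∈ f ∷ []
    only {x} x∈ with x ≟ f
    ... | yes refl = here refl
    ... | no  x≢f  = contradiction (lose x∈ x≢f) none

  2r+1 : ∀ {l} → Unique l → (∀ {x} → x ∈ l → V x) → suc (r + r) ≤ length l → ⊥
  2r+1 u v p = <-irrefl refl (≤-trans p (≤-trans (V-length u v) vertices≤2r))

  -- Together with `t` the two edges would give 2r + 1 vertices.
  disjoint-cover : ∀ {e f t} → E e → E f → V t → (∀ {v} → Adj e v → ¬ Adj f v) → ¬ Adj e t → ¬ Adj f t → ⊥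
  disjoint-cover {e} {f} {t} ee ef vt dis ¬et ¬ft = 2r+1 unique allV (≤-reflexive (sym len))
    where
    l = t ∷ nb e ++ nb f
    unique : Unique l
    unique = ∷-Unique (λ t∈ → case ∈-++⁻ (nb e) t∈ of λ { (inj₁ p) → ¬et (∈-nb⁻ p) ; (inj₂ p) → ¬ft (∈-nb⁻ p) })
      (++-Unique (nb-unique e) (nb-unique f) (λ p q → dis (∈-nb⁻ p) (∈-nb⁻ q)))
    allV : ∀ {x} → x ∈ l → V x
    allV (here refl) = vt
    allV (there p) with ∈-++⁻ (nb e) p
    ... | inj₁ q = nb-V ee q
    ... | inj₂ q = nb-V ef q
    len : length l ≡ suc (r + r)
    len = cong suc (trans (length-++ (nb e)) (cong₂ _+_ (edge-size ee) (edge-size ef)))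

  -- Without `z` the edge `f` still has at least r - 1 vertices; these, the r vertices of `e`, and
  -- `t` and `u` are again 2r + 1.
  almost-disjoint-cover : ∀ {e f z t u} → E e → E f → V t → V u → t ≢ u →
    (∀ {v} → Adj e v → Adj f v → v ≡ z) → ¬ Adj e t → ¬ Adj f t → ¬ Adj e u → ¬ Adj f u → ⊥
  almost-disjoint-cover {e} {f} {z} {t} {u} ee ef vt vu t≢u dis ¬et ¬ft ¬eu ¬fu =
    2r+1 unique allV (begin
      suc (r + r)                              ≡⟨ cong suc (cong₂ _+_ (sym (edge-size ee)) (sym (edge-size ef))) ⟩
      suc (length (nb e) + length (nb f))      ≤⟨ s≤s (+-monoʳ-≤ (length (nb e)) f≤) ⟩
      suc (length (nb e) + suc (length f∖z))   ≡⟨ cong suc (+-suc (length (nb e)) (length f∖z)) ⟩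
      suc (suc (length (nb e) + length f∖z))   ≡⟨ cong (λ n → suc (suc n)) (length-++ (nb e)) ⟨
      length l                                 ∎)
    where
    open ≤-Reasoning
    f∖z = filter (λ x → ¬? (x ≟ z)) (nb f)
    l = t ∷ u ∷ nb e ++ f∖z
    ∈f∖z : ∀ {x} → x ∈ f∖z → Adj f x × x ≢ z
    ∈f∖z x∈ with ∈-filter⁻ (λ x → ¬? (x ≟ z)) {xs = nb f} x∈
    ... | p , q = ∈-nb⁻ p , q
    f≤ : length (nb f) ≤ suc (length f∖z)
    f≤ = Unique-⊆⇒length≤ (nb-unique f) sub
      where
      sub : ∀ {x} → x ∈ nb f → x ∈ z ∷ f∖z
      sub {x} x∈ with x ≟ z
      ... | yes refl = here refl
      ... | no  x≢z  = there (∈-filter⁺ (λ x → ¬? (x ≟ z)) x∈ x≢z)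
    out : ∀ {x} → ¬ Adj e x → ¬ Adj f x → x ∉ nb e ++ f∖z
    out ¬ex ¬fx x∈ with ∈-++⁻ (nb e) x∈
    ... | inj₁ p = ¬ex (∈-nb⁻ p)
    ... | inj₂ p = ¬fx (proj₁ (∈f∖z p))
    unique : Unique l
    unique = ∷-Unique (λ { (here refl) → t≢u refl ; (there t∈) → out ¬et ¬ft t∈ }) (∷-Unique (out ¬eu ¬fu)
      (++-Unique (nb-unique e) (Uniq.filter⁺ (λ x → ¬? (x ≟ z)) (nb-unique f))
        (λ p q → proj₂ (∈f∖z q) (dis (∈-nb⁻ p) (proj₁ (∈f∖z q))))))
    allV : ∀ {x} → x ∈ l → V x
    allV (here refl) = vt
    allV (there (here refl)) = vu
    allV (there (there p)) with ∈-++⁻ (nb e) p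
    ... | inj₁ q = nb-V ee q
    ... | inj₂ q = adj-E (proj₁ (∈f∖z q)) ef

  short : ∀ {D} → Longest D → ∀ {a b Q} → PathOff D a b Q → ∀ {α M β R} → Cycle (α ∷ M ++ β ∷ R) →
    α ∷ M ++ β ∷ R ↭ D → Adj a α → Adj b β → length M < length Q → ⊥
  short lg P c p aα bβ lt = <-irrefl refl (≤-trans lt (Gaps.gap≠ lg P c p aα bβ))

  meets? : ∀ e f → Dec (∃ λ z → Adj e z × Adj f z)
  meets? e f with any? (adj? e) (nb f)
  ... | yes p with find p
  ...   | z , z∈ , ez = yes (z , ez , ∈-nb⁻ z∈)
  meets? e f | no none = no λ (z , ez , fz) → none (lose (∈-nb⁺ fz) ez)

  has-E : ∀ {D} → Cycle D → ∃ λ e → e ∈ D × E e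
  has-E {D} c with isV (first c) in eq
  ... | false = first c , walk-first∈ (walk c) , eq
  ... | true  = last c , walk-last∈ (walk c) , adj-V (adj-sym (close c)) eq

-- Edges outside a longest cycle meet it

module EdgesReach (I : Incidence) where
  open Incidence I
  open Basics I

  walk-snoc-form : ∀ {a b l} → Walk a b l → ∃ λ k → l ≡ k ++ b ∷ []
  walk-snoc-form [ a ] = [] , refl
  walk-snoc-form (_∷_ {a} e w) with walk-snoc-form w
  ... | k , refl = a ∷ k , refl

  -- `e₀` is the one edge of the cycle that is allowed to be disjoint from `f`.
  module _ {e₀ v e₁ w} (lg : Longest (e₀ ∷ v ∷ e₁ ∷ w)) {f} (ef : E f) (f∉ : f ∉ e₀ ∷ v ∷ e₁ ∷ w)
    (free : ∀ {x} → x ∈ e₀ ∷ v ∷ e₁ ∷ w → ¬ Adj f x) (ee₀ : E e₀)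
    (tail-meets : ∀ {e} → e ∈ v ∷ e₁ ∷ w → E e → ∃ λ z → Adj e z × Adj f z) where

    private
      D : List Node
      D = e₀ ∷ v ∷ e₁ ∷ w

      cy : Cycle D
      cy = proj₁ lg

      f-off : ∀ {x} → Adj f x → x ∉ D
      f-off fx x∈ = free x∈ fx

      e₀v : Adj e₀ v
      e₀v with walk cy
      ... | e ∷ u with walk-head u
      ...   | refl = e

      w₁ : Walk e₁ (last cy) (e₁ ∷ w)
      w₁ = walk-drop (e₀ ∷ v ∷ []) (walk cy)

      ve₁ : Adj v e₁
      ve₁ with walk-drop (e₀ ∷ []) (walk cy)
      ... | e ∷ u with walk-head u
      ...   | refl = e

      ee₁ : E e₁
      ee₁ = adj-V ve₁ (adj-E e₀v ee₀)

      -- Otherwise the path z f z′ could replace the single node `x` between `e` and `e′`.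
      consecutive : ∀ pre {e x e′ post z z′} → D ≡ pre ++ e ∷ x ∷ e′ ∷ post →
        Adj f z → Adj f z′ → Adj e z → Adj e′ z′ → z ≡ z′
      consecutive pre {e} {x} {e′} {post} {z} {z′} eq fz fz′ ez e′z′ with z ≟ z′
      ... | yes z≡z′ = z≡z′
      ... | no  z≢z′ = ⊥-elim (short lg P {M = x ∷ []} (rotate pre (subst Cycle eq cy))
            (↭-trans (↭-++-comm (e ∷ x ∷ e′ ∷ post) pre) (↭-reflexive (sym eq)))
            (adj-sym ez) (adj-sym e′z′) (s≤s (s≤s z≤n)))
        where
        P : PathOff D z z′ (z ∷ f ∷ z′ ∷ [])
        P = pathOff (adj-sym fz ∷ fz′ ∷ [ z′ ])
          (∷-Unique (λ { (here refl) → adj-irrefl fz ; (there (here refl)) → z≢z′ refl })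
            (∷-Unique (λ { (here refl) → adj-irrefl fz′ }) (∷-Unique (λ ()) [])))
          λ { (here refl) → f-off fz ; (there (here refl)) → f∉ ; (there (there (here refl))) → f-off fz′ }

    -- By `consecutive`, all edges of D except perhaps `e₀` meet `f` in one and the same vertex `z`.
    -- A vertex `t` of `f` outside `e₁` therefore lies on no edge of D, and a second edge `g`
    -- through `t` is off D. With a vertex `y` of `g` outside `f`, the path z f t g (followed by `y`
    -- if `y` is off D) can be spliced into D, unless `y` is outside both D and `e₀`; there the
    -- covering lemmas help.
    unreached-absurd : ⊥
    unreached-absurd with tail-meets (there (here refl)) ee₁ | differ ef ee₁ (λ { refl → f∉ (there (there (here refl))) })
    ... | z , e₁z , fz | t , ft , ¬e₁t = conclude (another f (adj-E ft ef))
      where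
      z≢t : z ≢ t
      z≢t refl = ¬e₁t e₁z

      chain : ∀ pre e w′ {b} → D ≡ pre ++ e ∷ w′ → Walk e b (e ∷ w′) → (∀ {x} → x ∈ w′ → x ∈ v ∷ e₁ ∷ w) →
        E e → Adj e z → ∀ {x} → x ∈ w′ → E x → Adj x z × ¬ Adj x t
      chain pre e (y ∷ w′) eq (ey ∷ u) sub ee ez (here refl) ex with walk-head u
      ... | refl = ⊥-elim (V≢E (adj-E ey ee) ex)
      chain pre e (y ∷ e′ ∷ w′) eq (ey ∷ (ye′ ∷ u)) sub ee ez x∈ ex with walk-head u
      ... | refl = continue x∈ ex
        where
        ee′ : E e′
        ee′ = adj-V ye′ (adj-E ey ee)
        at-e′ : Adj e′ z × ¬ Adj e′ t
        at-e′ with tail-meets (sub (there (here refl))) ee′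
        ... | z′ , e′z′ , fz′ with consecutive pre eq fz fz′ ez e′z′
        ...   | refl = e′z′ , λ e′t → z≢t (consecutive pre eq fz ft ez e′t)
        continue : ∀ {x} → x ∈ y ∷ e′ ∷ w′ → E x → Adj x z × ¬ Adj x t
        continue (here refl) ex = ⊥-elim (V≢E (adj-E ey ee) ex)
        continue (there (here refl)) ex = at-e′
        continue (there (there x∈)) ex =
          chain (pre ++ e ∷ y ∷ []) e′ w′ (trans eq (sym (++-assoc pre (e ∷ y ∷ []) (e′ ∷ w′)))) u
            (λ p → sub (there (there p))) ee′ (proj₁ at-e′) x∈ ex

      tail-z : ∀ {x} → x ∈ w → E x → Adj x z × ¬ Adj x t
      tail-z = chain (e₀ ∷ v ∷ []) e₁ w refl w₁ (λ p → there (there p)) ee₁ e₁z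

      t-isolated : ∀ {x} → x ∈ D → ¬ Adj x t
      t-isolated (here refl) xt = z≢t (sym (consecutive [] refl ft fz xt e₁z))
      t-isolated (there (here refl)) xt = V≢E (adj-E e₀v ee₀) (adj-V (adj-sym xt) (adj-E ft ef))
      t-isolated (there (there (here refl))) xt = ¬e₁t xt
      t-isolated (there (there (there x∈))) xt = proj₂ (tail-z x∈ (adj-V (adj-sym xt) (adj-E ft ef))) xt

      conclude : (∃ λ g → Adj t g × g ≢ f) → ⊥
      conclude (g , tg , g≢f) with differ eg ef g≢f
        where
        eg : E g
        eg = adj-V tg (adj-E ft ef)
      ... | y , gy , ¬fy = finish (y ∈? D)
        where
        eg : E g
        eg = adj-V tg (adj-E ft ef)
        vy : V y
        vy = adj-E gy eg
        vz : V z
        vz = adj-E fz ef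
        vt : V t
        vt = adj-E ft ef
        g∉ : g ∉ D
        g∉ g∈ = t-isolated g∈ (adj-sym tg)
        z≢y : z ≢ y
        z≢y refl = ¬fy fz
        t≢y : t ≢ y
        t≢y refl = ¬fy ft

        -- z f t g leaves and re-enters D at neighbouring nodes.
        P₄ : PathOff D g z (g ∷ t ∷ f ∷ z ∷ [])
        P₄ = pathOff (adj-sym tg ∷ adj-sym ft ∷ fz ∷ [ z ])
          (∷-Unique (λ { (here refl) → adj-irrefl tg ; (there (here refl)) → g≢f refl ; (there (there (here refl))) → V≢E vz eg })
            (∷-Unique (λ { (here refl) → adj-irrefl ft ; (there (here refl)) → z≢t refl })
              (∷-Unique (λ { (here refl) → adj-irrefl fz }) (∷-Unique (λ ()) []))))
          λ { (here refl) → g∉ ; (there (here refl)) → f-off ft ; (there (there (here refl))) → f∉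
            ; (there (there (there (here refl)))) → f-off fz }

        P₅ : y ∉ D → PathOff D y z (y ∷ g ∷ t ∷ f ∷ z ∷ [])
        P₅ y∉ = pathOff (adj-sym gy ∷ pwalk P₄)
          (∷-Unique (λ { (here refl) → adj-irrefl gy ; (there (here refl)) → t≢y refl ; (there (there (here refl))) → V≢E vy ef
                       ; (there (there (there (here refl)))) → z≢y refl }) (puniq P₄))
          λ { (here refl) → y∉ ; (there p) → off P₄ p }

        -- If `e₀` and `f` share only `z`, at most one vertex is outside both, and `y` is such a
        -- vertex. So either `e₁` contains `y`, which gives a detour, or `e₁` is contained in `e₀`.
        e₀-case : y ∉ D → ¬ Adj e₀ y → ⊥
        e₀-case y∉ ¬e₀y with meets? e₀ f
        ... | no none = disjoint-cover ee₀ ef vy (λ e₀x fx → none (_ , e₀x , fx)) ¬e₀y ¬fy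
        ... | yes (z₀ , e₀z₀ , fz₀) with consecutive [] refl fz₀ fz e₀z₀ e₁z
        ...   | refl with adj? e₁ y
        ...     | yes e₁y = short lg (pathOff-reverse (P₅ y∉)) {M = v ∷ []} cy ↭-refl (adj-sym e₀z₀) (adj-sym e₁y) (s≤s (s≤s z≤n))
        ...     | no ¬e₁y = Unique-head∉ (uniq cy) (subst (_∈ v ∷ e₁ ∷ w) (extensional ee₁ ee₀ sub) (there (here refl)))
          where
          sub : ∀ {u} → Adj e₁ u → Adj e₀ u
          sub {u} e₁u with adj? e₀ u
          ... | yes p = p
          ... | no ¬e₀u = ⊥-elim (almost-disjoint-cover ee₀ ef vy (adj-E e₁u ee₁) (λ { refl → ¬e₁y e₁u })
                  (λ e₀x fx → consecutive [] refl fx fz e₀x e₁z) ¬e₀y ¬fy ¬e₀u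
                  λ fu → case consecutive [] refl fz fu e₀z₀ e₁u of λ { refl → ¬e₀u e₀z₀ })

        finish : Dec (y ∈ D) → ⊥
        finish (yes (here refl)) = V≢E vy ee₀
        finish (yes (there (here refl))) =
          short lg P₄ {M = []} (rotate (e₀ ∷ []) cy) (↭-++-comm (v ∷ e₁ ∷ w) (e₀ ∷ [])) gy (adj-sym e₁z) (s≤s z≤n)
        finish (yes (there (there (here refl)))) = V≢E vy ee₁
        -- The edge `p` before `y` on D contains `z`, so z f t g fits between the neighbours `p` and
        -- `y`.
        finish (yes (there (there (there y∈)))) with ∈-∃++ y∈
        ... | l , l′ , refl with walk-cut e₁ l w₁
        ...   | p , wp , py , _ with walk-snoc-form wp
        ...     | l₀ , eq = short lg (pathOff-reverse P₄) {M = []} (rotate (e₀ ∷ v ∷ l₀) (subst Cycle whole cy))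
                  (↭-trans (↭-++-comm (p ∷ y ∷ l′) (e₀ ∷ v ∷ l₀)) (↭-reflexive (sym whole)))
                  (adj-sym pz) gy (s≤s z≤n)
          where
          whole : D ≡ (e₀ ∷ v ∷ l₀) ++ p ∷ y ∷ l′
          whole = cong (λ s → e₀ ∷ v ∷ s) (trans (cong (_++ y ∷ l′) eq) (++-assoc l₀ (p ∷ []) (y ∷ l′)))
          ep : E p
          ep = adj-V (adj-sym py) vy
          pz : Adj p z
          pz with walk-last∈ wp
          ... | here refl = e₁z
          ... | there p∈ = proj₁ (tail-z (∈-++⁺ˡ p∈) ep)
        finish (no y∉) with adj? e₀ y
        ... | yes e₀y = short lg (P₅ y∉) {M = v ∷ []} cy ↭-refl (adj-sym e₀y) (adj-sym e₁z) (s≤s (s≤s z≤n))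
        ... | no ¬e₀y = e₀-case y∉ ¬e₀y

  -- The complement of `f` has at most r vertices, so at most one edge of `D` lies inside it; `D` is
  -- rotated to start at that edge, or at any edge if there is none.
  reach : ∀ {D} → Longest D → 4 ≤ length D → ∀ {f} → E f → f ∉ D → 1 ≤ f # D
  reach {D} lg 4≤ {f} ef f∉ with f # D in eq
  ... | suc _ = s≤s z≤n
  ... | zero  = ⊥-elim (pick (any? (λ e → (isV e BoolP.≟ false) ×-dec ¬? (meets? e f)) D))
    where
    from : ∀ {e} → e ∈ D → E e → (∀ {x} → x ∈ D → x ≢ e → E x → ∃ λ z → Adj x z × Adj f z) → ⊥
    from {e} e∈ ee others with rotate-to (proj₁ lg) e∈
    ... | [] , c , p with subst (4 ≤_) (sym (↭-length p)) 4≤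
    ...   | s≤s ()
    from e∈ ee others | _ ∷ [] , c , p with subst (4 ≤_) (sym (↭-length p)) 4≤
    ...   | s≤s (s≤s ())
    from e∈ ee others | v ∷ e₁ ∷ w′ , c , p = unreached-absurd (longest-↭ lg c (↭-length p)) ef
      (λ f∈ → f∉ (∈-resp-↭ p f∈)) (λ x∈ → #-none eq (∈-resp-↭ p x∈)) ee
      (λ x∈ ex → others (∈-resp-↭ p (there x∈)) (λ { refl → Unique-head∉ (uniq c) x∈ }) ex)
    pick : Dec _ → ⊥
    pick (no none) with has-E (proj₁ lg)
    ... | e , e∈ , ee = from e∈ ee all-meet
      where
      all-meet : ∀ {x} → x ∈ D → x ≢ e → E x → ∃ λ z → Adj x z × Adj f z
      all-meet {x} x∈ _ ex with meets? x f
      ... | yes m = m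
      ... | no ¬m = contradiction (lose x∈ (ex , ¬m)) none
    pick (yes some) with find some
    ... | e , e∈ , ee , ¬m = from e∈ ee rest
      where
      rest : ∀ {x} → x ∈ D → x ≢ e → E x → ∃ λ z → Adj x z × Adj f z
      rest {x} x∈ x≢e ex with meets? x f
      ... | yes m = m
      ... | no ¬m′ = contradiction (extensional ex ee sub) x≢e
        where
        sub : ∀ {v} → Adj x v → Adj e v
        sub {v} xv with adj? e v
        ... | yes ev = ev
        ... | no ¬ev = ⊥-elim (disjoint-cover ee ef (adj-E xv ex) (λ eu fu → ¬m (_ , eu , fu)) ¬ev λ fv → ¬m′ (_ , xv , fv))

-- No large cycles outside a longest cycle

module OutsideCycles (I : Incidence) where
  open Incidence I
  open Basics I
  open EdgesReach I

  -- The path is closed at the last neighbour of `a` on it, so that the cycle keeps all of `l`. The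
  -- nodes of `l` are on one side of the bipartition, which is exactly half of the cycle.
  close-path : ∀ {a b Q l} → Walk a b Q → Unique Q → Unique l → 1 ≤ length l →
    (∀ {x} → x ∈ l → x ∈ Q × Adj a x) →
    ∃ λ K → Cycle K × (∀ {x} → x ∈ K → x ∈ Q) × length l + length l ≤ length K
  close-path {a} {l = x ∷ l} w u ul 1≤ sub with split-last (adj? a) (proj₁ (sub (here refl))) (proj₂ (sub (here refl)))
  ... | as , y , bs , refl , ay , none = K , cK , (λ p → [ ∈-++⁺ˡ , (λ { (here refl) → ∈-insert as }) ]′ (∈-++⁻ as p)) , bound
    where
    K : List Node
    K = as ++ y ∷ []
    cK : Cycle K
    cK = record { walk = walk-take as w ; close = adj-sym ay
                ; uniq = Unique-++⁻ˡ K (subst Unique (sym (++-assoc as (y ∷ []) bs)) u) }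
    in-K : ∀ {z} → z ∈ x ∷ l → z ∈ filter (adj? a) K
    in-K z∈ with sub z∈
    ... | z∈Q , az with ∈-++⁻ as z∈Q
    ...   | inj₁ p           = ∈-filter⁺ (adj? a) (∈-++⁺ˡ p) az
    ...   | inj₂ (here refl) = ∈-filter⁺ (adj? a) (∈-insert as) az
    ...   | inj₂ (there p)   = contradiction az (none p)
    l≤# : length (x ∷ l) ≤ a # K
    l≤# = Unique-⊆⇒length≤ ul in-K
    #≤vs : a # K ≤ vs K
    #≤vs with isV a in eq
    ... | true  = ≤-trans (#-≤es K eq) (≤-reflexive (cycle-balance cK))
    ... | false = #-≤vs K eq
    bound : length (x ∷ l) + length (x ∷ l) ≤ length K
    bound = ≤-trans (+-mono-≤ (≤-trans l≤# #≤vs) (≤-trans l≤# #≤vs)) (≤-reflexive (sym (cycle-length cK)))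

  Saturated : List Node → List Node → Node → Set
  Saturated D Q a = ∀ {x} → Adj a x → x ∈ D ⊎ x ∈ Q

  degree-split : ∀ {D Q a} → Saturated D Q a → length (nb a) ≤ a # D + a # Q
  degree-split {D} {Q} {a} sat = ≤-trans (Unique-⊆⇒length≤ (nb-unique a) sub)
    (≤-reflexive (length-++ (filter (adj? a) D)))
    where
    sub : ∀ {x} → x ∈ nb a → x ∈ filter (adj? a) D ++ filter (adj? a) Q
    sub x∈ with sat (∈-nb⁻ x∈)
    ... | inj₁ p = ∈-++⁺ˡ (∈-filter⁺ (adj? a) p (∈-nb⁻ x∈))
    ... | inj₂ p = ∈-++⁺ʳ (filter (adj? a) D) (∈-filter⁺ (adj? a) p (∈-nb⁻ x∈))

  module _ {D} (lg : Longest D) (4≤D : 4 ≤ length D) where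

    -- The end `f` is adjacent to a vertex of `D` by `reach`, whereas a neighbour of `x` on `D`
    -- would be an edge. The two are different, and `gap-two` makes `Q` too short.
    far : ∀ {x f Q} → PathOff D x f Q → V x → E f → length D < 2 * suc (length Q) → ∀ {α} → α ∈ D → ¬ Adj x α
    far P vx ef lt α∈ xα with #-find (reach lg 4≤D ef (off P (walk-last∈ (pwalk P))))
    ... | β , β∈ , fβ = <-irrefl refl (≤-trans lt
      (gap-two lg P α∈ β∈ (λ { refl → V≢E (adj-E fβ ef) (adj-V xα vx) }) xα fβ))

    module _ {f₁ x f₂ K′} (cK : Cycle (f₁ ∷ x ∷ f₂ ∷ K′)) (K-off : ∀ {y} → y ∈ f₁ ∷ x ∷ f₂ ∷ K′ → y ∉ D)
      (e₁ : E f₁) (large : length D + 2 ≤ 2 * length (f₁ ∷ x ∷ f₂ ∷ K′)) where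

      private
        K : List Node
        K = f₁ ∷ x ∷ f₂ ∷ K′

        f₁x : Adj f₁ x
        f₁x with walk cK
        ... | e ∷ u with walk-head u
        ...   | refl = e

        e₂ : E f₂
        e₂ with walk-drop (f₁ ∷ []) (walk cK)
        ... | e ∷ u with walk-head u
        ...   | refl = adj-V e (adj-E f₁x e₁)

        -- Only x is left out when going from f₂ to f₁ the long way round K.
        P₂₁ : PathOff D f₂ f₁ (f₂ ∷ K′ ++ f₁ ∷ [])
        P₂₁ with walk-head (walk cK)
        ... | refl = pathOff (walk-++ (walk-drop (f₁ ∷ x ∷ []) (walk cK)) (close cK) [ f₁ ])
          (++-Unique (Unique-++⁻ʳ (f₁ ∷ x ∷ []) (uniq cK)) (∷-Unique (λ ()) [])
            (λ { p (here refl) → Unique-head∉ (uniq cK) (there p) }))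
          λ p → case ∈-++⁻ (f₂ ∷ K′) p of λ { (inj₁ q) → K-off (there (there q)) ; (inj₂ (here refl)) → K-off (here refl) }

        len₂₁ : suc (length (f₂ ∷ K′ ++ f₁ ∷ [])) ≡ length K
        len₂₁ = cong (λ n → suc (suc n)) (trans (length-++ K′) (+-comm (length K′) 1))

        D<2K : length D < 2 * length K
        D<2K = ≤-trans (≤-trans (≤-reflexive (+-comm 1 (length D))) (+-monoʳ-≤ (length D) (s≤s z≤n))) large

        x≢ : ∀ {y} → y ∉ K → ∀ {z} → z ∈ f₂ ∷ K′ ++ f₁ ∷ [] → y ≢ z
        x≢ y∉ z∈ refl with ∈-++⁻ (f₂ ∷ K′) z∈
        ... | inj₁ p = y∉ (there (there p))
        ... | inj₂ (here refl) = y∉ (here refl)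

        D<2y : length D < 2 * suc (length (f₂ ∷ K′ ++ f₁ ∷ []))
        D<2y = subst (λ n → length D < 2 * n) (sym len₂₁) D<2K

        -- The path around `K` that avoids only `x` is too long for two different attachments, by
        -- `gap-two`.
        same : ∀ {α β} → α ∈ D → β ∈ D → Adj f₂ α → Adj f₁ β → α ≡ β
        same {α} {β} α∈ β∈ fα fβ with α ≟ β
        ... | yes eq = eq
        ... | no  ne = ⊥-elim (<-irrefl refl (≤-trans D<2y (gap-two lg P₂₁ α∈ β∈ ne fα fβ)))

        extend : ∀ {a b Q y} → PathOff D a b Q → (∀ {z} → z ∈ Q → y ≢ z) → y ∉ D → Adj y a → PathOff D y b (y ∷ Q)
        extend (pathOff w u o) y≢ y∉ ya = pathOff (ya ∷ w) (∷-Unique (λ p → y≢ p refl) u)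
          λ { (here refl) → y∉ ; (there p) → o p }

        D<2+ : ∀ n → length D < 2 * n → length D < 2 * suc n
        D<2+ n p = ≤-trans p (*-monoʳ-≤ 2 (n≤1+n n))

        -- Opened at `y`, the cycle `K` is a path from the vertex `y` to an edge, so `far` applies.
        isolated-K : ∀ {y} → y ∈ K → V y → ∀ {α} → α ∈ D → ¬ Adj y α
        isolated-K {y} y∈ vy with rotate-to cK y∈
        ... | w , c , p with walk-head (walk c)
        ...   | refl = far (pathOff (walk c) (uniq c) (λ q → K-off (∈-resp-↭ p q))) vy (adj-V (adj-sym (close c)) vy)
                (subst (λ n → length D < 2 * suc n) (sym (↭-length p)) (D<2+ (length K) D<2K))

        isolated₂ : ∀ {y} → Adj f₂ y → y ∉ D → ∀ {α} → α ∈ D → ¬ Adj y α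
        isolated₂ {y} fy y∉D with y ∈? K
        ... | yes y∈ = isolated-K y∈ (adj-E fy e₂)
        ... | no  y∉ = far (extend P₂₁ (x≢ y∉) y∉D (adj-sym fy)) (adj-E fy e₂) e₁ (D<2+ (suc (length (f₂ ∷ K′ ++ f₁ ∷ []))) D<2y)

        isolated₁ : ∀ {y} → Adj f₁ y → y ∉ D → ∀ {α} → α ∈ D → ¬ Adj y α
        isolated₁ {y} fy y∉D with y ∈? K
        ... | yes y∈ = isolated-K y∈ (adj-E fy e₁)
        ... | no  y∉ = far (extend (pathOff-reverse P₂₁) (λ p → x≢ y∉ (∈-resp-↭ (↭-reverse _) p)) y∉D (adj-sym fy))
                (adj-E fy e₁) e₂ (subst (λ n → length D < 2 * suc (suc n)) (sym (length-reverse (f₂ ∷ K′ ++ f₁ ∷ []))) (D<2+ (suc (length (f₂ ∷ K′ ++ f₁ ∷ []))) D<2y))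

        module _ {e e′} (e∈ : e ∈ D) (e′∈ : e′ ∈ D) (ee : E e) (ee′ : E e′) where

          -- The edge `f₁` meets edges of `D` only in the attachment vertex `a`, and a vertex `t` of
          -- `f₂` outside `f₁` lies on no edge of `D`. So `e′` and `f₁` share at most `a` and both
          -- miss `t`. If they are disjoint, `t` is one vertex too many; if they share `a`, then `u`
          -- is a second vertex missed by both.
          e⊆e′ : ∀ {u} → Adj e u → Adj e′ u
          e⊆e′ {u} eu with adj? e′ u
          ... | yes p = p
          ... | no ¬e′u with #-find (reach lg 4≤D e₁ (K-off (here refl))) | #-find (reach lg 4≤D e₂ (K-off (there (there (here refl)))))
                | differ e₂ e₁ (λ { refl → Unique-head∉ (uniq cK) (there (here refl)) })
          ...   | a , a∈ , f₁a | b , b∈ , f₂b | t , f₂t , ¬f₁t = ⊥-elim (clash (adj? e′ a))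
            where
            t∉D : t ∉ D
            t∉D t∈ with same t∈ a∈ f₂t f₁a
            ... | refl = ¬f₁t f₁a
            only : ∀ {z} → Adj f₁ z → ∀ {α} → α ∈ D → Adj α z → z ≡ a
            only {z} f₁z α∈ αz with z ∈? D
            ... | yes z∈ = trans (sym (same b∈ z∈ f₂b f₁z)) (same b∈ a∈ f₂b f₁a)
            ... | no  z∉ = ⊥-elim (isolated₁ f₁z z∉ α∈ (adj-sym αz))
            ¬t : ∀ {α} → α ∈ D → ¬ Adj α t
            ¬t α∈ αt = isolated₂ f₂t t∉D α∈ (adj-sym αt)
            vt : V t
            vt = adj-E f₂t e₂
            clash : Dec (Adj e′ a) → ⊥
            clash (yes e′a) = almost-disjoint-cover ee′ e₁ vt (adj-E eu ee) (λ { refl → ¬t e∈ eu })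
              (λ e′z f₁z → only f₁z e′∈ e′z) (¬t e′∈) ¬f₁t ¬e′u
              (λ f₁u → case only f₁u e∈ eu of λ { refl → ¬e′u e′a })
            clash (no ¬e′a) = disjoint-cover ee′ e₁ vt
              (λ e′z f₁z → case only f₁z e′∈ e′z of λ { refl → ¬e′a e′z }) (¬t e′∈) ¬f₁t

      large-absurd : ⊥
      large-absurd with has-E (proj₁ lg)
      ... | e , e∈ , ee with rotate-to (proj₁ lg) e∈
      ...   | [] , c , p with subst (4 ≤_) (sym (↭-length p)) 4≤D
      ...     | s≤s ()
      large-absurd | e , e∈ , ee | _ ∷ [] , c , p with subst (4 ≤_) (sym (↭-length p)) 4≤D
      ...     | s≤s (s≤s ())
      large-absurd | e , e∈ , ee | v ∷ e′ ∷ w , c , p with walk c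
      ...   | ev ∷ (ve′ ∷ u) with walk-head u
      ...     | refl = Unique-head∉ (uniq c) (subst (_∈ v ∷ e′ ∷ w)
                  (sym (extensional ee ee′ (e⊆e′ e∈ (∈-resp-↭ p (there (there (here refl)))) ee ee′))) (there (here refl)))
        where
        ee′ : E e′
        ee′ = adj-V ve′ (adj-E ev ee)

    no-large-cycle : ∀ {K} → Cycle K → (∀ {y} → y ∈ K → y ∉ D) → 4 ≤ length K → length D + 2 ≤ 2 * length K → ⊥
    no-large-cycle cK K-off 4≤K large with has-E cK
    ... | f , f∈ , ef with rotate-to cK f∈
    ...   | [] , c , p with subst (4 ≤_) (sym (↭-length p)) 4≤K
    ...     | s≤s ()
    no-large-cycle cK K-off 4≤K large | f , f∈ , ef | _ ∷ [] , c , p with subst (4 ≤_) (sym (↭-length p)) 4≤K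
    ...     | s≤s (s≤s ())
    no-large-cycle cK K-off 4≤K large | f , f∈ , ef | _ ∷ _ ∷ _ , c , p =
      large-absurd c (λ q → K-off (∈-resp-↭ p q)) ef (subst (λ n → length D + 2 ≤ 2 * n) (sym (↭-length p)) large)

    -- A path end all of whose neighbours lie on the path would close up to a large cycle.
    vertex-end-reaches : ∀ {a b Q} → vs D < k → PathOff D a b Q → V a → Saturated D Q a → 1 ≤ a # D
    vertex-end-reaches {a} {b} {Q} D<k P va sat with a # D in eq
    ... | suc _ = s≤s z≤n
    ... | zero with close-path (pwalk P) (puniq P) (nb-unique a) (≤-trans (≤-trans (s≤s z≤n) 2≤h) (vertex-degree va)) in-Q
      where
      in-Q : ∀ {x} → x ∈ nb a → x ∈ Q × Adj a x
      in-Q x∈ with sat (∈-nb⁻ x∈)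
      ... | inj₁ p = ⊥-elim (#-none eq p (∈-nb⁻ x∈))
      ... | inj₂ p = p , ∈-nb⁻ x∈
    -- `K` has at least 2h ≥ k > vs D nodes, which is what `no-large-cycle` forbids.
    ...   | K , cK , K⊆Q , 2h≤K = ⊥-elim (no-large-cycle cK (λ p → off P (K⊆Q p))
             (≤-trans (+-mono-≤ 2≤h 2≤h) hh≤K)
             (begin
               length D + 2            ≡⟨ cong (_+ 2) (cycle-length (proj₁ lg)) ⟩
               vs D + vs D + 2         ≡⟨ eq₁ (vs D) ⟩
               2 * suc (vs D)          ≤⟨ *-monoʳ-≤ 2 (≤-trans D<k (≤-trans k≤2h hh≤K)) ⟩
               2 * length K            ∎))
      where
      open ≤-Reasoning
      hh≤K : h + h ≤ length K
      hh≤K = ≤-trans (+-mono-≤ (vertex-degree va) (vertex-degree va)) 2h≤K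
      eq₁ : ∀ n → n + n + 2 ≡ 2 * suc n
      eq₁ = solve-∀

-- The linear inequalities behind the counts

module Arithmetic where

  swap-zero : ∀ a b c → a + 2 * 0 + b + c ≡ a + b + 2 * 0 + c
  swap-zero a b c = cong (_+ c) (trans (cong (_+ b) (+-identityʳ a)) (sym (+-identityʳ (a + b))))

  -- A path between two edges has p + suc p nodes; B, L, R count the nodes of D adjacent to both ends,
  -- only to the first, only to the second.
  module EdgeEdge (p′ B L R r ℓ : ℕ) where
    p q : ℕ
    p = suc p′
    q = p + suc p

    abstract
      left-right : r ≤ B + L + p → r ≤ B + R + p → ℓ + p ≤ r + r →
        suc q * B + 2 * L + 2 * R + ((q ∸ 1) + (q ∸ 1)) ≤ ℓ + ℓ → ⊥
      left-right h₁ h₂ h₃ h₄ = ≤-absurd (2 * p′ * B + 2 * p′ + 1)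
        (+-mono-≤ h₄ (+-mono-≤ (*-monoʳ-≤ 2 h₃) (+-mono-≤ (*-monoʳ-≤ 2 h₁) (*-monoʳ-≤ 2 h₂))))
        (eq p′ B L R r ℓ)
        where
        eq : ∀ p′ B L R r ℓ → suc (suc p′ + suc (suc p′)) * B + 2 * L + 2 * R + ((p′ + suc (suc p′)) + (p′ + suc (suc p′)))
               + (2 * (ℓ + suc p′) + (2 * r + 2 * r))
             ≡ suc ((ℓ + ℓ) + (2 * (r + r) + (2 * (B + L + suc p′) + 2 * (B + R + suc p′))) + (2 * p′ * B + 2 * p′ + 1))
        eq = solve-∀

      one-sided : r ≤ B + p → ℓ + p ≤ r + r → suc q * B + 2 * suc L + 2 * 0 + ((q ∸ 1) + 0) ≤ ℓ + ℓ → ⊥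
      one-sided h₁ h₃ h₄ = ≤-absurd (2 * p′ * B + 2 * L + 1)
        (+-mono-≤ h₄ (+-mono-≤ (*-monoʳ-≤ 2 h₃) (*-monoʳ-≤ 4 h₁))) (eq p′ B L r ℓ)
        where
        eq : ∀ p′ B L r ℓ → suc (suc p′ + suc (suc p′)) * B + 2 * suc L + 2 * 0 + ((p′ + suc (suc p′)) + 0)
               + (2 * (ℓ + suc p′) + 4 * r)
             ≡ suc ((ℓ + ℓ) + (2 * (r + r) + 4 * (B + suc p′)) + (2 * p′ * B + 2 * L + 1))
        eq = solve-∀

      equal : suc r ≤ suc B + p → ℓ + p ≤ r + r → suc q * suc B + 2 * 0 + 2 * 0 ≤ ℓ + ℓ → ⊥
      equal h₁ h₃ h₄ = ≤-absurd (2 * p′ * B + 1)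
        (+-mono-≤ h₄ (+-mono-≤ (*-monoʳ-≤ 2 h₃) (*-monoʳ-≤ 4 h₁))) (eq p′ B r ℓ)
        where
        eq : ∀ p′ B r ℓ → suc (suc p′ + suc (suc p′)) * suc B + 2 * 0 + 2 * 0 + (2 * (ℓ + suc p′) + 4 * suc r)
             ≡ suc ((ℓ + ℓ) + (2 * (r + r) + 4 * (suc B + suc p′)) + (2 * p′ * B + 1))
        eq = solve-∀

  q∸3 : ∀ s′ → (suc (suc s′) + suc s′) ∸ 3 ≡ s′ + s′
  q∸3 s′ = cong (_∸ 1) (+-suc s′ s′)

  -- A path between two vertices has suc s + s nodes.
  module VertexVertex (s′ B L R h ℓ : ℕ) where
    s q : ℕ
    s = suc s′
    q = suc s + s

    abstract
      left-right : h ≤ B + L + s → h ≤ B + R + s → suc ℓ ≤ h + h →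
        suc q * B + 2 * L + 2 * R + ((q ∸ 1) + (q ∸ 1)) ≤ ℓ + ℓ → ⊥
      left-right h₁ h₂ h₃ h₄ = ≤-absurd (2 * s′ * B + 1)
        (+-mono-≤ h₄ (+-mono-≤ (*-monoʳ-≤ 2 h₃) (+-mono-≤ (*-monoʳ-≤ 2 h₁) (*-monoʳ-≤ 2 h₂)))) (eq s′ B L R h ℓ)
        where
        eq : ∀ s′ B L R h ℓ → suc (suc (suc s′) + suc s′) * B + 2 * L + 2 * R + ((suc s′ + suc s′) + (suc s′ + suc s′))
               + (2 * suc ℓ + (2 * h + 2 * h))
             ≡ suc ((ℓ + ℓ) + (2 * (h + h) + (2 * (B + L + suc s′) + 2 * (B + R + suc s′))) + (2 * s′ * B + 1))
        eq = solve-∀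

      one-sided : h ≤ suc B + s → suc ℓ ≤ h + h → suc q * suc B + 2 * suc L + 2 * 0 + ((q ∸ 1) + 0) ≤ ℓ + ℓ → ⊥
      one-sided h₁ h₃ h₄ = ≤-absurd (2 * s′ * B + 2 * L + 1)
        (+-mono-≤ h₄ (+-mono-≤ (*-monoʳ-≤ 2 h₃) (*-monoʳ-≤ 4 h₁))) (eq s′ B L h ℓ)
        where
        eq : ∀ s′ B L h ℓ → suc (suc (suc s′) + suc s′) * suc B + 2 * suc L + 2 * 0 + ((suc s′ + suc s′) + 0)
               + (2 * suc ℓ + 4 * h)
             ≡ suc ((ℓ + ℓ) + (2 * (h + h) + 4 * (suc B + suc s′)) + (2 * s′ * B + 2 * L + 1))
        eq = solve-∀

      single : ∀ σ → h ≤ suc B + s → suc ℓ ≤ h + h → suc q * suc B + 2 * (2 + σ) + (0 + (q ∸ 3)) ≤ ℓ + ℓ → ⊥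
      single σ h₁ h₃ h₄ = ≤-absurd (2 * s′ * B + 2 * σ + 1)
        (+-mono-≤ (subst (λ t → suc q * suc B + 2 * (2 + σ) + (0 + t) ≤ ℓ + ℓ) (q∸3 s′) h₄)
          (+-mono-≤ (*-monoʳ-≤ 2 h₃) (*-monoʳ-≤ 4 h₁))) (eq s′ B σ h ℓ)
        where
        eq : ∀ s′ B σ h ℓ → suc (suc (suc s′) + suc s′) * suc B + 2 * (2 + σ) + (0 + (s′ + s′)) + (2 * suc ℓ + 4 * h)
             ≡ suc ((ℓ + ℓ) + (2 * (h + h) + 4 * (suc B + suc s′)) + (2 * s′ * B + 2 * σ + 1))
        eq = solve-∀

      full : ∀ σ β → h ≤ suc B + β → suc β ≤ s → suc ℓ ≤ h + h → suc q * suc B + 2 * suc σ + (0 + (q ∸ 3)) ≤ ℓ + ℓ → ⊥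
      full σ β h₁ h₂ h₃ h₄ = ≤-absurd (2 * s′ * B + 2 * σ + 3)
        (+-mono-≤ (subst (λ t → suc q * suc B + 2 * suc σ + (0 + t) ≤ ℓ + ℓ) (q∸3 s′) h₄)
          (+-mono-≤ (*-monoʳ-≤ 2 h₃) (+-mono-≤ (*-monoʳ-≤ 4 h₁) (*-monoʳ-≤ 4 h₂)))) (eq s′ B σ β h ℓ)
        where
        eq : ∀ s′ B σ β h ℓ → suc (suc (suc s′) + suc s′) * suc B + 2 * suc σ + (0 + (s′ + s′)) + (2 * suc ℓ + (4 * h + 4 * suc β))
             ≡ suc ((ℓ + ℓ) + (2 * (h + h) + (4 * (suc B + β) + 4 * suc s′)) + (2 * s′ * B + 2 * σ + 3))
        eq = solve-∀

  abstract
    -- If `L` and `R` are both positive, the degrees and `ℓ + p ≤ r + r` bound 2ℓ by 4B + 2L + 2R +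
    -- 2p, while the exits alone are worth 4p. If one of them is zero, the degree of that end is
    -- used twice and the bound becomes 4B + 2p. If both are zero, the extra unit in `suc r ≤ B + p`
    -- is what decides.
    edge-edge : ∀ p B L R r ℓ → let q = p + suc p in 1 ≤ p →
      r ≤ B + L + p → r ≤ B + R + p → 1 ≤ B + L → 1 ≤ B + R → ℓ + p ≤ r + r →
      (L ≡ 0 → R ≡ 0 → suc r ≤ B + p) →
      (1 ≤ L → 1 ≤ R → suc q * B + 2 * L + 2 * R + ((q ∸ 1) + (q ∸ 1)) ≤ ℓ + ℓ) →
      (1 ≤ L → 1 ≤ B → suc q * B + 2 * L + 2 * R + ((q ∸ 1) + 0) ≤ ℓ + ℓ) →
      (1 ≤ R → 1 ≤ B → suc q * B + 2 * L + 2 * R + ((q ∸ 1) + 0) ≤ ℓ + ℓ) →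
      (1 ≤ B → suc q * B + 2 * L + 2 * R ≤ ℓ + ℓ) → ⊥
    edge-edge (suc p) B (suc L) (suc R) r ℓ _ hL hR _ _ hℓ _ lr _ _ _ =
      EdgeEdge.left-right p B (suc L) (suc R) r ℓ hL hR hℓ (lr (s≤s z≤n) (s≤s z≤n))
    edge-edge (suc p) B (suc L) zero r ℓ _ _ hR _ 1≤R hℓ _ _ lb _ _ =
      EdgeEdge.one-sided p B L 0 r ℓ (subst (λ t → r ≤ t + suc p) (+-identityʳ B) hR) hℓ
        (lb (s≤s z≤n) (subst (1 ≤_) (+-identityʳ B) 1≤R))
    edge-edge (suc p) B zero (suc R) r ℓ _ hL _ 1≤L _ hℓ _ _ _ rb _ =
      EdgeEdge.one-sided p B R 0 r ℓ (subst (λ t → r ≤ t + suc p) (+-identityʳ B) hL) hℓ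
        (subst (_≤ ℓ + ℓ) (swap-zero (suc (suc p + suc (suc p)) * B) (2 * suc R) _) (rb (s≤s z≤n) (subst (1 ≤_) (+-identityʳ B) 1≤L)))
    edge-edge (suc p) (suc B) zero zero r ℓ _ _ _ _ _ hℓ distinct _ _ _ eq =
      EdgeEdge.equal p B 0 0 r ℓ (distinct refl refl) hℓ (eq (s≤s z≤n))

    -- No contradiction can be expected when `L` and `R` are both zero: the numbers are then
    -- consistent for s = 1, since two vertices may have the same neighbours.
    vertex-vertex : ∀ s B L R h ℓ → let q = suc s + s in 1 ≤ s →
      h ≤ B + L + s → h ≤ B + R + s → 1 ≤ B + R → suc ℓ ≤ h + h →
      (1 ≤ L → 1 ≤ R → suc q * B + 2 * L + 2 * R + ((q ∸ 1) + (q ∸ 1)) ≤ ℓ + ℓ) →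
      (1 ≤ L → 1 ≤ B → suc q * B + 2 * L + 2 * R + ((q ∸ 1) + 0) ≤ ℓ + ℓ) → L ≡ 0
    vertex-vertex s B zero R h ℓ _ _ _ _ _ _ _ = refl
    vertex-vertex (suc s) B (suc L) (suc R) h ℓ _ hL hR _ hℓ lr _ =
      ⊥-elim (VertexVertex.left-right s B (suc L) (suc R) h ℓ hL hR hℓ (lr (s≤s z≤n) (s≤s z≤n)))
    vertex-vertex (suc s) (suc B) (suc L) zero h ℓ _ _ hR _ hℓ _ lb =
      ⊥-elim (VertexVertex.one-sided s B L 0 h ℓ (subst (λ t → h ≤ t + suc s) (+-identityʳ (suc B)) hR) hℓ
        (lb (s≤s z≤n) (s≤s z≤n)))

    -- The hypotheses combine to (2s - 2)B + 2σ ≤ 2s, and `B` is at least 1.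
    vertex-single : ∀ s B σ h ℓ → let q = suc s + s in 1 ≤ s → 1 ≤ B → h ≤ B + s → suc ℓ ≤ h + h →
      suc q * B + 2 * σ + (0 + (q ∸ 3)) ≤ ℓ + ℓ → σ ≤ 1
    vertex-single (suc s) (suc B) zero h ℓ _ _ _ _ _ = z≤n
    vertex-single (suc s) (suc B) (suc zero) h ℓ _ _ _ _ _ = s≤s z≤n
    vertex-single (suc s) (suc B) (suc (suc σ)) h ℓ _ _ h₁ h₃ h₄ =
      ⊥-elim (VertexVertex.single s B 0 0 h ℓ σ h₁ h₃ h₄)

    -- The hypotheses combine to (2s - 2)B + 2σ + 2s ≤ 4β, whose left side is at least 4s.
    vertex-full : ∀ s B σ β h ℓ → let q = suc s + s in 1 ≤ s → 1 ≤ B → 1 ≤ σ → h ≤ B + β → suc ℓ ≤ h + h →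
      suc q * B + 2 * σ + (0 + (q ∸ 3)) ≤ ℓ + ℓ → s ≤ β
    vertex-full (suc s) (suc B) (suc σ) β h ℓ _ _ _ h₁ h₃ h₄ =
      ≮⇒≥ λ lt → VertexVertex.full s B 0 0 h ℓ σ β h₁ lt h₃ h₄

    -- A path between a vertex and an edge has p + p nodes, p = suc p′.
    vertex-edge : ∀ p′ L R h r ℓ N → h ≤ L + suc p′ → r ≤ R + suc p′ → suc ℓ ≤ h + h → N ≤ r + r →
      2 * L + 2 * R + ((p′ + suc p′) + (p′ + suc p′)) ≤ ℓ + ℓ → N ≤ suc ℓ
    vertex-edge p′ L R h r ℓ N h₁ h₂ h₃ h₄ h₅ = ≮⇒≥ λ lt → ≤-absurd 0
      (+-mono-≤ h₅ (+-mono-≤ (*-monoʳ-≤ 2 h₁) (+-mono-≤ (*-monoʳ-≤ 2 h₂) (+-mono-≤ h₃ (+-mono-≤ h₄ lt)))))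
      (eq p′ L R h r ℓ N)
      where
      eq : ∀ p′ L R h r ℓ N → 2 * L + 2 * R + ((p′ + suc p′) + (p′ + suc p′)) + (2 * h + (2 * r + (suc ℓ + (N + suc (suc ℓ)))))
         ≡ suc ((ℓ + ℓ) + (2 * (L + suc p′) + (2 * (R + suc p′) + ((h + h) + ((r + r) + N)))) + 0)
      eq = solve-∀

    -- 2L ≥ 2h - 2 ≥ ℓ - 1, and 3R ≥ 2r + (r - 3) ≥ ℓ + 1 because `3 ≤ r`; with the exit charge 1
    -- the total is at least 2ℓ + 1.
    no-triple : ∀ L R h r ℓ → h ≤ L + 1 → r ≤ R + 1 → suc ℓ ≤ h + h → suc ℓ ≤ r + r → 3 ≤ r →
      2 * L + 3 * R + (1 + 0) ≤ ℓ + ℓ → ⊥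
    no-triple L R h r ℓ h₁ h₂ h₃ h₄ h₅ h₆ = ≤-absurd 0
      (+-mono-≤ h₆ (+-mono-≤ (*-monoʳ-≤ 2 h₁) (+-mono-≤ (*-monoʳ-≤ 3 h₂) (+-mono-≤ h₃ (+-mono-≤ h₄ h₅)))))
      (eq L R h r ℓ)
      where
      eq : ∀ L R h r ℓ → 2 * L + 3 * R + (1 + 0) + (2 * h + (3 * r + (suc ℓ + (suc ℓ + 3))))
         ≡ suc ((ℓ + ℓ) + (2 * (L + 1) + (3 * (R + 1) + ((h + h) + ((r + r) + r)))) + 0)
      eq = solve-∀

    crossing-sum : ∀ u f h r ℓ N → h ≤ u → r ≤ f → suc ℓ ≤ h + h → N ≤ r + r → u + f ≤ suc ℓ → N ≤ suc ℓ
    crossing-sum u f h r ℓ N h₁ h₂ h₃ h₄ h₅ = ≮⇒≥ λ lt → ≤-absurd 0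
      (+-mono-≤ (*-monoʳ-≤ 2 h₅) (+-mono-≤ (*-monoʳ-≤ 2 h₁) (+-mono-≤ (*-monoʳ-≤ 2 h₂) (+-mono-≤ h₃ (+-mono-≤ h₄ lt)))))
      (eq u f h r ℓ N)
      where
      eq : ∀ u f h r ℓ N → 2 * (u + f) + (2 * h + (2 * r + (suc ℓ + (N + suc (suc ℓ)))))
         ≡ suc (2 * suc ℓ + (2 * u + (2 * f + ((h + h) + ((r + r) + N)))) + 0)
      eq = solve-∀

    crossing-tight : ∀ u f h r ℓ → h ≤ u → r ≤ f → suc ℓ ≤ h + h → suc ℓ ≤ r + r → u + f ≤ ℓ → ⊥
    crossing-tight u f h r ℓ h₁ h₂ h₃ h₄ h₅ = ≤-absurd 1
      (+-mono-≤ (*-monoʳ-≤ 2 h₅) (+-mono-≤ (*-monoʳ-≤ 2 h₁) (+-mono-≤ (*-monoʳ-≤ 2 h₂) (+-mono-≤ h₃ h₄))))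
      (eq u f h r ℓ)
      where
      eq : ∀ u f h r ℓ → 2 * (u + f) + (2 * h + (2 * r + (suc ℓ + suc ℓ)))
         ≡ suc (2 * ℓ + (2 * u + (2 * f + ((h + h) + (r + r)))) + 1)
      eq = solve-∀

-- Outside paths whose ends have no neighbours elsewhere

module PathEnds (I : Incidence) where
  open Incidence I
  open Basics I
  open EdgesReach I
  open OutsideCycles I

  edge-degree : ∀ {D Q a} → E a → Saturated D Q a → r ≤ a # D + a # Q
  edge-degree ea sat = ≤-trans (≤-reflexive (sym (edge-size ea))) (degree-split sat)

  V-degree : ∀ {D Q a} → V a → Saturated D Q a → h ≤ a # D + a # Q
  V-degree va sat = ≤-trans (vertex-degree va) (degree-split sat)

  vs-filter : ∀ l → vs l ≡ length (filter (λ x → isV x BoolP.≟ true) l)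
  vs-filter [] = refl
  vs-filter (x ∷ l) with isV x
  ... | true  = cong suc (vs-filter l)
  ... | false = vs-filter l

  es-filter : ∀ l → es l ≡ length (filter (λ x → isV x BoolP.≟ false) l)
  es-filter [] = refl
  es-filter (x ∷ l) with isV x
  ... | true  = es-filter l
  ... | false = cong suc (es-filter l)

  vs-++ : ∀ k l → vs (k ++ l) ≡ vs k + vs l
  vs-++ [] l = refl
  vs-++ (x ∷ k) l with isV x
  ... | true  = cong suc (vs-++ k l)
  ... | false = vs-++ k l

  vs-bound : ∀ {l} → Unique l → vs l ≤ length vertices
  vs-bound {l} u = ≤-trans (≤-reflexive (vs-filter l))
    (V-length (Uniq.filter⁺ (λ x → isV x BoolP.≟ true) u) (λ x∈ → proj₂ (∈-filter⁻ (λ x → isV x BoolP.≟ true) {xs = l} x∈)))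

  vs-bound₂ : ∀ {D Q} → Unique D → Unique Q → (∀ {x} → x ∈ Q → x ∉ D) → vs D + vs Q ≤ length vertices
  vs-bound₂ {D} {Q} u u′ o = ≤-trans (≤-reflexive (sym (vs-++ D Q))) (vs-bound (++-Unique u u′ (λ p q → o q p)))

  one-outside : ∀ {D x y} → Unique D → length vertices ≤ suc (vs D) → V x → V y → x ∉ D → y ∉ D → x ≡ y
  one-outside {D} {x} {y} u small vx vy x∉ y∉ with x ≟ y
  ... | yes eq = eq
  ... | no  ne = ⊥-elim (<-irrefl refl (≤-trans (≤-reflexive (+-comm 2 (vs D)))
        (≤-trans (subst (λ n → vs D + n ≤ length vertices) two (vs-bound₂ u
          (∷-Unique {xs = y ∷ []} (λ { (here refl) → ne refl }) (∷-Unique (λ ()) []))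
          λ { (here refl) → x∉ ; (there (here refl)) → y∉ })) small)))
    where
    two : vs (x ∷ y ∷ []) ≡ 2
    two rewrite vx | vy = refl

  module _ {D} (lg : Longest D) (4≤D : 4 ≤ length D) (D<k : vs D < k) where

    private
      cy : Cycle D
      cy = proj₁ lg

      ℓ : ℕ
      ℓ = vs D

      ℓ<2h : suc ℓ ≤ h + h
      ℓ<2h = ≤-trans D<k k≤2h

      2ℓ : ∀ {x} → x ≤ length D → x ≤ ℓ + ℓ
      2ℓ p = ≤-trans p (≤-reflexive (cycle-length cy))

    module _ {a b Q} (P : PathOff D a b Q) (a≢b : a ≢ b) (satₐ : Saturated D Q a) (sat_b : Saturated D Q b) where
      open TwoEnds lg P

      private
        ℓ+p≤2r : ℓ + vs Q ≤ r + r
        ℓ+p≤2r = ≤-trans (vs-bound₂ (uniq cy) (puniq P) (off P)) vertices≤2r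

      edge-edge-absurd : E a → E b → ⊥
      edge-edge-absurd ea eb = Arithmetic.edge-edge (vs Q) nB nL nR r ℓ 1≤p
        (≤-trans rₐ (+-monoʳ-≤ (nB + nL) (#-≤vs Q ea))) (≤-trans r_b (+-monoʳ-≤ (nB + nR) (#-≤vs Q eb)))
        1≤a 1≤b ℓ+p≤2r distinct
        (λ l r → spaced {λ q → suc q * nB + 2 * nL + 2 * nR + ((q ∸ 1) + (q ∸ 1))} (left-right l r))
        (λ l b → spaced {λ q → suc q * nB + 2 * nL + 2 * nR + ((q ∸ 1) + 0)} (left-both l b))
        (λ r b → spaced {λ q → suc q * nB + 2 * nL + 2 * nR + ((q ∸ 1) + 0)} (right-both r b))
        (λ b → spaced {λ q → suc q * nB + 2 * nL + 2 * nR} (both-only b))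
        where
        q≡ : length Q ≡ vs Q + suc (vs Q)
        q≡ = trans (length-vs-es Q) (cong (vs Q +_) (walk-EE (pwalk P) ea eb))
        rₐ : r ≤ nB + nL + a # Q
        rₐ = subst (λ t → r ≤ t + a # Q) (#-left D) (edge-degree ea satₐ)
        r_b : r ≤ nB + nR + b # Q
        r_b = subst (λ t → r ≤ t + b # Q) (#-right D) (edge-degree eb sat_b)
        1≤a : 1 ≤ nB + nL
        1≤a = subst (1 ≤_) (#-left D) (reach lg 4≤D ea (off P (walk-first∈ (pwalk P))))
        1≤b : 1 ≤ nB + nR
        1≤b = subst (1 ≤_) (#-right D) (reach lg 4≤D eb (off P (walk-last∈ (pwalk P))))
        spaced : ∀ {f : ℕ → ℕ} → f (length Q) ≤ length D → f (vs Q + suc (vs Q)) ≤ ℓ + ℓ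
        spaced {f} p = 2ℓ (subst (λ q → f q ≤ length D) q≡ p)
        1≤p : 1 ≤ vs Q
        1≤p with vs Q | pwalk P | q≡
        ... | suc _ | _ | _ = s≤s z≤n
        ... | zero | [ _ ] | _ = contradiction refl a≢b
        ... | zero | _ ∷ [ _ ] | ()
        ... | zero | _ ∷ (_ ∷ _) | ()
        -- If this failed, the degree of `b` would force `b` to contain every vertex of `Q`. It also
        -- contains the vertices of `a` on `D`, as `nL` is zero; so `a` would be contained in `b`
        -- and equal to it.
        distinct : nL ≡ 0 → nR ≡ 0 → suc r ≤ nB + vs Q
        distinct eL eR = ≰⇒> λ le → a≢b (extensional ea eb λ av → case satₐ av of λ where
          (inj₁ v∈D) → no-left eL v∈D av
          (inj₂ v∈Q) → #-full-vs Q eb (+-cancelˡ-≤ nB _ _ (≤-trans le (≤-trans r_b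
                          (≤-reflexive (cong (_+ b # Q) (trans (cong (nB +_) eR) (+-identityʳ nB))))))) v∈Q (adj-E av ea))
      vertex-vertex-equal : V a → V b → ∀ {x} → x ∈ D → Adj a x → Adj b x
      vertex-vertex-equal va vb = no-left (Arithmetic.vertex-vertex (es Q) nB nL nR h ℓ 1≤s
        (≤-trans hₐ (+-monoʳ-≤ (nB + nL) (#-≤es Q va))) (≤-trans h_b (+-monoʳ-≤ (nB + nR) (#-≤es Q vb)))
        1≤b ℓ<2h
        (λ l r → spaced {λ q → suc q * nB + 2 * nL + 2 * nR + ((q ∸ 1) + (q ∸ 1))} (left-right l r))
        (λ l b → spaced {λ q → suc q * nB + 2 * nL + 2 * nR + ((q ∸ 1) + 0)} (left-both l b)))
        where
        q≡ : length Q ≡ suc (es Q) + es Q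
        q≡ = trans (length-vs-es Q) (cong (_+ es Q) (walk-VV (pwalk P) va vb))
        hₐ : h ≤ nB + nL + a # Q
        hₐ = subst (λ t → h ≤ t + a # Q) (#-left D) (V-degree va satₐ)
        h_b : h ≤ nB + nR + b # Q
        h_b = subst (λ t → h ≤ t + b # Q) (#-right D) (V-degree vb sat_b)
        1≤b : 1 ≤ nB + nR
        1≤b = subst (1 ≤_) (#-right D) (vertex-end-reaches lg 4≤D D<k (pathOff-reverse P) vb
                 (λ bx → case sat_b bx of λ { (inj₁ p) → inj₁ p ; (inj₂ p) → inj₂ (∈-resp-↭ (↭-sym (↭-reverse Q)) p) }))
        spaced : ∀ {f : ℕ → ℕ} → f (length Q) ≤ length D → f (suc (es Q) + es Q) ≤ ℓ + ℓ
        spaced {f} p = 2ℓ (subst (λ q → f q ≤ length D) q≡ p)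
        1≤s : 1 ≤ es Q
        1≤s with es Q | pwalk P | q≡
        ... | suc _ | _ | _ = s≤s z≤n
        ... | zero | [ _ ] | _ = contradiction refl a≢b
        ... | zero | _ ∷ [ _ ] | ()
        ... | zero | _ ∷ (_ ∷ _) | ()

      -- For ends of different kinds the charging is not contradictory by itself; what it yields is
      -- that at most one vertex lies outside `D`.
      vertex-edge-tight : V a → E b → length vertices ≤ suc ℓ
      vertex-edge-tight va eb = go (vs Q) refl
        where
        q≡ : length Q ≡ vs Q + vs Q
        q≡ = trans (length-vs-es Q) (cong (vs Q +_) (walk-VE (pwalk P) va eb))
        B≡0 : nB ≡ 0
        B≡0 = clsNum-both-VE va eb D
        a≡ : a # D ≡ nL
        a≡ = trans (#-left D) (cong (_+ nL) B≡0)
        b≡ : b # D ≡ nR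
        b≡ = trans (#-right D) (cong (_+ nR) B≡0)
        go : ∀ p → vs Q ≡ p → length vertices ≤ suc ℓ
        go zero eq with pwalk P | trans q≡ (cong (λ n → n + n) eq)
        ... | [ _ ] | ()
        ... | _ ∷ _ | ()
        go (suc p′) eq = Arithmetic.vertex-edge p′ nL nR h r ℓ (length vertices)
          (≤-trans (V-degree va satₐ) (+-mono-≤ (≤-reflexive a≡)
            (≤-trans (#-≤es Q va) (≤-reflexive (trans (walk-VE (pwalk P) va eb) eq)))))
          (≤-trans (edge-degree eb sat_b) (+-mono-≤ (≤-reflexive b≡) (≤-trans (#-≤vs Q eb) (≤-reflexive eq))))
          ℓ<2h vertices≤2r
          (2ℓ (resolve (left-right
            (subst (1 ≤_) a≡ (vertex-end-reaches lg 4≤D D<k P va satₐ))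
            (subst (1 ≤_) b≡ (reach lg 4≤D eb (off P (walk-last∈ (pwalk P))))))))
          where
          resolve : suc (length Q) * nB + 2 * nL + 2 * nR + ((length Q ∸ 1) + (length Q ∸ 1)) ≤ length D →
            2 * nL + 2 * nR + ((p′ + suc p′) + (p′ + suc p′)) ≤ length D
          resolve p rewrite B≡0 | *-zeroʳ (length Q) | trans q≡ (cong (λ n → n + n) eq) = p

-- Crossing chords: an isolated vertex and an isolated edge

module Crossing (I : Incidence) where
  open Incidence I
  open Basics I
  open OutsideCycles I
  open PathEnds I

  -- `Exchange.exchanged` establishes the same conditions for another cycle, so every consequence of
  -- them can be used on both cycles.
  record Isolated (D : List Node) (u f : Node) : Set where
    field
      lg  : Longest D
      D<k : vs D < k
      vu  : V u
      ef  : E f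
      u∉  : u ∉ D
      f∉  : f ∉ D
      u⊆  : ∀ {x} → Adj u x → x ∈ D
      f⊆  : ∀ {x} → Adj f x → x ∈ D

  vs-↭ : ∀ {l l′} → l ↭ l′ → vs l ≡ vs l′
  vs-↭ {l} {l′} p = trans (vs-filter l)
    (trans (↭-length (filter-↭ (λ x → isV x BoolP.≟ true) p)) (sym (vs-filter l′)))

  isolated-↭ : ∀ {D D′ u f} → Isolated D u f → Cycle D′ → D′ ↭ D → Isolated D′ u f
  isolated-↭ i c p = record
    { lg = longest-↭ lg c (↭-length p) ; D<k = subst (_< k) (sym (vs-↭ p)) D<k ; vu = vu ; ef = ef
    ; u∉ = λ q → u∉ (∈-resp-↭ p q) ; f∉ = λ q → f∉ (∈-resp-↭ p q)
    ; u⊆ = λ q → ∈-resp-↭ (↭-sym p) (u⊆ q) ; f⊆ = λ q → ∈-resp-↭ (↭-sym p) (f⊆ q) }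
    where open Isolated i

  flip-cycle : ∀ {x y R} → Cycle (x ∷ y ∷ R) → Cycle (y ∷ x ∷ reverse R)
  flip-cycle {x} {y} {R} c = rotate (reverse R) (subst Cycle eq (cycle-reverse c))
    where
    eq : reverse (x ∷ y ∷ R) ≡ reverse R ++ y ∷ x ∷ []
    eq = trans (unfold-reverse x (y ∷ R)) (trans (cong (_++ x ∷ []) (unfold-reverse y R)) (++-assoc (reverse R) (y ∷ []) (x ∷ [])))

  flip-↭ : ∀ (x y : Node) R → y ∷ x ∷ reverse R ↭ x ∷ y ∷ R
  flip-↭ x y R = swap y x (↭-reverse R)

  #-yes : ∀ {a x} l → Adj a x → a # (x ∷ l) ≡ suc (a # l)
  #-yes {a} {x} l ax with adj? a x
  ... | yes _  = refl
  ... | no ¬ax = contradiction ax ¬ax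

  #-no : ∀ {a x} l → ¬ Adj a x → a # (x ∷ l) ≡ a # l
  #-no {a} {x} l ¬ax with adj? a x
  ... | yes ax = contradiction ax ¬ax
  ... | no _   = refl

  module Pairs (u f : Node) where

    Hit : Node → Node → Set
    Hit e v = Adj u e × Adj f v

    -- The list is read in steps of two: it starts at an edge, and each edge is paired with the
    -- vertex that follows it.
    hits : List Node → ℕ
    hits (e ∷ v ∷ l) with adj? u e | adj? f v
    ... | yes _ | yes _ = suc (hits l)
    ... | _     | _     = hits l
    hits _ = 0

    hits-miss : ∀ {e v} l → ¬ Hit e v → hits (e ∷ v ∷ l) ≡ hits l
    hits-miss {e} {v} l ¬ht with adj? u e | adj? f v
    ... | yes ue | yes fv = contradiction (ue , fv) ¬ht
    ... | yes _  | no _   = refl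
    ... | no _   | _      = refl

    hits-yes : ∀ {e v} l → Hit e v → hits (e ∷ v ∷ l) ≡ suc (hits l)
    hits-yes {e} {v} l (ue , fv) with adj? u e | adj? f v
    ... | yes _  | yes _  = refl
    ... | yes _  | no ¬fv = contradiction fv ¬fv
    ... | no ¬ue | _      = contradiction ue ¬ue

    hits-hit : ∀ {e v} l → hits (e ∷ v ∷ l) ≤ suc (hits l)
    hits-hit {e} {v} l with adj? u e | adj? f v
    ... | yes _ | yes _ = ≤-refl
    ... | yes _ | no _  = n≤1+n _
    ... | no _  | _     = n≤1+n _

    hit? : ∀ e v → Dec (Hit e v)
    hit? e v = adj? u e ×-dec adj? f v

    find-hit : ∀ l → 1 ≤ hits l → ∃ λ M → ∃ λ e → ∃ λ v → ∃ λ R → l ≡ M ++ e ∷ v ∷ R × Hit e v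
    find-hit (e ∷ v ∷ l) p with hit? e v
    ... | yes ht = [] , e , v , l , refl , ht
    ... | no ¬ht with find-hit l (subst (1 ≤_) (hits-miss l ¬ht) p)
    ...   | M , e′ , v′ , R , refl , ht = e ∷ v ∷ M , e′ , v′ , R , refl , ht

    find-hits : ∀ l → 2 ≤ hits l → ∃ λ pre → ∃ λ e → ∃ λ v → ∃ λ M → ∃ λ e′ → ∃ λ v′ → ∃ λ R →
      l ≡ pre ++ e ∷ v ∷ M ++ e′ ∷ v′ ∷ R × Hit e v × Hit e′ v′
    find-hits (e ∷ v ∷ l) p with hit? e v
    ... | yes ht with find-hit l (s≤s⁻¹ (≤-trans p (hits-hit l)))
    ...   | M , e′ , v′ , R , refl , ht′ = [] , e , v , M , e′ , v′ , R , refl , ht , ht′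
    find-hits (e ∷ v ∷ l) p | no ¬ht with find-hits l (subst (2 ≤_) (hits-miss l ¬ht) p)
    ...   | pre , e₁ , v₁ , M , e′ , v′ , R , refl , ht = e ∷ v ∷ pre , e₁ , v₁ , M , e′ , v′ , R , refl , ht

    module _ (vu : V u) (ef : E f) where

      module _ {e v} (l : List Node) (ev : Adj e v) (ee : E e) where

        es-pair : es (e ∷ v ∷ l) ≡ suc (es l)
        es-pair rewrite ee | adj-E ev ee = refl

        ¬uv : ¬ Adj u v
        ¬uv uv = V≢E (adj-E ev ee) (adj-V uv vu)

        ¬fe : ¬ Adj f e
        ¬fe fe = V≢E (adj-E fe ef) ee

        u-pair : u # (e ∷ v ∷ l) ≡ u # (e ∷ l)
        u-pair with adj? u e
        ... | yes _ = cong suc (#-no l ¬uv)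
        ... | no _  = #-no l ¬uv

        f-pair : f # (e ∷ v ∷ l) ≡ f # (v ∷ l)
        f-pair = #-no (v ∷ l) ¬fe

        pair-miss : ¬ Adj u e → ¬ Adj f v → u # (e ∷ v ∷ l) + f # (e ∷ v ∷ l) ≡ u # l + f # l
        pair-miss ¬ue ¬fv = cong₂ _+_ (trans u-pair (#-no l ¬ue)) (trans f-pair (#-no l ¬fv))

        pair-count : u # l + f # l ≤ es l + hits l →
          u # (e ∷ v ∷ l) + f # (e ∷ v ∷ l) ≤ es (e ∷ v ∷ l) + hits (e ∷ v ∷ l)
        pair-count ih = subst (λ n → u # (e ∷ v ∷ l) + f # (e ∷ v ∷ l) ≤ n + hits (e ∷ v ∷ l)) (sym es-pair)
          (go (adj? u e) (adj? f v))
          where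
          open ≤-Reasoning
          go : Dec (Adj u e) → Dec (Adj f v) → u # (e ∷ v ∷ l) + f # (e ∷ v ∷ l) ≤ suc (es l) + hits (e ∷ v ∷ l)
          go (yes ue) (yes fv) = begin
            u # (e ∷ v ∷ l) + f # (e ∷ v ∷ l)   ≡⟨ cong₂ _+_ (trans u-pair (#-yes l ue)) (trans f-pair (#-yes l fv)) ⟩
            suc (u # l) + suc (f # l)           ≡⟨ cong suc (+-suc (u # l) (f # l)) ⟩
            suc (suc (u # l + f # l))           ≤⟨ s≤s (s≤s ih) ⟩
            suc (suc (es l + hits l))           ≡⟨ cong suc (+-suc (es l) (hits l)) ⟨
            suc (es l) + suc (hits l)           ≡⟨ cong (suc (es l) +_) (hits-yes l (ue , fv)) ⟨
            suc (es l) + hits (e ∷ v ∷ l)       ∎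
          go (yes ue) (no ¬fv) = begin
            u # (e ∷ v ∷ l) + f # (e ∷ v ∷ l)   ≡⟨ cong₂ _+_ (trans u-pair (#-yes l ue)) (trans f-pair (#-no l ¬fv)) ⟩
            suc (u # l) + f # l                 ≤⟨ s≤s ih ⟩
            suc (es l) + hits l                 ≡⟨ cong (suc (es l) +_) (hits-miss l (λ ht → ¬fv (proj₂ ht))) ⟨
            suc (es l) + hits (e ∷ v ∷ l)       ∎
          go (no ¬ue) (yes fv) = begin
            u # (e ∷ v ∷ l) + f # (e ∷ v ∷ l)   ≡⟨ cong₂ _+_ (trans u-pair (#-no l ¬ue)) (trans f-pair (#-yes l fv)) ⟩
            u # l + suc (f # l)                 ≡⟨ +-suc (u # l) (f # l) ⟩
            suc (u # l + f # l)                 ≤⟨ s≤s ih ⟩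
            suc (es l) + hits l                 ≡⟨ cong (suc (es l) +_) (hits-miss l (λ ht → ¬ue (proj₁ ht))) ⟨
            suc (es l) + hits (e ∷ v ∷ l)       ∎
          go (no ¬ue) (no ¬fv) = begin
            u # (e ∷ v ∷ l) + f # (e ∷ v ∷ l)   ≡⟨ pair-miss ¬ue ¬fv ⟩
            u # l + f # l                       ≤⟨ m≤n⇒m≤1+n ih ⟩
            suc (es l) + hits l                 ≡⟨ cong (suc (es l) +_) (hits-miss l (λ ht → ¬ue (proj₁ ht))) ⟨
            suc (es l) + hits (e ∷ v ∷ l)       ∎

      -- A pair contributes at most one to the left side, or two if it is a hit.
      count : ∀ {e b} l → Walk e b l → E e → V b → u # l + f # l ≤ es l + hits l
      count (e ∷ []) [ _ ] ee ve = ⊥-elim (V≢E ve ee)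
      count (e ∷ v ∷ []) (ev ∷ w) ee vb with walk-head w
      ... | refl = pair-count [] ev ee z≤n
      count (e ∷ v ∷ e′ ∷ l) (ev ∷ (ve′ ∷ w)) ee vb with walk-head w
      ... | refl = pair-count (e′ ∷ l) ev ee (count (e′ ∷ l) w (adj-V ve′ (adj-E ev ee)) vb)

  module _ {D u f} (i : Isolated D u f) where
    open Isolated i
    open Pairs u f

    private
      cy : Cycle D
      cy = proj₁ lg

    no-crossing : ∀ {e v M e′ v′ R} → Cycle (e ∷ v ∷ M ++ e′ ∷ v′ ∷ R) → e ∷ v ∷ M ++ e′ ∷ v′ ∷ R ↭ D →
      Hit e v → Hit e′ v′ → ⊥
    no-crossing c p (ue , fv) (ue′ , fv′) with cross c (λ q → u∉ (∈-resp-↭ p q)) (λ q → f∉ (∈-resp-↭ p q))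
      (λ { refl → V≢E vu ef }) ue ue′ fv fv′
    ... | D′ , c′ , len = <-irrefl refl (≤-trans (s≤s (n≤1+n (length D)))
          (≤-trans (≤-reflexive (sym (trans len (cong (2 +_) (↭-length p))))) (proj₂ lg c′)))

    hits≤1 : ∀ {l} → Cycle l → l ↭ D → hits l ≤ 1
    hits≤1 {l} c p = ≮⇒≥ λ lt → case find-hits l lt of λ where
      (pre , e , v , M , e′ , v′ , R , eq , ht , ht′) →
        no-crossing (subst Cycle (++-assoc (e ∷ v ∷ M) (e′ ∷ v′ ∷ R) pre) (rotate pre (subst Cycle eq c)))
          (↭-trans (↭-reflexive (sym (++-assoc (e ∷ v ∷ M) (e′ ∷ v′ ∷ R) pre)))
            (↭-trans (↭-++-comm (e ∷ v ∷ M ++ e′ ∷ v′ ∷ R) pre) (↭-trans (↭-reflexive (sym eq)) p))) ht ht′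

    private
      ℓ<2h : suc (vs D) ≤ h + h
      ℓ<2h = ≤-trans D<k k≤2h

      h≤u : h ≤ u # D
      h≤u = ≤-trans (vertex-degree vu) (≤-trans (degree-split {Q = []} (λ q → inj₁ (u⊆ q))) (≤-reflexive (+-identityʳ _)))

      r≤f : r ≤ f # D
      r≤f = ≤-trans (≤-reflexive (sym (edge-size ef)))
        (≤-trans (degree-split {Q = []} (λ q → inj₁ (f⊆ q))) (≤-reflexive (+-identityʳ _)))

      ℓ<2r : suc (vs D) ≤ r + r
      ℓ<2r = ≤-trans D<k (≤-trans k≤vertices vertices≤2r)

      sum-≤ : u # D + f # D ≤ suc (vs D)
      sum-≤ with has-E cy
      ... | e , e∈ , ee with rotate-to cy e∈
      ...   | w , c , p with walk-head (walk c)
      ...     | refl = begin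
        u # D + f # D                   ≡⟨ cong₂ _+_ (#-↭ p) (#-↭ p) ⟨
        u # (e ∷ w) + f # (e ∷ w)       ≤⟨ count vu ef (e ∷ w) (walk c) ee (adj-E (adj-sym (close c)) ee) ⟩
        es (e ∷ w) + hits (e ∷ w)       ≤⟨ +-monoʳ-≤ (es (e ∷ w)) (hits≤1 c p) ⟩
        es (e ∷ w) + 1                  ≡⟨ cong (_+ 1) (trans (cycle-balance c) (vs-↭ p)) ⟩
        vs D + 1                        ≡⟨ +-comm (vs D) 1 ⟩
        suc (vs D)                      ∎
        where open ≤-Reasoning

    -- Doubling `sum-≤` gives 2h + 2r ≤ 2ℓ + 2; here 2h is at least ℓ + 1, which leaves 2r ≤ ℓ + 1.
    vertices-≤ : length vertices ≤ suc (vs D)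
    vertices-≤ = Arithmetic.crossing-sum (u # D) (f # D) h r (vs D) (length vertices) h≤u r≤f ℓ<2h vertices≤2r sum-≤

    -- If `u` lay on every edge of `D`, then `sum-≤` would leave `f` with at most one vertex.
    missed-edge : ∃ λ e → e ∈ D × E e × ¬ Adj u e
    missed-edge = scan D (≰⇒> λ le → <-irrefl refl (begin-strict
        suc (vs D)            <⟨ n<1+n (suc (vs D)) ⟩
        2 + vs D              ≡⟨ +-comm 2 (vs D) ⟩
        vs D + 2              ≤⟨ +-mono-≤ (≤-trans (≤-reflexive (sym (cycle-balance cy))) le) (≤-trans (≤-trans (n≤1+n 2) 3≤r) r≤f) ⟩
        u # D + f # D         ≤⟨ sum-≤ ⟩
        suc (vs D)            ∎))
      where
      open ≤-Reasoning
      scan : ∀ l → u # l < es l → ∃ λ e → e ∈ l × E e × ¬ Adj u e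
      scan (x ∷ l) lt with adj? u x
      ... | yes ux rewrite adj-V ux vu with scan l (s≤s⁻¹ lt)
      ...   | e , e∈ , rest = e , there e∈ , rest
      scan (x ∷ l) lt | no ¬ux with isV x in eq
      ... | false = x , here refl , eq , ¬ux
      ... | true with scan l lt
      ...   | e , e∈ , rest = e , there e∈ , rest

    -- A pair that contributes nothing lowers the bound of `sum-≤` to ℓ, but 2h + 2r ≥ 2ℓ + 2.
    next-hit : ∀ {e v R} → Cycle (e ∷ v ∷ R) → e ∷ v ∷ R ↭ D → E e → ¬ Adj u e → Adj f v
    next-hit {e} {v} {R} c p ee ¬ue with adj? f v
    ... | yes fv = fv
    ... | no ¬fv = ⊥-elim (Arithmetic.crossing-tight (u # D) (f # D) h r (vs D) h≤u r≤f ℓ<2h ℓ<2r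
          (s≤s⁻¹ (begin
            suc (u # D + f # D)                     ≡⟨ cong suc (cong₂ _+_ (#-↭ p) (#-↭ p)) ⟨
            suc (u # (e ∷ v ∷ R) + f # (e ∷ v ∷ R)) ≤⟨ spare ⟩
            es (e ∷ v ∷ R) + hits (e ∷ v ∷ R)       ≤⟨ +-monoʳ-≤ (es (e ∷ v ∷ R)) (hits≤1 c p) ⟩
            es (e ∷ v ∷ R) + 1                      ≡⟨ cong (_+ 1) (trans (cycle-balance c) (vs-↭ p)) ⟩
            vs D + 1                                ≡⟨ +-comm (vs D) 1 ⟩
            suc (vs D)                              ∎)))
      where
      open ≤-Reasoning
      tail-count : ∀ R {b} → Walk e b (e ∷ v ∷ R) → V b → u # R + f # R ≤ es R + hits R
      tail-count [] w vb = z≤n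
      tail-count (e′ ∷ R) (ev ∷ (ve′ ∷ w)) vb with walk-head w
      ... | refl = count vu ef (e′ ∷ R) w (adj-V ve′ (adj-E ev ee)) vb
      first≡ : first c ≡ e
      first≡ = walk-head (walk c)
      wk : Walk e (last c) (e ∷ v ∷ R)
      wk = subst (λ a → Walk a (last c) (e ∷ v ∷ R)) first≡ (walk c)
      vlast : V (last c)
      vlast = adj-E (adj-sym (subst (Adj (last c)) first≡ (close c))) ee
      spare : suc (u # (e ∷ v ∷ R) + f # (e ∷ v ∷ R)) ≤ es (e ∷ v ∷ R) + hits (e ∷ v ∷ R)
      spare with wk
      ... | ev ∷ w′ with walk-head w′
      ...   | refl = subst₂ (λ m n → suc m ≤ n) (sym (pair-miss vu ef R ev ee ¬ue ¬fv))
                (sym (cong₂ _+_ (es-pair vu ef R ev ee) (hits-miss R (λ ht → ¬ue (proj₁ ht)))))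
                (s≤s (tail-count R wk vlast))

  prev-hit : ∀ {D u f} → Isolated D u f → ∀ {v e R} → Cycle (v ∷ e ∷ R) → v ∷ e ∷ R ↭ D → E e → ¬ Adj u e → Adj f v
  prev-hit i {v} {e} {R} c p = next-hit i (flip-cycle c) (↭-trans (flip-↭ v e R) p)

  no-reverse-crossing : ∀ {D u f} → Isolated D u f → ∀ {v e M v′ e′ R} → Cycle (v ∷ e ∷ M ++ v′ ∷ e′ ∷ R) →
    v ∷ e ∷ M ++ v′ ∷ e′ ∷ R ↭ D → Adj f v → Adj u e → Adj f v′ → Adj u e′ → ⊥
  no-reverse-crossing i {v} {e} {M} {v′} {e′} {R} c p fv ue fv′ ue′ =
    no-crossing i (subst Cycle eq (flip-cycle c)) (↭-trans (↭-reflexive (sym eq)) (↭-trans (flip-↭ v e (M ++ v′ ∷ e′ ∷ R)) p))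
      (ue , fv) (ue′ , fv′)
    where
    eq : e ∷ v ∷ reverse (M ++ v′ ∷ e′ ∷ R) ≡ e ∷ v ∷ reverse R ++ e′ ∷ v′ ∷ reverse M
    eq = cong (λ t → e ∷ v ∷ t) (trans (reverse-++ M (v′ ∷ e′ ∷ R)) (trans (cong (_++ reverse M)
      (trans (unfold-reverse v′ (e′ ∷ R)) (trans (cong (_++ v′ ∷ []) (unfold-reverse e′ R)) (++-assoc (reverse R) (e′ ∷ []) (v′ ∷ [])))))
      (++-assoc (reverse R) (e′ ∷ v′ ∷ []) (reverse M))))

  -- An edge e of the cycle missing u is exchanged for f; comparing the two cycles forces f ⊆ e.
  module Exchange {u f e v₁ w₁} (i : Isolated (e ∷ v₁ ∷ w₁) u f) (ee : E e) (¬ue : ¬ Adj u e) where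
    open Isolated i

    private
      w : List Node
      w = v₁ ∷ w₁

      cy : Cycle (e ∷ w)
      cy = proj₁ lg

      f≢e : f ≢ e
      f≢e refl = f∉ (here refl)

      fv₁ : Adj f v₁
      fv₁ = next-hit i cy ↭-refl ee ¬ue

      wk₁ : Walk v₁ (last cy) w
      wk₁ = walk-drop (e ∷ []) (walk cy)

      f-last : Adj f (last cy)
      f-last with EdgesReach.walk-snoc-form I wk₁
      ... | l , eq = prev-hit i (rotate (e ∷ l) (subst Cycle (cong (e ∷_) eq) cy))
          (↭-trans (↭-++-comm (last cy ∷ []) (e ∷ l)) (↭-reflexive (cong (e ∷_) (sym eq)))) ee ¬ue

      shrink : ∀ {x} → x ∈ e ∷ w → x ≢ e → x ∈ f ∷ w
      shrink (here refl) x≢e = contradiction refl x≢e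
      shrink (there p)   _   = there p

      in-cycle : ∀ {x} → Adj e x → x ∈ f ∷ w
      in-cycle {x} ex with x ∈? (e ∷ w)
      ... | yes x∈ = shrink x∈ (λ { refl → adj-irrefl ex })
      ... | no  x∉ with one-outside (uniq cy) (vertices-≤ i) (adj-E ex ee) vu x∉ u∉
      ...   | refl = contradiction (adj-sym ex) ¬ue

      vs≡ : vs (e ∷ w) ≡ vs (f ∷ w)
      vs≡ rewrite ee | ef = refl

    -- Both neighbours of `e` on the cycle belong to `f`, so `f` can take its place. All vertices of
    -- `e` remain on the cycle, since `u` is the only vertex off it and `e` misses `u`.
    exchanged : Isolated (f ∷ w) u e
    exchanged = record
      { lg = longest-↭ lg record { walk = fv₁ ∷ wk₁ ; close = adj-sym f-last
                                 ; uniq = ∷-Unique (λ p → f∉ (there p)) (Unique-++⁻ʳ (e ∷ []) (uniq cy)) } refl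
      ; D<k = subst (_< k) vs≡ D<k ; vu = vu ; ef = ee
      ; u∉ = λ { (here refl) → V≢E vu ef ; (there p) → u∉ (there p) }
      ; f∉ = λ { (here refl) → f≢e refl ; (there p) → Unique-head∉ (uniq cy) p }
      ; u⊆ = λ ux → shrink (u⊆ ux) (λ { refl → ¬ue ux })
      ; f⊆ = in-cycle }

    private
      module _ {v} (fv : Adj f v) (¬ev : ¬ Adj e v) where

        vv : V v
        vv = adj-E fv ef

        turn : ∀ {g} pre {l} → g ∷ w ≡ pre ++ l → l ++ pre ↭ g ∷ w
        turn pre {l} eq = ↭-trans (↭-++-comm l pre) (↭-reflexive (sym eq))

        -- On the exchanged cycle `e` plays the role of `f`, so an edge there that misses `u` has
        -- both of its neighbours in `e`. As `v` is not in `e`, the edges next to `v` must contain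
        -- `u`.
        before : ∀ pre e′ {post} → e ∷ w ≡ pre ++ e′ ∷ v ∷ post → E e′ → Adj u e′
        before [] e′ refl ee′ with walk cy
        ... | ev ∷ wk with walk-head wk
        ...   | refl = contradiction ev ¬ev
        before (_ ∷ pre) e′ {post} eq ee′ with adj? u e′
        ... | yes ue′ = ue′
        ... | no ¬ue′ = contradiction (next-hit exchanged (rotate (f ∷ pre) (subst Cycle eq′ (proj₁ (Isolated.lg exchanged))))
                          (turn (f ∷ pre) eq′) ee′ ¬ue′) ¬ev
          where
          eq′ : f ∷ w ≡ (f ∷ pre) ++ e′ ∷ v ∷ post
          eq′ = cong (f ∷_) (∷-injectiveʳ eq)

        after : ∀ pre e′ {post} → e ∷ w ≡ pre ++ v ∷ e′ ∷ post → E e′ → Adj u e′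
        after [] e′ refl ee′ = ⊥-elim (V≢E vv ee)
        after (_ ∷ pre) e′ {post} eq ee′ with adj? u e′
        ... | yes ue′ = ue′
        ... | no ¬ue′ = contradiction (prev-hit exchanged (rotate (f ∷ pre) (subst Cycle eq′ (proj₁ (Isolated.lg exchanged))))
                          (turn (f ∷ pre) eq′) ee′ ¬ue′) ¬ev
          where
          eq′ : f ∷ w ≡ (f ∷ pre) ++ v ∷ e′ ∷ post
          eq′ = cong (f ∷_) (∷-injectiveʳ eq)

        -- From `e`, which misses `u`, to the edge just before `v`, which contains `u`, there is a
        -- step from an edge `e′` that misses `u` to an edge `e″` that contains it. The vertex `y`
        -- between them lies in `f` by `next-hit`, so y e″ and v e⁺ are crossing chords of the cycle
        -- read backwards.
        chain : ∀ pre e′ w′ → e ∷ w ≡ pre ++ e′ ∷ w′ → Walk e′ (last cy) (e′ ∷ w′) → E e′ → ¬ Adj u e′ → v ∈ w′ → ⊥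
        chain pre e′ (y ∷ w′) eq wk ee′ ¬ue′ (here refl) = ¬ue′ (before pre e′ eq ee′)
        chain pre e′ (y ∷ e″ ∷ w′) eq (e′y ∷ (ye″ ∷ wk)) ee′ ¬ue′ (there v∈) with walk-head wk
        ... | refl with v∈
        ...   | here refl = V≢E vv ee″
          where
          ee″ : E e″
          ee″ = adj-V ye″ (adj-E e′y ee′)
        ...   | there v∈w′ with adj? u e″
        ...     | no ¬ue″ = chain (pre ++ e′ ∷ y ∷ []) e″ w′ (trans eq (sym (++-assoc pre (e′ ∷ y ∷ []) (e″ ∷ w′)))) wk
                    (adj-V ye″ (adj-E e′y ee′)) ¬ue″ v∈w′
        ...     | yes ue″ with ∈-∃++ v∈w′
        -- Here `v` is the last node of the list, so the edge after it is `e`, which does not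
        -- contain it.
        ...       | m , [] , refl = ¬ev (subst (λ x → Adj x v) first≡ (adj-sym (subst (λ x → Adj x (first cy)) last≡ (close cy))))
          where
          first≡ : first cy ≡ e
          first≡ = walk-head (walk cy)
          last≡ : last cy ≡ v
          last≡ with walk-drop (e″ ∷ m) wk
          ... | [ _ ] = refl
        ...       | m , e⁺ ∷ m′ , refl = no-reverse-crossing i {M = m} (subst Cycle assoc (rotate (pre ++ e′ ∷ []) (subst Cycle split cy)))
                    (subst (_↭ e ∷ w) assoc (turn (pre ++ e′ ∷ []) split)) fy ue″ fv ue⁺
          where
          split : e ∷ w ≡ (pre ++ e′ ∷ []) ++ y ∷ e″ ∷ m ++ v ∷ e⁺ ∷ m′
          split = trans eq (sym (++-assoc pre (e′ ∷ []) (y ∷ e″ ∷ m ++ v ∷ e⁺ ∷ m′)))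
          assoc : y ∷ e″ ∷ (m ++ v ∷ e⁺ ∷ m′) ++ (pre ++ e′ ∷ []) ≡ y ∷ e″ ∷ m ++ v ∷ e⁺ ∷ (m′ ++ (pre ++ e′ ∷ []))
          assoc = ++-assoc (y ∷ e″ ∷ m) (v ∷ e⁺ ∷ m′) (pre ++ e′ ∷ [])
          fy : Adj f y
          fy = next-hit i (rotate pre (subst Cycle eq cy)) (turn pre eq) ee′ ¬ue′
          ue⁺ : Adj u e⁺
          ue⁺ = after (pre ++ e′ ∷ y ∷ e″ ∷ m) e⁺ (trans eq (sym (++-assoc pre (e′ ∷ y ∷ e″ ∷ m) (v ∷ e⁺ ∷ m′)))) ee⁺
            where
            ee⁺ : E e⁺
            ee⁺ with walk-drop (e″ ∷ m) wk
            ... | ve ∷ t with walk-head t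
            ...   | refl = adj-V ve vv

    f⊆e : ∀ {v} → Adj f v → Adj e v
    f⊆e {v} fv with adj? e v
    ... | yes ev = ev
    ... | no ¬ev with f⊆ fv
    ...   | here refl = ⊥-elim (V≢E (adj-E fv ef) ee)
    ...   | there v∈w = ⊥-elim (chain fv ¬ev [] e w refl
              (subst (λ a → Walk a (last cy) (e ∷ w)) (walk-head (walk cy)) (walk cy)) ee ¬ue v∈w)

    exchange-absurd : ⊥
    exchange-absurd = f≢e (extensional ef ee f⊆e)

  isolated-absurd : ∀ {D u f} → Isolated D u f → ⊥
  isolated-absurd i with missed-edge i
  ... | e , e∈ , ee , ¬ue with rotate-to (proj₁ (Isolated.lg i)) e∈
  ...   | [] , c , p with walk c | close c
  ...     | [ _ ] | ee′ = adj-irrefl ee′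
  isolated-absurd i | e , e∈ , ee , ¬ue | _ ∷ _ , c , p = Exchange.exchange-absurd (isolated-↭ i c p) ee ¬ue

-- A longest path outside a longest cycle

module LongestPaths (I : Incidence) where
  open Incidence I
  open Basics I
  open EdgesReach I
  open OutsideCycles I
  open PathEnds I
  open Crossing I

  walk-ends : ∀ {a b Q} → Walk a b Q → Unique Q → 2 ≤ length Q → a ≢ b
  walk-ends [ _ ]   _ (s≤s ())
  walk-ends (e ∷ w) u _ refl = Unique-head∉ u (walk-last∈ w)

  module _ {D} (lg : Longest D) (4≤D : 4 ≤ length D) (D<k : vs D < k) {q} (2≤q : 2 ≤ q)
    (longest : ∀ {a b Q} → PathOff D a b Q → length Q ≤ q) where

    private
      cy : Cycle D
      cy = proj₁ lg

      ℓ<2h : suc (vs D) ≤ h + h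
      ℓ<2h = ≤-trans D<k k≤2h

    saturated-first : ∀ {a b Q} → PathOff D a b Q → length Q ≡ q → Saturated D Q a
    saturated-first {a} {b} {Q} P len {x} ax with x ∈? D | x ∈? Q
    ... | yes x∈D | _       = inj₁ x∈D
    ... | _       | yes x∈Q = inj₂ x∈Q
    ... | no x∉D  | no x∉Q  = ⊥-elim (<-irrefl refl (≤-trans (s≤s (≤-reflexive (sym len)))
          (longest (pathOff (adj-sym ax ∷ pwalk P) (∷-Unique x∉Q (puniq P)) λ { (here refl) → x∉D ; (there p) → off P p }))))

    saturated-last : ∀ {a b Q} → PathOff D a b Q → length Q ≡ q → Saturated D Q b
    saturated-last {Q = Q} P len bx with saturated-first (pathOff-reverse P) (trans (length-reverse Q) len) bx
    ... | inj₁ p = inj₁ p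
    ... | inj₂ p = inj₂ (∈-resp-↭ (↭-reverse Q) p)

    ends : ∀ {a b Q} → PathOff D a b Q → length Q ≡ q → a ≢ b
    ends P len = walk-ends (pwalk P) (puniq P) (subst (2 ≤_) (sym len) 2≤q)

    edge-edge : ∀ {a b Q} → PathOff D a b Q → length Q ≡ q → E a → E b → ⊥
    edge-edge P len = edge-edge-absurd lg 4≤D D<k P (ends P len) (saturated-first P len) (saturated-last P len)

    same-attachments : ∀ {a b Q} → PathOff D a b Q → length Q ≡ q → V a → V b → ∀ {x} → x ∈ D → Adj a x → Adj b x
    same-attachments P len = vertex-vertex-equal lg 4≤D D<k P (ends P len) (saturated-first P len) (saturated-last P len)

    module VertexEnds {a b Q} (P : PathOff D a b Q) (len : length Q ≡ q) (va : V a) (vb : V b) where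

      -- `f` is the edge before `b`, and `l` is `Q` without `b`: a second outside path, now ending
      -- in an edge, to which the charging is applied again.
      module _ {f l} (Q≡ : Q ≡ l ++ b ∷ []) (wf : Walk a f l) (fb : Adj f b) where

        ef : E f
        ef = adj-V (adj-sym fb) vb

        l-unique : Unique (l ++ b ∷ [])
        l-unique = subst Unique Q≡ (puniq P)

        l⊆Q : ∀ {x} → x ∈ l → x ∈ Q
        l⊆Q p = subst (_ ∈_) (sym Q≡) (∈-++⁺ˡ p)

        Pf : PathOff D a f l
        Pf = pathOff wf (Unique-++⁻ˡ l l-unique) (λ p → off P (l⊆Q p))

        q≡l : q ≡ suc (length l)
        q≡l = trans (sym len) (trans (cong length Q≡) (trans (length-++ l) (+-comm (length l) 1)))

        q≡s : q ≡ suc (es Q) + es Q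
        q≡s = trans (sym len) (trans (length-vs-es Q) (cong (_+ es Q) (walk-VV (pwalk P) va vb)))

        1≤s : 1 ≤ es Q
        1≤s with es Q | subst (2 ≤_) q≡s 2≤q
        ... | zero  | s≤s ()
        ... | suc _ | _ = s≤s z≤n

        3≤q : 3 ≤ q
        3≤q = subst (3 ≤_) (sym q≡s) (+-mono-≤ (s≤s 1≤s) 1≤s)

        -- Nodes attached to `a` are attached to `b` too, so two of them are q + 1 apart. A node
        -- attached to `a` and one attached to `f` are only known to be q apart, as `l` is one node
        -- shorter. The potential 1 on the side of `a` moves the unit missing on passages from `a`
        -- to `f` to the passages back, where 2 + (q - 3) + 1 = q.
        spaced : 1 ≤ a # D → 1 ≤ f # D → suc q * (a # D) + 2 * (f # D) + (0 + (q ∸ 3)) ≤ length D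
        spaced = Mixed.mixed lg va ef (suc q) q 2 2 0 (q ∸ 3) 1
          (λ {_} {M} c p az az′ → s≤s (subst (_≤ length M) len (Gaps.gap≠ lg P c p az (same-attachments P len va vb (∈-resp-↭ p (there (∈-insert M))) az′))))
          (λ {_} {M} c p az fz′ → subst (_≤ suc (length M)) (sym q≡l) (s≤s (Gaps.gap≠ lg Pf c p az fz′)))
          (λ {_} {M} c p fz az′ → subst (_≤ suc (length M)) (sym q≡l)
            (s≤s (subst (_≤ length M) (length-reverse l) (Gaps.gap≠ lg (pathOff-reverse Pf) c p fz az′))))
          (λ c p fz fz′ → nonconsecutive c fz fz′)
          (λ {_} {M} c p az → s≤s (subst (_≤ length M) len (Gaps.gap= lg P p az (same-attachments P len va vb (∈-resp-↭ p (here refl)) az))))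
          (λ c p fz → cycle-2≤ c)
          ≤-refl
          (≤-reflexive (trans (+-identityʳ (suc q)) (+-comm 1 q)))
          (≤-reflexive (trans (+-comm (2 + (q ∸ 3)) 1) (m+[n∸m]≡n 3≤q)))

        1≤a : 1 ≤ a # D
        1≤a = vertex-end-reaches lg 4≤D D<k P va (saturated-first P len)

        1≤f : 1 ≤ f # D
        1≤f = reach lg 4≤D ef (off Pf (walk-last∈ wf))

        h≤ : h ≤ a # D + a # Q
        h≤ = V-degree va (saturated-first P len)

        numeric : suc (suc (es Q) + es Q) * (a # D) + 2 * (f # D) + (0 + (suc (es Q) + es Q ∸ 3)) ≤ vs D + vs D
        numeric = ≤-trans (subst (λ n → suc n * (a # D) + 2 * (f # D) + (0 + (n ∸ 3)) ≤ length D) q≡s (spaced 1≤a 1≤f))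
          (≤-reflexive (cycle-length cy))

        f#≤1 : f # D ≤ 1
        f#≤1 = Arithmetic.vertex-single (es Q) (a # D) (f # D) h (vs D) 1≤s 1≤a
          (≤-trans h≤ (+-monoʳ-≤ (a # D) (#-≤es Q va))) ℓ<2h numeric

        full : es Q ≤ a # Q
        full = Arithmetic.vertex-full (es Q) (a # D) (f # D) (a # Q) h (vs D) 1≤s 1≤a 1≤f h≤ ℓ<2h numeric

        module _ {eₐ} (eₐ∈ : eₐ ∈ D) (aeₐ : Adj a eₐ) where

          beₐ : Adj b eₐ
          beₐ = same-attachments P len va vb eₐ∈ aeₐ

          -- In each case `y` becomes an end of a longest outside path: it replaces `b` if it is off
          -- `Q`, and otherwise a Pósa rotation applies, because `full` makes `a` adjacent to every
          -- edge of `Q`. The attachments of `a` and `b` are then inherited by `y`.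
          attached : ∀ {y} → Adj f y → y ∉ D → Adj y eₐ
          attached {y} fy y∉D with y ∈? Q
          ... | no y∉Q = same-attachments
                (pathOff (walk-++ wf fy [ y ])
                  (++-Unique (Unique-++⁻ˡ l l-unique) (∷-Unique (λ ()) []) (λ { p (here refl) → y∉Q (l⊆Q p) }))
                  (λ p → case ∈-++⁻ l p of λ { (inj₁ p′) → off Pf p′ ; (inj₂ (here refl)) → y∉D }))
                (trans (length-++ l) (trans (+-comm (length l) 1) (sym q≡l))) va (adj-E fy ef) eₐ∈ aeₐ
          ... | yes y∈Q with ∈-∃++ y∈Q
          ...   | Q₁ , Q₂ , eq = rotated Q₂ eq
            where
            vy : V y
            vy = adj-E fy ef
            rotated : ∀ Q₂ → Q ≡ Q₁ ++ y ∷ Q₂ → Adj y eₐ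
            rotated [] eq with walk-drop Q₁ (subst (Walk a b) eq (pwalk P))
            ... | [ _ ] = beₐ
            rotated (g ∷ Q₂) eq with walk-drop Q₁ (subst (Walk a b) eq (pwalk P))
            ... | yg ∷ wg with walk-head wg
            ...   | refl = same-attachments (pathOff-reverse P′) (trans (length-reverse Q′) len′) vb vy eₐ∈ beₐ
              where
              Q′ : List Node
              Q′ = reverse (Q₁ ++ y ∷ []) ++ g ∷ Q₂
              perm : Q′ ↭ Q
              perm = ↭-trans (++⁺ʳ (g ∷ Q₂) (↭-reverse (Q₁ ++ y ∷ [])))
                (↭-reflexive (trans (++-assoc Q₁ (y ∷ []) (g ∷ Q₂)) (sym eq)))
              ag : Adj a g
              ag = #-full-es Q va full (subst (g ∈_) (sym eq) (∈-++⁺ʳ Q₁ (there (here refl)))) (adj-V yg vy)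
              P′ : PathOff D y b Q′
              P′ = pathOff (walk-++ (walk-reverse (walk-take Q₁ (subst (Walk a b) eq (pwalk P)))) ag wg)
                (Unique-resp-↭ (↭-sym perm) (puniq P)) (λ p → off P (∈-resp-↭ perm p))
              len′ : length Q′ ≡ q
              len′ = trans (↭-length perm) len

          ee : E eₐ
          ee = adj-V aeₐ va

          -- eₐ would contain the r - 1 vertices of f outside D and both of its neighbours on D.
          overfull : ∀ {v v′} → v ∈ D → v′ ∈ D → v ≢ v′ → Adj eₐ v → Adj eₐ v′ → ⊥
          overfull {v} {v′} v∈ v′∈ v≢v′ ev ev′ = <-irrefl refl (begin-strict
            r                                          ≡⟨ edge-size ef ⟨
            length (nb f)                              ≤⟨ Unique-⊆⇒length≤ (nb-unique f) split ⟩
            length (outer ++ filter (adj? f) D)        ≡⟨ length-++ outer ⟩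
            length outer + f # D                       ≤⟨ +-monoʳ-≤ (length outer) f#≤1 ⟩
            length outer + 1                           ≡⟨ +-comm (length outer) 1 ⟩
            suc (length outer)                         <⟨ ≤-refl ⟩
            length (v ∷ v′ ∷ outer)                    ≤⟨ Unique-⊆⇒length≤ unique sub ⟩
            length (nb eₐ)                             ≡⟨ edge-size ee ⟩
            r                                          ∎)
            where
            open ≤-Reasoning
            outer : List Node
            outer = filter (λ x → ¬? (x ∈? D)) (nb f)
            outer⁻ : ∀ {x} → x ∈ outer → Adj f x × x ∉ D
            outer⁻ x∈ with ∈-filter⁻ (λ x → ¬? (x ∈? D)) {xs = nb f} x∈
            ... | p , x∉ = ∈-nb⁻ p , x∉
            split : ∀ {x} → x ∈ nb f → x ∈ outer ++ filter (adj? f) D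
            split {x} x∈ with x ∈? D
            ... | yes x∈D = ∈-++⁺ʳ outer (∈-filter⁺ (adj? f) x∈D (∈-nb⁻ x∈))
            ... | no  x∉D = ∈-++⁺ˡ (∈-filter⁺ (λ x → ¬? (x ∈? D)) x∈ x∉D)
            unique : Unique (v ∷ v′ ∷ outer)
            unique = ∷-Unique (λ { (here refl) → v≢v′ refl ; (there p) → proj₂ (outer⁻ p) v∈ })
              (∷-Unique (λ p → proj₂ (outer⁻ p) v′∈) (Uniq.filter⁺ (λ x → ¬? (x ∈? D)) (nb-unique f)))
            sub : ∀ {x} → x ∈ v ∷ v′ ∷ outer → x ∈ nb eₐ
            sub (here refl) = ∈-nb⁺ ev
            sub (there (here refl)) = ∈-nb⁺ ev′
            sub (there (there p)) with outer⁻ p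
            ... | fx , x∉ = ∈-nb⁺ (adj-sym (attached fx x∉))

          end-edge-absurd : ⊥
          end-edge-absurd with rotate-to cy eₐ∈
          ... | [] , c , p with subst (4 ≤_) (sym (↭-length p)) 4≤D
          ...   | s≤s ()
          end-edge-absurd | _ ∷ [] , c , p with subst (4 ≤_) (sym (↭-length p)) 4≤D
          ...   | s≤s (s≤s ())
          end-edge-absurd | v ∷ e′ ∷ w , c , p with walk c | close c | uniq c
          ... | ev ∷ (ve′ ∷ wk) | le | u! with walk-head wk
          ...   | refl = overfull (∈-resp-↭ p (there (here refl))) (∈-resp-↭ p (there (there (walk-last∈ wk))))
                    (λ { refl → Unique-head∉ (Unique-++⁻ʳ (eₐ ∷ []) u!) (walk-last∈ wk) }) ev (adj-sym le)

      vertex-vertex-absurd : ⊥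
      vertex-vertex-absurd with walk-snoc-form (pwalk P)
      ... | [] , eq with subst (2 ≤_) (trans (sym len) (cong length eq)) 2≤q
      ...   | s≤s ()
      vertex-vertex-absurd | c ∷ l , eq with walk-unsnoc l (subst (Walk a b) eq (pwalk P))
      ... | _ , f , wf , fb with #-find (1≤a eq wf fb)
      ...   | eₐ , eₐ∈ , aeₐ = end-edge-absurd eq wf fb eₐ∈ aeₐ

    module VertexEdgeEnds {a b Q} (P : PathOff D a b Q) (len : length Q ≡ q) (va : V a) (eb : E b) where

      small : length vertices ≤ suc (vs D)
      small = vertex-edge-tight lg 4≤D D<k P (ends P len) (saturated-first P len) (saturated-last P len) va eb

      vs≤1 : vs Q ≤ 1
      vs≤1 = +-cancelˡ-≤ (vs D) _ _ (≤-trans (vs-bound₂ (uniq cy) (puniq P) (off P)) (≤-trans small (≤-reflexive (+-comm 1 (vs D)))))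

      Q≡ : Q ≡ a ∷ b ∷ []
      Q≡ = two (pwalk P) (≤-trans (≤-reflexive (trans (length-vs-es Q) (cong (vs Q +_) (walk-VE (pwalk P) va eb)))) (+-mono-≤ vs≤1 vs≤1))
        where
        two : ∀ {Q} → Walk a b Q → length Q ≤ 2 → Q ≡ a ∷ b ∷ []
        two [ _ ] _ = ⊥-elim (V≢E va eb)
        two (e ∷ [ _ ]) _ = refl
        two (e ∷ (_ ∷ [ _ ])) (s≤s (s≤s ()))
        two (e ∷ (_ ∷ (_ ∷ _))) (s≤s (s≤s ()))

      P₂ : PathOff D a b (a ∷ b ∷ [])
      P₂ = subst (PathOff D a b) Q≡ P

      in-D-or-b : ∀ {x} → Adj a x → x ≢ b → x ∈ D
      in-D-or-b {x} ax x≢b with saturated-first P len ax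
      ... | inj₁ p = p
      ... | inj₂ p with subst (x ∈_) Q≡ p
      ...   | here refl = ⊥-elim (adj-irrefl ax)
      ...   | there (here refl) = contradiction refl x≢b

      -- Exchanging `e` for `b` gives another longest cycle. The edge `e` misses `a`, since
      -- otherwise the path a b would fit between `e` and `z′`; and `a` is the only vertex off `D`.
      -- So `a` and `e` are isolated with respect to the new cycle.
      no-triple : ∀ {z e z′ R} → Cycle (z ∷ e ∷ z′ ∷ R) → z ∷ e ∷ z′ ∷ R ↭ D → Adj b z → Adj b z′ → ⊥
      no-triple {z} {e} {z′} {R} c p bz bz′ with walk-head (walk c) | walk c | close c | uniq c
      ... | refl | ze ∷ (ez′ ∷ wk) | lz | u! with walk-head wk
      ...   | refl = isolated-absurd record
        { lg = longest-↭ lg c′ (↭-length p) ; D<k = subst (_< k) (trans (sym (vs-↭ p)) vs≡) D<k ; vu = va ; ef = ee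
        ; u∉ = λ { (there (here refl)) → V≢E va eb ; (here refl) → a∉ (∈-resp-↭ p (here refl))
                 ; (there (there q)) → a∉ (∈-resp-↭ p (there (there q))) }
        ; f∉ = λ { (here refl) → adj-irrefl ze ; (there (here refl)) → b∉ (∈-resp-↭ p (there (here refl)))
                 ; (there (there q)) → Unique-head∉ (Unique-++⁻ʳ (z ∷ []) u!) q }
        ; u⊆ = from-a ; f⊆ = from-e }
        where
        a∉ : a ∉ D
        a∉ = off P (walk-first∈ (pwalk P))
        b∉ : b ∉ D
        b∉ = off P (walk-last∈ (pwalk P))
        ee : E e
        ee = adj-V ze (adj-E bz eb)
        ¬ae : ¬ Adj a e
        ¬ae ae = short lg P₂ {M = []} (rotate (z ∷ []) c) (↭-trans (↭-++-comm (e ∷ z′ ∷ R) (z ∷ [])) p) ae bz′ (s≤s z≤n)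
        c′ : Cycle (z ∷ b ∷ z′ ∷ R)
        c′ = record { walk = adj-sym bz ∷ (bz′ ∷ wk) ; close = lz
          ; uniq = Unique-resp-↭ (swap b z ↭-refl) (∷-Unique (λ { (here refl) → b∉ (∈-resp-↭ p (here refl))
              ; (there q) → b∉ (∈-resp-↭ p (there (there q))) })
              (Unique-++⁻ʳ (e ∷ []) (Unique-resp-↭ (swap z e ↭-refl) u!))) }
        vs≡ : vs (z ∷ e ∷ z′ ∷ R) ≡ vs (z ∷ b ∷ z′ ∷ R)
        vs≡ rewrite ee | eb = refl
        shrink : ∀ {x} → x ∈ D → x ≢ e → x ∈ z ∷ b ∷ z′ ∷ R
        shrink x∈ x≢e with ∈-resp-↭ (↭-sym p) x∈
        ... | here refl = here refl
        ... | there (here refl) = contradiction refl x≢e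
        ... | there (there q) = there (there q)
        from-a : ∀ {x} → Adj a x → x ∈ z ∷ b ∷ z′ ∷ R
        from-a {x} ax with x ≟ b
        ... | yes refl = there (here refl)
        ... | no  x≢b  = shrink (in-D-or-b ax x≢b) (λ { refl → ¬ae ax })
        from-e : ∀ {x} → Adj e x → x ∈ z ∷ b ∷ z′ ∷ R
        from-e {x} ex with x ∈? D
        ... | yes x∈ = shrink x∈ (λ { refl → adj-irrefl ex })
        ... | no  x∉ with one-outside (uniq cy) small (adj-E ex ee) va x∉ a∉
        ...   | refl = contradiction (adj-sym ex) ¬ae

      -- Distance two is excluded by `no-triple`, odd distances by the bipartition.
      spread : ∀ {z M z′ R} → Cycle (z ∷ M ++ z′ ∷ R) → z ∷ M ++ z′ ∷ R ↭ D → Adj b z → Adj b z′ → 4 ≤ suc (length M)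
      spread {M = []} c p bz bz′ with nonconsecutive {M = []} c bz bz′
      ... | s≤s ()
      spread {M = e ∷ []} c p bz bz′ = ⊥-elim (no-triple c p bz bz′)
      spread {z} {e ∷ v ∷ []} c p bz bz′ = ⊥-elim (V≢E (adj-E bz′ eb)
        (adj-V (walk-step (walk-drop (z ∷ e ∷ []) (walk c)))
          (adj-E (walk-step (walk-drop (z ∷ []) (walk c))) (adj-V (walk-step (walk c)) (adj-E bz eb)))))
      spread {M = _ ∷ _ ∷ _ ∷ _} c p bz bz′ = s≤s (s≤s (s≤s (s≤s z≤n)))

      vertex-edge-absurd : ⊥
      vertex-edge-absurd = Arithmetic.no-triple (a # D) (b # D) h r (vs D)
        (≤-trans (V-degree va (saturated-first P len)) (+-monoʳ-≤ (a # D) (≤-trans (#-≤es Q va) (≤-trans (≤-reflexive (walk-VE (pwalk P) va eb)) vs≤1))))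
        (≤-trans (edge-degree eb (saturated-last P len)) (+-monoʳ-≤ (b # D) (≤-trans (#-≤vs Q eb) vs≤1)))
        ℓ<2h (≤-trans D<k (≤-trans k≤vertices vertices≤2r)) 3≤r
        -- Passages between the two classes cost |Q| + 1 = 3. A neighbour of `b` weighs 3, not the
        -- full distance 4, since a passage to a neighbour of `a` yields no more. A neighbour of `a`
        -- weighs 2, so a passage from it leaves an exit charge of 1.
        (≤-trans (Mixed.mixed lg va eb 2 3 4 3 1 0 0
          (λ c p az az′ → nonconsecutive c az az′)
          (λ c p az bz′ → s≤s (Gaps.gap≠ lg P₂ c p az bz′))
          (λ c p bz az′ → s≤s (Gaps.gap≠ lg (pathOff-reverse P₂) c p bz az′))
          spread
          (λ c p az → cycle-2≤ c)
          (λ c p bz → subst (4 ≤_) (sym (↭-length p)) 4≤D)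
          (n≤1+n 3) ≤-refl ≤-refl
          (vertex-end-reaches lg 4≤D D<k P va (saturated-first P len))
          (reach lg 4≤D eb (off P (walk-last∈ (pwalk P)))))
          (≤-reflexive (cycle-length cy)))

    longest-path-absurd : ∀ {a b Q} → PathOff D a b Q → length Q ≡ q → ⊥
    longest-path-absurd {a} {b} {Q} P len with isV a in va | isV b in vb
    ... | true  | true  = VertexEnds.vertex-vertex-absurd P len va vb
    ... | true  | false = VertexEdgeEnds.vertex-edge-absurd P len va vb
    ... | false | true  = VertexEdgeEnds.vertex-edge-absurd (pathOff-reverse P) (trans (length-reverse Q) len) vb va
    ... | false | false = edge-edge P len va vb

-- Existence of longest cycles and paths; refuting the absence of a long cycle

module LongCycle (I : Incidence) where
  open Incidence I
  open Basics I
  open OutsideCycles I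
  open PathEnds I
  open Crossing I
  open LongestPaths I

  nodes : List Node
  nodes = vertices ++ edges

  ∈-nodes : ∀ x → x ∈ nodes
  ∈-nodes x with isV x in eq
  ... | true  = ∈-++⁺ˡ (∈-vertices eq)
  ... | false = ∈-++⁺ʳ vertices (∈-edges eq)

  length-≤nodes : ∀ {l} → Unique l → length l ≤ length nodes
  length-≤nodes u = Unique-⊆⇒length≤ u λ {x} _ → ∈-nodes x

  2≤nb : ∀ a → 2 ≤ length (nb a)
  2≤nb a with isV a in eq
  ... | true  = ≤-trans 2≤h (vertex-degree eq)
  ... | false = ≤-trans (≤-trans (n≤1+n 2) 3≤r) (≤-reflexive (sym (edge-size eq)))

  -- Well-founded recursion on n: once all longer lists are refuted, l is a longest one.
  maximal : ∀ {l : List Node} n → length nodes ≤ n + length l → ∀ {l′ : List Node} → Unique l′ →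
    (∀ m → n ≡ suc m → length nodes ≤ m + length l′ → length l < length l′ → ⊥) → length l′ ≤ length l
  maximal zero    bound u rec = ≤-trans (length-≤nodes u) bound
  maximal {l} (suc n) bound {l′} u rec = ≮⇒≥ λ lt → rec n refl
    (≤-trans bound (≤-trans (≤-reflexive (sym (+-suc n (length l)))) (+-monoʳ-≤ n lt))) lt

  module _ {D} (lg : Longest D) (4≤D : 4 ≤ length D) (D<k : vs D < k) where

    outside-path-absurd : ∀ n {a b Q} → PathOff D a b Q → 2 ≤ length Q → length nodes ≤ n + length Q → ⊥
    outside-path-absurd n {Q = Q} P 2≤ bound = longest-path-absurd lg 4≤D D<k 2≤
      (λ P′ → maximal {Q} n bound (puniq P′) λ { m refl b lt → outside-path-absurd m P′ (≤-trans 2≤ (<⇒≤ lt)) b }) P refl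

    fresh : ∀ {xs} (t : Bool) → (∀ {x} → x ∈ xs → isV x ≡ t) → Unique xs →
      length (filter (λ x → isV x BoolP.≟ t) D) < length xs → ∃ λ x → x ∈ xs × x ∉ D
    fresh {xs} t typ u lt with any? (λ x → ¬? (x ∈? D)) xs
    ... | yes some with find some
    ...   | x , x∈ , x∉ = x , x∈ , x∉
    fresh {xs} t typ u lt | no none = ⊥-elim (<-irrefl refl (≤-trans lt (Unique-⊆⇒length≤ u sub)))
      where
      sub : ∀ {x} → x ∈ xs → x ∈ filter (λ x → isV x BoolP.≟ t) D
      sub {x} x∈ with x ∈? D
      ... | yes x∈D = ∈-filter⁺ (λ x → isV x BoolP.≟ t) x∈D (typ x∈)
      ... | no  x∉D = contradiction (lose x∈ x∉D) none

    -- Either a vertex off `D` is adjacent to an edge off `D`, and the two form an outside path; or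
    -- every vertex and every edge off `D` is isolated. Both kinds exist off `D`, which has fewer
    -- than k of each.
    longest-absurd : ⊥
    longest-absurd with any? (λ v → ¬? (v ∈? D) ×-dec any? (λ e → ¬? (e ∈? D)) (nb v)) vertices
    ... | yes some with find some
    ...   | v , v∈ , v∉ , out with find out
    ...     | e , e∈ , e∉ = outside-path-absurd (length nodes)
                (pathOff (∈-nb⁻ e∈ ∷ [ e ]) (∷-Unique (λ { (here refl) → adj-irrefl (∈-nb⁻ e∈) }) (∷-Unique (λ ()) []))
                  λ { (here refl) → v∉ ; (there (here refl)) → e∉ })
                ≤-refl (m≤m+n (length nodes) 2)
    longest-absurd | no none
      with fresh true vertices-V vertices-unique (≤-trans (s≤s (≤-reflexive (sym (vs-filter D)))) (≤-trans D<k k≤vertices))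
         | fresh false edges-E edges-unique (≤-trans (s≤s (≤-reflexive (trans (sym (es-filter D)) (cycle-balance (proj₁ lg))))) (≤-trans D<k k≤edges))
    ... | v , v∈ , v∉ | e , e∈ , e∉ = isolated-absurd record
      { lg = lg ; D<k = D<k ; vu = vertices-V v∈ ; ef = edges-E e∈ ; u∉ = v∉ ; f∉ = e∉
      ; u⊆ = λ {x} vx → vertex-on-D v∈ vx v∉
      ; f⊆ = λ {x} ex → edge-on-D ex }
      where
      vertex-on-D : ∀ {v x} → v ∈ vertices → Adj v x → v ∉ D → x ∈ D
      vertex-on-D {v} {x} v∈ vx v∉ with x ∈? D
      ... | yes x∈ = x∈
      ... | no  x∉ = contradiction (lose v∈ (v∉ , lose (∈-nb⁺ vx) x∉)) none
      edge-on-D : ∀ {x} → Adj e x → x ∈ D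
      edge-on-D {x} ex with x ∈? D
      ... | yes x∈ = x∈
      ... | no  x∉ = contradiction (vertex-on-D (∈-vertices (adj-E ex (edges-E e∈))) (adj-sym ex) x∉) e∉

  module _ (none : ∀ {D} → Cycle D → k ≤ vs D → ⊥) where

    cycle-absurd : ∀ n {D} → Cycle D → 4 ≤ length D → length nodes ≤ n + length D → ⊥
    cycle-absurd n {D} c 4≤ bound = longest-absurd
      (c , λ c′ → maximal {D} n bound (uniq c′) λ { m refl b lt → cycle-absurd m c′ (≤-trans 4≤ (<⇒≤ lt)) b })
      4≤ (≰⇒> (none c))

    -- This supplies the initial cycle: a longest path of the whole graph is closed up at its first
    -- node, whose two or more neighbours force at least four nodes.
    path-absurd : ∀ n {a b Q} → PathOff [] a b Q → length nodes ≤ n + length Q → ⊥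
    path-absurd n {a} {Q = Q} P bound with close-path (pwalk P) (puniq P) (nb-unique a) (≤-trans (s≤s z≤n) (2≤nb a)) in-Q
      where
      in-Q : ∀ {x} → x ∈ nb a → x ∈ Q × Adj a x
      in-Q {x} x∈ with x ∈? Q
      ... | yes x∈Q = x∈Q , ∈-nb⁻ x∈
      ... | no  x∉Q = ⊥-elim (<-irrefl refl (maximal {Q} n bound (∷-Unique x∉Q (puniq P)) λ { m refl b lt →
              path-absurd m (pathOff (adj-sym (∈-nb⁻ x∈) ∷ pwalk P) (∷-Unique x∉Q (puniq P)) (λ _ ())) b }))
    ... | K , cK , _ , 2nb≤K = cycle-absurd (length nodes) cK (≤-trans (+-mono-≤ (2≤nb a) (2≤nb a)) 2nb≤K) (m≤m+n (length nodes) (length K))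

    no-long-cycle-absurd : 1 ≤ k → ⊥
    no-long-cycle-absurd 1≤k with edges | k≤edges
    ... | []    | k≤0 = <-irrefl refl (≤-trans 1≤k k≤0)
    ... | e ∷ _ | _   = path-absurd (length nodes) (pathOff [ e ] (∷-Unique (λ ()) []) (λ _ ())) (m≤m+n (length nodes) 1)

-- Deciding the existence of a long cycle

module CycleSearch (I : Incidence) where
  open Incidence I
  open Basics I
  open LongCycle I using (nodes; length-≤nodes; ∈-nodes)

  walk-from? : ∀ a l → Dec (∃ λ b → Walk a b (a ∷ l))
  walk-from? a [] = yes (a , [ a ])
  walk-from? a (x ∷ l) with adj? a x | walk-from? x l
  ... | yes ax | yes (b , w) = yes (b , ax ∷ w)
  ... | no ¬ax | _           = no λ { (b , w) → ¬ax (walk-step w) }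
  ... | _      | no none     = no λ { (b , w) → none (b , walk-drop (a ∷ []) w) }

  walk-last-unique : ∀ {a b a′ b′ l} → Walk a b l → Walk a′ b′ l → b ≡ b′
  walk-last-unique [ _ ]   [ _ ]     = refl
  walk-last-unique (e ∷ w) (e′ ∷ w′) = walk-last-unique w w′

  cycle? : ∀ l → Dec (Cycle l)
  cycle? [] = no λ c → case walk c of λ ()
  cycle? (a ∷ l) with walk-from? a l | allPairs? (λ x y → ¬? (x ≟ y)) (a ∷ l)
  ... | no none | _ = no λ c → none (last c , subst (λ x → Walk x (last c) (a ∷ l)) (walk-head (walk c)) (walk c))
  ... | _ | no ¬u = no λ c → ¬u (uniq c)
  ... | yes (b , w) | yes u with adj? b a
  ...   | yes ba = yes record { walk = w ; close = ba ; uniq = u }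
  ...   | no ¬ba = no λ c → ¬ba (subst₂ Adj (walk-last-unique (walk c) w) (walk-head (walk c)) (close c))

  search : ∀ N {P : List Node → Set} → (∀ l → Dec (P l)) → Dec (∃ λ l → length l ≤ N × P l)
  search zero P? = map′ (λ p → [] , z≤n , p) (λ { ([] , _ , p) → p }) (P? [])
  search (suc N) {P} P? with P? [] | any? (λ x → search N (λ l → P? (x ∷ l))) nodes
  ... | yes p | _ = yes ([] , z≤n , p)
  ... | no _ | yes some with find some
  ...   | x , _ , l , le , p = yes (x ∷ l , s≤s le , p)
  search (suc N) {P} P? | no ¬p | no none = no λ where
    ([] , _ , p)         → ¬p p
    (x ∷ l , s≤s le , p) → none (lose (∈-nodes x) (l , le , p))

  long-cycle? : Dec (∃ λ D → Cycle D × k ≤ vs D)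
  long-cycle? = map′ (λ (D , _ , p) → D , p) (λ (D , c , p) → D , length-≤nodes (uniq c) , c , p)
    (search (length nodes) (λ D → cycle? D ×-dec (k ≤? vs D)))

long-cycle : (I : Incidence) → let open Incidence I; open Basics I in 1 ≤ k → ∃ λ D → Cycle D × k ≤ vs D
long-cycle I 1≤k with CycleSearch.long-cycle? I
... | yes c = c
... | no none = ⊥-elim (LongCycle.no-long-cycle-absurd I (λ c p → none (_ , c , p)) 1≤k)

-- From hypergraphs to incidence graphs and back

filter-∈-suc : ∀ {n} s (p : Subset n) l → length (filter (_∈ˢ? (s ∷ p)) (map suc l)) ≡ length (filter (_∈ˢ? p) l)
filter-∈-suc s p [] = refl
filter-∈-suc s p (x ∷ l) with does (x ∈ˢ? p)
... | true  = cong suc (filter-∈-suc s p l)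
... | false = filter-∈-suc s p l

length-filter-∈ : ∀ {n} (p : Subset n) → length (filter (_∈ˢ? p) (allFin n)) ≡ ∣ p ∣
length-filter-∈ [] = refl
length-filter-∈ {suc n} (s ∷ p) = cases s
  where
  tail≡ : ∀ s → length (filter (_∈ˢ? (s ∷ p)) (tabulate suc)) ≡ ∣ p ∣
  tail≡ s = trans (cong (λ l → length (filter (_∈ˢ? (s ∷ p)) l)) (sym (map-tabulate (λ x → x) suc)))
    (trans (filter-∈-suc s p (allFin n)) (length-filter-∈ p))
  cases : ∀ s → length (filter (_∈ˢ? (s ∷ p)) (allFin (suc n))) ≡ ∣ s ∷ p ∣
  cases inside  = cong suc (tail≡ inside)
  cases outside = tail≡ outside

≤-halves : ∀ m → m ≤ suc (m / 2 + m / 2)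
≤-halves m = begin
  m                        ≡⟨ m≡m%n+[m/n]*n m 2 ⟩
  m % 2 + m / 2 * 2        ≤⟨ +-monoˡ-≤ (m / 2 * 2) (s≤s⁻¹ (m%n<n m 2)) ⟩
  suc (m / 2 * 2)          ≡⟨ cong suc (double (m / 2)) ⟩
  suc (m / 2 + m / 2)      ∎
  where
  open ≤-Reasoning
  double : ∀ x → x * 2 ≡ x + x
  double = solve-∀

module FromHypergraph {n k r : ℕ} (r≤k : r ≤ k) (k≤n : k ≤ n) (3≤r : 3 ≤ r) (t<r : (n ∸ 1) / 2 < r)
  (H : Hypergraph n) (uniform : Uniform r H) (k≤m : k ≤ m H) (dense : MinDegreeAtLeast H ⌈ k /2⌉) where

  HNode : Set
  HNode = Fin n ⊎ Fin (m H)

  HAdj : HNode → HNode → Set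
  HAdj (inj₁ v) (inj₂ e) = v Subset.∈ edge H e
  HAdj (inj₂ e) (inj₁ v) = v Subset.∈ edge H e
  HAdj _        _        = ⊥

  hadj? : ∀ a b → Dec (HAdj a b)
  hadj? (inj₁ v) (inj₂ e) = v ∈ˢ? edge H e
  hadj? (inj₂ e) (inj₁ v) = v ∈ˢ? edge H e
  hadj? (inj₁ _) (inj₁ _) = no λ ()
  hadj? (inj₂ _) (inj₂ _) = no λ ()

  hisV : HNode → Bool
  hisV (inj₁ _) = true
  hisV (inj₂ _) = false

  hgraph : BipartiteGraph
  hgraph = record
    { Node = HNode ; _≟_ = ⊎-≡-dec FinP._≟_ FinP._≟_ ; isV = hisV ; Adj = HAdj ; adj? = hadj?
    ; adj-sym  = λ { {inj₁ _} {inj₂ _} p → p ; {inj₂ _} {inj₁ _} p → p }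
    ; adj-flip = λ { {inj₁ _} {inj₂ _} p → refl ; {inj₂ _} {inj₁ _} p → refl } }

  incident : Fin n → List (Fin (m H))
  incident v = filter (λ i → v ∈ˢ? edge H i) (allFin (m H))

  members : Fin (m H) → List (Fin n)
  members e = filter (_∈ˢ? edge H e) (allFin n)

  neighbours : HNode → List HNode
  neighbours (inj₁ v) = map inj₂ (incident v)
  neighbours (inj₂ e) = map inj₁ (members e)

  neighbours-unique : ∀ a → Unique (neighbours a)
  neighbours-unique (inj₁ v) = Uniq.map⁺ inj₂-injective (Uniq.filter⁺ _ (Uniq.allFin⁺ (m H)))
  neighbours-unique (inj₂ e) = Uniq.map⁺ inj₁-injective (Uniq.filter⁺ _ (Uniq.allFin⁺ n))

  neighbours⁺ : ∀ {a b} → HAdj a b → b ∈ neighbours a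
  neighbours⁺ {inj₁ v} {inj₂ e} p = ∈-map⁺ inj₂ (∈-filter⁺ (λ i → v ∈ˢ? edge H i) (∈-allFin e) p)
  neighbours⁺ {inj₂ e} {inj₁ v} p = ∈-map⁺ inj₁ (∈-filter⁺ (_∈ˢ? edge H e) (∈-allFin v) p)

  neighbours⁻ : ∀ {a b} → b ∈ neighbours a → HAdj a b
  neighbours⁻ {inj₁ v} b∈ with ∈-map⁻ inj₂ b∈
  ... | e , e∈ , refl = proj₂ (∈-filter⁻ (λ i → v ∈ˢ? edge H i) {xs = allFin (m H)} e∈)
  neighbours⁻ {inj₂ e} b∈ with ∈-map⁻ inj₁ b∈
  ... | v , v∈ , refl = proj₂ (∈-filter⁻ (_∈ˢ? edge H e) {xs = allFin n} v∈)

  extensional : ∀ {e f} → hisV e ≡ false → hisV f ≡ false → (∀ {v} → HAdj e v → HAdj f v) → e ≡ f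
  extensional {inj₂ e} {inj₂ f} _ _ sub = cong inj₂ (edges-distinct H (⊆-antisym e⊆f f⊆e))
    where
    e⊆f : edge H e Subset.⊆ edge H f
    e⊆f {v} = sub {inj₁ v}
    f⊆e : edge H f Subset.⊆ edge H e
    f⊆e {v} v∈f with v ∈ˢ? edge H e
    ... | yes v∈e = v∈e
    ... | no  v∉e = ⊥-elim (<-irrefl (trans (uniform e) (sym (uniform f))) (p⊂q⇒∣p∣<∣q∣ (e⊆f , v , v∈f , v∉e)))

  k≤2h : k ≤ ⌈ k /2⌉ + ⌈ k /2⌉
  k≤2h = s≤s⁻¹ (≤-trans (≤-reflexive (+-comm 1 k)) (≤-halves (k + 1)))

  n≤2r : n ≤ r + r
  n≤2r = begin
    n                                            ≤⟨ m≤n+m∸n n 1 ⟩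
    suc (n ∸ 1)                                  ≤⟨ s≤s (≤-halves (n ∸ 1)) ⟩
    suc (suc ((n ∸ 1) / 2 + (n ∸ 1) / 2))        ≡⟨ cong suc (+-suc ((n ∸ 1) / 2) ((n ∸ 1) / 2)) ⟨
    suc ((n ∸ 1) / 2) + suc ((n ∸ 1) / 2)        ≤⟨ +-mono-≤ t<r t<r ⟩
    r + r                                        ∎
    where open ≤-Reasoning

  incidence : Incidence
  incidence = record
    { graph = hgraph ; r = r ; h = ⌈ k /2⌉ ; k = k
    ; nb = neighbours ; nb-unique = neighbours-unique ; ∈-nb⁺ = neighbours⁺ ; ∈-nb⁻ = neighbours⁻
    ; vertices = map inj₁ (allFin n) ; edges = map inj₂ (allFin (m H))
    ; ∈-vertices = λ { {inj₁ v} _ → ∈-map⁺ inj₁ (∈-allFin v) }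
    ; ∈-edges = λ { {inj₂ e} _ → ∈-map⁺ inj₂ (∈-allFin e) }
    ; vertices-V = λ v∈ → case ∈-map⁻ inj₁ v∈ of λ { (_ , _ , refl) → refl }
    ; edges-E = λ e∈ → case ∈-map⁻ inj₂ e∈ of λ { (_ , _ , refl) → refl }
    ; vertices-unique = Uniq.map⁺ inj₁-injective (Uniq.allFin⁺ n)
    ; edges-unique = Uniq.map⁺ inj₂-injective (Uniq.allFin⁺ (m H))
    ; edge-size = λ { {inj₂ e} _ → trans (length-map inj₁ (members e)) (trans (length-filter-∈ (edge H e)) (uniform e)) }
    ; vertex-degree = λ { {inj₁ v} _ → ≤-trans (dense v) (≤-reflexive (sym (length-map inj₂ (incident v)))) }
    ; extensional = extensional
    ; 3≤r = 3≤r
    ; 2≤h = /-monoˡ-≤ 2 (+-monoˡ-≤ 1 (≤-trans 3≤r r≤k))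
    ; k≤2h = k≤2h
    ; vertices≤2r = ≤-trans (≤-reflexive (size n inj₁)) n≤2r
    ; k≤vertices = ≤-trans k≤n (≤-reflexive (sym (size n inj₁)))
    ; k≤edges = ≤-trans k≤m (≤-reflexive (sym (size (m H) inj₂))) }
    where
    size : ∀ {A : Set} N (f : Fin N → A) → length (map f (allFin N)) ≡ N
    size N f = trans (length-map f (allFin N)) (length-tabulate (λ x → x))

  open Basics incidence

  flatten : List (Fin n × Fin (m H)) → List HNode
  flatten []             = []
  flatten ((v , e) ∷ ps) = inj₁ v ∷ inj₂ e ∷ flatten ps

  -- The pairs (vᵢ , eᵢ) of a Berge path whose last edge also contains w.
  data Closed (w : Fin n) : List (Fin n × Fin (m H)) → Set where
    end  : ∀ {v e} → v Subset.∈ edge H e → w Subset.∈ edge H e → Closed w ((v , e) ∷ [])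
    link : ∀ {v e v′ e′ ps} → v Subset.∈ edge H e → v′ Subset.∈ edge H e →
      Closed w ((v′ , e′) ∷ ps) → Closed w ((v , e) ∷ (v′ , e′) ∷ ps)

  pair-up : ∀ {v b w l} → Walk (inj₁ v) b l → HAdj b (inj₁ w) → ∃ λ ps → l ≡ flatten ps × Closed w ps
  pair-up {b = inj₂ e} (_∷_ {b = inj₂ e} ve [ _ ]) bw = (_ , e) ∷ [] , refl , end ve bw
  pair-up (_∷_ {b = inj₂ e} ve (_∷_ {b = inj₁ v′} ev′ wk)) bw with pair-up wk bw
  ... | (v″ , e″) ∷ ps , refl , cl with walk-head wk
  ...   | refl = (_ , e) ∷ (v″ , e″) ∷ ps , refl , link ve ev′ cl

  vs-flatten : ∀ ps → vs (flatten ps) ≡ length ps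
  vs-flatten []       = refl
  vs-flatten (p ∷ ps) = cong suc (vs-flatten ps)

  ∈-flatten : ∀ {p} ps → p ∈ ps → inj₁ (proj₁ p) ∈ flatten ps × inj₂ (proj₂ p) ∈ flatten ps
  ∈-flatten (p ∷ ps) (here refl) = here refl , there (here refl)
  ∈-flatten (p ∷ ps) (there q) with ∈-flatten ps q
  ... | x , y = there (there x) , there (there y)

  verts-distinct : ∀ ps → Unique (flatten ps) → AllPairs (λ p q → proj₁ p ≢ proj₁ q) ps
  verts-distinct []       u              = []
  verts-distinct (p ∷ ps) (v∉ ∷ (_ ∷ u)) =
    All.tabulate (λ q∈ eq → All.lookup v∉ (there (proj₁ (∈-flatten ps q∈))) (cong inj₁ eq)) ∷ verts-distinct ps u

  edges-distinct′ : ∀ ps → Unique (flatten ps) → AllPairs (λ p q → proj₂ p ≢ proj₂ q) ps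
  edges-distinct′ []       u              = []
  edges-distinct′ (p ∷ ps) (_ ∷ (e∉ ∷ u)) =
    All.tabulate (λ q∈ eq → All.lookup e∉ (proj₂ (∈-flatten ps q∈)) (cong inj₂ eq)) ∷ edges-distinct′ ps u

  lookup-injective : ∀ {A B : Set} (g : A → B) xs → AllPairs (λ x y → g x ≢ g y) xs →
    Injective _≡_ _≡_ (λ i → g (lookup xs i))
  lookup-injective g (x ∷ xs) (p ∷ ps) {zero}  {zero}  eq = refl
  lookup-injective g (x ∷ xs) (p ∷ ps) {zero}  {suc j} eq = contradiction eq (All.lookup p (∈-lookup j))
  lookup-injective g (x ∷ xs) (p ∷ ps) {suc i} {zero}  eq = contradiction (sym eq) (All.lookup p (∈-lookup i))
  lookup-injective g (x ∷ xs) (p ∷ ps) {suc i} {suc j} eq = cong suc (lookup-injective g xs ps eq)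

  closed-in : ∀ {w ps} → Closed w ps → ∀ i → proj₁ (lookup ps i) Subset.∈ edge H (proj₂ (lookup ps i))
  closed-in (end v∈ _)     zero    = v∈
  closed-in (link v∈ _ _)  zero    = v∈
  closed-in (link _ _ cl)  (suc i) = closed-in cl i

  -- Index 0 stands for `w`, the first vertex of the whole cycle, and not for the head of `ps`. In
  -- the recursion over tails `next` wraps around to index 0 of the tail, where the first vertex of
  -- the cycle is still the one required. On the whole list the two readings agree.
  successor : Fin n → (ps : List (Fin n × Fin (m H))) → Fin (length ps) → Fin n
  successor w (_ ∷ ps) zero    = w
  successor w ps@(_ ∷ _) (suc j) = proj₁ (lookup ps (suc j))

  closed-next : ∀ {w ps} → Closed w ps → ∀ i → successor w ps (next i) Subset.∈ edge H (proj₂ (lookup ps i))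
  closed-next (end _ w∈)    zero = w∈
  closed-next (link _ v∈ _) zero = v∈
  closed-next (link _ _ cl) (suc i) with next i | closed-next cl i
  ... | zero  | p = p
  ... | suc j | p = p

  berge : ∀ {v e ps} → Closed v ((v , e) ∷ ps) → Unique (flatten ((v , e) ∷ ps)) → BergeCycle H (length ((v , e) ∷ ps))
  berge {v} {e} {ps} cl u = record
    { vert = λ i → proj₁ (lookup qs i)
    ; edg  = λ i → proj₂ (lookup qs i)
    ; vert-distinct = lookup-injective proj₁ qs (verts-distinct qs u)
    ; edg-distinct  = lookup-injective proj₂ qs (edges-distinct′ qs u)
    ; vert-in = closed-in cl
    ; next-in = λ i → subst (Subset._∈ edge H (proj₂ (lookup qs i))) (head-first (next i)) (closed-next cl i) }
    where
    qs : List (Fin n × Fin (m H))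
    qs = (v , e) ∷ ps
    head-first : ∀ j → successor v qs j ≡ proj₁ (lookup qs j)
    head-first zero    = refl
    head-first (suc j) = refl

  -- Started at a vertex, the nodes pair up as (vᵢ , eᵢ), and the closing adjacency puts the first
  -- vertex into the last edge.
  berge-cycle : ∀ {D} → Cycle D → BergeCycle H (vs D)
  berge-cycle {D} c with has-V c
    where
    has-V : Cycle D → ∃ λ v → inj₁ v ∈ D
    has-V c with first c in fc | last c in lc | close c
    ... | inj₁ v | _      | _ = v , subst (_∈ D) fc (walk-first∈ (walk c))
    ... | inj₂ _ | inj₁ v | _ = v , subst (_∈ D) lc (walk-last∈ (walk c))
  ... | v , v∈ with rotate-to c v∈
  ...   | w , c′ , p with walk-head (walk c′)
  ...     | refl with pair-up (walk c′) (close c′)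
  ...       | (v′ , e) ∷ ps , refl , cl = subst (BergeCycle H)
              (trans (sym (vs-flatten ((v′ , e) ∷ ps))) (Crossing.vs-↭ incidence p)) (berge cl (uniq c′))

  circumference : CircumferenceAtLeast H k
  circumference with long-cycle incidence (≤-trans (≤-trans (s≤s z≤n) 3≤r) r≤k)
  ... | D , c , k≤ = vs D , k≤ , berge-cycle c

theorem1p9 : (n k r : ℕ) → 1 ≤ r → r ≤ k → k ≤ n → 3 ≤ r → (n ∸ 1) / 2 < r →
    (H : Hypergraph n) → Uniform r H → k ≤ m H → MinDegreeAtLeast H ⌈ k /2⌉ →
    CircumferenceAtLeast H k
theorem1p9 n k r _ r≤k k≤n 3≤r t<r H uniform k≤m dense =
  FromHypergraph.circumference r≤k k≤n 3≤r t<r H uniform k≤m dense
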